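{- If $n\geq 9$, then $R(S_n[5],W_8)=2n-1$.
   Context: All graphs are finite and simple. For graphs $G,H$, $R(G,H)$ is the smallest $N$ such that every graph $F$ of order $N$ either contains $G$ as a subgraph or has complement $\overline{F}$ containing $H$. $W_8$ is the wheel of order 9 (a hub joined to every vertex of a cycle $C_8$). $S_k$ is the star of order $k$. $S_n[5]$ is the tree of order $n$ obtained by adding an edge joining the center of $S_{n-5}$ to a degree-one vertex of $S_5$. -}

module Defs where

open import Data.Nat using (ℕ; zero; suc; _∸_; _≤_; _≡ᵇ_; _≤ᵇ_)
open import Data.Bool using (Bool; true; false; not; _∧_; _∨_)
open import Data.Bool.Properties using (∨-comm)
open import Data.Fin using (Fin; toℕ)
open import Data.Fin.Properties using (_≟_)
open import Data.Product using (Σ; _×_; ∃)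
open import Function.Definitions using (Injective)
open import Relation.Nullary using (¬_; does)
open import Relation.Nullary.Decidable using (dec-true)
open import Relation.Binary.PropositionalEquality using (_≡_; refl; cong; cong₂)

record Graph (n : ℕ) : Set where
  field
    adj    : Fin n → Fin n → Bool
    sym    : ∀ i j → adj i j ≡ adj j i
    irrefl : ∀ i → adj i i ≡ false
open Graph public

_==ᶠ_ : ∀ {n} → Fin n → Fin n → Bool
i ==ᶠ j = does (i ≟ j)

mkGraph : ∀ {n} → (Fin n → Fin n → Bool) → Graph n
mkGraph {n} r = record { adj = a ; sym = s ; irrefl = ir }
  where
    a : Fin n → Fin n → Bool
    a i j = not (i ==ᶠ j) ∧ (r i j ∨ r j i)
    eqsym : ∀ (i j : Fin n) → (i ==ᶠ j) ≡ (j ==ᶠ i)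
    eqsym i j with i ≟ j | j ≟ i
    ... | Relation.Nullary.yes _ | Relation.Nullary.yes _ = refl
    ... | Relation.Nullary.no _  | Relation.Nullary.no _  = refl
    ... | Relation.Nullary.yes p | Relation.Nullary.no q = Data.Empty.⊥-elim (q (Relation.Binary.PropositionalEquality.sym p))
      where import Data.Empty
    ... | Relation.Nullary.no q  | Relation.Nullary.yes p = Data.Empty.⊥-elim (q (Relation.Binary.PropositionalEquality.sym p))
      where import Data.Empty
    s : ∀ i j → a i j ≡ a j i
    s i j = cong₂ (λ x y → not x ∧ y) (eqsym i j) (∨-comm (r i j) (r j i))
    ir : ∀ i → a i i ≡ false
    ir i rewrite dec-true (i ≟ i) refl = refl

complement : ∀ {n} → Graph n → Graph n
complement G = mkGraph (λ i j → not (adj G i j))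

_⊆_ : ∀ {k N} → Graph k → Graph N → Set
_⊆_ {k} {N} G F =
  Σ (Fin k → Fin N) λ f →
    Injective _≡_ _≡_ f × (∀ u v → adj G u v ≡ true → adj F (f u) (f v) ≡ true)

RamseyProp : ∀ {g h} → Graph g → Graph h → ℕ → Set
RamseyProp G H N = (F : Graph N) → G ⊆ F ⊎' H ⊆ complement F
  where
    open import Data.Sum using () renaming (_⊎_ to _⊎'_)

IsRamseyNumber : ∀ {g h} → Graph g → Graph h → ℕ → Set
IsRamseyNumber G H N = RamseyProp G H N × (∀ M → RamseyProp G H M → N ≤ M)

star : (k : ℕ) → Graph k
star k = mkGraph (λ i j → toℕ i ≡ᵇ 0)

W8 : Graph 9
W8 = mkGraph (λ i j → e (toℕ i) (toℕ j))
  where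
    e : ℕ → ℕ → Bool
    e a b = (a ≡ᵇ 0) ∨ ((1 ≤ᵇ a) ∧ (suc a ≡ᵇ b) ∧ (b ≤ᵇ 8)) ∨ ((a ≡ᵇ 8) ∧ (b ≡ᵇ 1))

-- S_n[5]: order n.  Vertex 0 is the centre of S_{n-5}, with leaves
-- 1,…,n-6; vertex n-4 is the centre of S_5 with leaves n-5, n-3, n-2, n-1;
-- the extra edge joins 0 to the S_5-leaf n-5.
Sn5 : (n : ℕ) → Graph n
Sn5 n = mkGraph (λ i j → e (toℕ i) (toℕ j))
  where
    e : ℕ → ℕ → Bool
    e a b = ((a ≡ᵇ 0) ∧ (1 ≤ᵇ b) ∧ (b ≤ᵇ (n ∸ 5)))
          ∨ ((a ≡ᵇ (n ∸ 4)) ∧ ((n ∸ 5) ≤ᵇ b) ∧ not (b ≡ᵇ (n ∸ 4)))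

-- Colour the edges of F red and those of its complement blue.  If a vertex v has red degree at least n − 5, then the
-- absence of the red tree centred at v severely limits the red degrees of all other vertices into the red neighbourhood
-- A and the blue neighbourhood B of v.  A blue C₈ in some blue neighbourhood then comes from Dirac's theorem (each of
-- eight vertices has at most three red neighbours among them), from Jackson's theorem on bipartite graphs or from a
-- K₄,₄; otherwise n vertices span a graph with all blue degrees at most 3, and that contains the red tree.
-- If all red degrees are at most n − 6, then the ends h and a of a blue edge have a set P of at least nine common blue
-- neighbours.  A blue path on seven vertices of P closes through a to a C₈ in the blue neighbourhood of h.  It exists
-- unless seven vertices of P have at most five blue neighbours in P; such vertices have few red neighbours outside P,
-- and four of them lie on a C₈ which alternates between P and the rest of the neighbourhood of h (or of a).
-- For the lower bound, two disjoint red cliques of order n − 1 leave a bipartite blue graph.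
module Submission where

open import Defs hiding (sym)
open import Data.Bool using (Bool; true; false; T; not; _∧_; _∨_; if_then_else_)
open import Data.Bool.Properties using (T-∧; ∧-identityʳ; ∧-zeroʳ; ∨-zeroʳ) renaming (_≟_ to _≟ᵇ_)
open import Data.Empty using (⊥; ⊥-elim)
open import Data.Fin as Fin using (Fin; zero; suc; toℕ)
open import Data.Fin.Patterns
open import Data.Fin.Properties as Finₚ using (_≟_; any?; all?)
open import Data.Integer as ℤ using (ℤ; -[1+_]) renaming (+_ to ⁺)
open import Data.List as List using (List; []; _∷_; _++_; length)
open import Data.List.Properties using (length-++; length-tabulate; ++-identityʳ)
open import Data.List.Relation.Unary.All as All using (All; []; _∷_)
open import Data.List.Relation.Unary.All.Properties as Allₚ using ()
open import Data.List.Relation.Unary.AllPairs using (AllPairs; []; _∷_; allPairs?)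
import Data.List.Relation.Unary.AllPairs.Properties as AllPairsₚ
open import Data.List.Relation.Unary.Unique.Propositional using (Unique)
import Data.List.Relation.Unary.Unique.Propositional.Properties as Uniqueₚ
open import Data.Maybe using (Maybe; just; nothing)
open import Data.Nat using (ℕ; zero; suc; _+_; _*_; _∸_; _≤_; _<_; _≤ᵇ_; _<ᵇ_; _≡ᵇ_; z≤n; s≤s)
open import Data.Nat.Properties as ℕₚ hiding (_≟_)
open import Data.Nat.Tactic.RingSolver using (solve-∀)
open import Data.Product using (_×_; _,_; proj₁; proj₂; ∃)
open import Data.Sum using (_⊎_; inj₁; inj₂; [_,_]′)
open import Data.Unit using (⊤; tt)
open import Data.Vec as Vec using (Vec; []; _∷_; lookup)
open import Data.Vec.N-ary using (N-ary; _$ⁿ_)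
open import Data.Vec.Properties using (length-toList; lookup-map; lookup∘tabulate)
open import Function using (_∘_; id; case_of_)
open import Function.Bundles using (Equivalence)
open import Relation.Binary.PropositionalEquality using (_≡_; _≢_; refl; sym; trans; cong; cong₂; subst; subst₂)
open import Relation.Nullary using (¬_; Dec; yes; no; does; ¬?)
open import Relation.Nullary.Decidable using (True; toWitness; _×-dec_; _⊎-dec_; _→-dec_; map′)

-- Linear arithmetic over ℕ

-- The red tree centred at v needs n - 5 red neighbours of v apart from the second centre x and its
-- three leaves. If v has n - 5 + k red neighbours, then k of them may be spent elsewhere: one on x,
-- if vx is red, and one on each leaf of x taken from A, whereas leaves taken from B cost nothing.
-- This budget explains the cases: from k = 3 on it pays for three leaves in A when x lies in B,
-- from k = 4 on also when x lies in A, and for k ≤ 2 only vertices with enough red neighbours in B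
-- are controlled. When all red degrees are at most n - 6, all blue degrees are at least n + 4, and
-- the number nine is 2(n + 4) - (2n - 1). The bound of five blue neighbours in P balances two
-- needs: six are enough to prolong a path on five vertices at both ends, and a vertex with at most
-- five has spent at least |P| - 6 red edges inside P. Trees and wheels in a finite colouring can be
-- searched for, so that arguing by contradiction is constructive here. The many small estimates go
-- to a verified procedure for linear arithmetic.

data Expr (k : ℕ) : Set where
  K   : ℕ → Expr k
  var : Fin k → Expr k
  _⊕_ : Expr k → Expr k → Expr k

data Atomic (k : ℕ) : Set where
  _≼_ _≐_ : Expr k → Expr k → Atomic k

infixl 7 _⊕_
infix 6 _≼_ _≐_ _≺_
infix 2 _⊢_ _⊢⊥

_≺_ : ∀ {k} → Expr k → Expr k → Atomic k
a ≺ b = K 1 ⊕ a ≼ b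

data Sequent (k : ℕ) : Set where
  _⊢_ : List (Atomic k) → Atomic k → Sequent k
  _⊢⊥ : List (Atomic k) → Sequent k

module _ {k : ℕ} (ρ : Vec ℕ k) where

  ⟦_⟧ᵉ : Expr k → ℕ
  ⟦ K c ⟧ᵉ   = c
  ⟦ var i ⟧ᵉ = lookup ρ i
  ⟦ a ⊕ b ⟧ᵉ = ⟦ a ⟧ᵉ + ⟦ b ⟧ᵉ

  ⟦_⟧ᵃ : Atomic k → Set
  ⟦ a ≼ b ⟧ᵃ = ⟦ a ⟧ᵉ ≤ ⟦ b ⟧ᵉ
  ⟦ a ≐ b ⟧ᵃ = ⟦ a ⟧ᵉ ≡ ⟦ b ⟧ᵉ

  _⟹_ : List (Atomic k) → Set → Set
  []       ⟹ G = G
  (a ∷ as) ⟹ G = ⟦ a ⟧ᵃ → as ⟹ G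

  ⟦_⟧ˢ : Sequent k → Set
  ⟦ as ⊢ g ⟧ˢ = as ⟹ ⟦ g ⟧ᵃ
  ⟦ as ⊢⊥  ⟧ˢ = as ⟹ ⊥

Normal : ℕ → Set
Normal k = ℕ × Vec ℕ k

Inequality : ℕ → Set
Inequality k = Normal k × Normal k

dot : ∀ {k} → Vec ℕ k → Vec ℕ k → ℕ
dot []       []       = 0
dot (c ∷ cs) (x ∷ xs) = c * x + dot cs xs

⟦_⟧ⁿ : ∀ {k} → Normal k → Vec ℕ k → ℕ
⟦ c , cs ⟧ⁿ ρ = c + dot cs ρ

_⊞_ : ∀ {k} → Normal k → Normal k → Normal k
(c , cs) ⊞ (d , ds) = c + d , Vec.zipWith _+_ cs ds

_⊡_ : ∀ {k} → ℕ → Normal k → Normal k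
m ⊡ (c , cs) = m * c , Vec.map (m *_) cs

unit : ∀ {k} → Fin k → Vec ℕ k
unit zero    = 1 ∷ Vec.replicate _ 0
unit (suc i) = 0 ∷ unit i

normalise : ∀ {k} → Expr k → Normal k
normalise (K c)   = c , Vec.replicate _ 0
normalise (var i) = 0 , unit i
normalise (a ⊕ b) = normalise a ⊞ normalise b

dot-zero : ∀ {k} (ρ : Vec ℕ k) → dot (Vec.replicate k 0) ρ ≡ 0
dot-zero []      = refl
dot-zero (x ∷ ρ) = dot-zero ρ

dot-unit : ∀ {k} (i : Fin k) (ρ : Vec ℕ k) → dot (unit i) ρ ≡ lookup ρ i
dot-unit zero    (x ∷ ρ) = trans (cong₂ _+_ (*-identityˡ x) (dot-zero ρ)) (+-identityʳ x)
dot-unit (suc i) (x ∷ ρ) = dot-unit i ρ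

dot-+ : ∀ {k} (cs ds ρ : Vec ℕ k) → dot (Vec.zipWith _+_ cs ds) ρ ≡ dot cs ρ + dot ds ρ
dot-+ []       []       []      = refl
dot-+ (c ∷ cs) (d ∷ ds) (x ∷ ρ) =
  trans (cong (_+_ ((c + d) * x)) (dot-+ cs ds ρ)) (shuffle c d x (dot cs ρ) (dot ds ρ))
  where
  shuffle : ∀ c d x s t → (c + d) * x + (s + t) ≡ c * x + s + (d * x + t)
  shuffle = solve-∀

dot-* : ∀ {k} m (cs ρ : Vec ℕ k) → dot (Vec.map (m *_) cs) ρ ≡ m * dot cs ρ
dot-* m []       []      = sym (*-zeroʳ m)
dot-* m (c ∷ cs) (x ∷ ρ) = trans (cong (_+_ (m * c * x)) (dot-* m cs ρ)) (shuffle m c x (dot cs ρ))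
  where
  shuffle : ∀ m c x s → m * c * x + m * s ≡ m * (c * x + s)
  shuffle = solve-∀

⊞-correct : ∀ {k} (a b : Normal k) ρ → ⟦ a ⊞ b ⟧ⁿ ρ ≡ ⟦ a ⟧ⁿ ρ + ⟦ b ⟧ⁿ ρ
⊞-correct (c , cs) (d , ds) ρ = trans (cong (_+_ (c + d)) (dot-+ cs ds ρ)) (shuffle c d _ _)
  where
  shuffle : ∀ c d s t → c + d + (s + t) ≡ c + s + (d + t)
  shuffle = solve-∀

⊡-correct : ∀ {k} m (a : Normal k) ρ → ⟦ m ⊡ a ⟧ⁿ ρ ≡ m * ⟦ a ⟧ⁿ ρ
⊡-correct m (c , cs) ρ = trans (cong (_+_ (m * c)) (dot-* m cs ρ)) (sym (*-distribˡ-+ m c _))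

normalise-correct : ∀ {k} (e : Expr k) ρ → ⟦ normalise e ⟧ⁿ ρ ≡ ⟦ ρ ⟧ᵉ e
normalise-correct (K c)   ρ = trans (cong (_+_ c) (dot-zero ρ)) (+-identityʳ c)
normalise-correct (var i) ρ = dot-unit i ρ
normalise-correct (a ⊕ b) ρ =
  trans (⊞-correct (normalise a) (normalise b) ρ) (cong₂ _+_ (normalise-correct a ρ) (normalise-correct b ρ))

inequalities : ∀ {k} → List (Atomic k) → List (Inequality k)
inequalities []             = []
inequalities (a ≼ b ∷ as) = (normalise a , normalise b) ∷ inequalities as
inequalities (a ≐ b ∷ as) =
  (normalise a , normalise b) ∷ (normalise b , normalise a) ∷ inequalities as

combine : ∀ {k} → List ℕ → List (Inequality k) → Inequality k
combine (m ∷ ms) ((l , r) ∷ is) =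
  let (ls , rs) = combine ms is in (m ⊡ l) ⊞ ls , (m ⊡ r) ⊞ rs
combine _ _ = (0 , Vec.replicate _ 0) , (0 , Vec.replicate _ 0)

_≤ᵛ_ : ∀ {k} → Vec ℕ k → Vec ℕ k → Bool
[]       ≤ᵛ []       = true
(c ∷ cs) ≤ᵛ (d ∷ ds) = (c ≤ᵇ d) ∧ (cs ≤ᵛ ds)

dot-mono : ∀ {k} (cs ds ρ : Vec ℕ k) → T (cs ≤ᵛ ds) → dot cs ρ ≤ dot ds ρ
dot-mono []       []       []      _ = z≤n
dot-mono (c ∷ cs) (d ∷ ds) (x ∷ ρ) t = let (p , q) = Equivalence.to T-∧ t in
  +-mono-≤ (*-monoˡ-≤ x (≤ᵇ⇒≤ c d p)) (dot-mono cs ds ρ q)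

-- Variables take values in ℕ, so a left side with the larger constant and nowhere a smaller
-- coefficient always exceeds the right side.
contradictory : ∀ {k} → Inequality k → Bool
contradictory ((c , cs) , (d , ds)) = (d <ᵇ c) ∧ (ds ≤ᵛ cs)

contradictory-sound : ∀ {k} (i : Inequality k) ρ → T (contradictory i) →
  ¬ (⟦ proj₁ i ⟧ⁿ ρ ≤ ⟦ proj₂ i ⟧ⁿ ρ)
contradictory-sound ((c , cs) , (d , ds)) ρ t = let (p , q) = Equivalence.to T-∧ t in
  <⇒≱ (+-mono-<-≤ (<ᵇ⇒< d c p) (dot-mono ds cs ρ q))

-- The dual simplex method with a zero objective and Bland's rule.  Only its outcome, the multipliers of the
-- inequalities in a contradictory combination, is verified.
module Search where

  record Row : Set where
    constructor row
    field
      basic        : ℕ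
      denominator  : ℤ
      constant     : ℤ
      coefficients : List ℤ

  -- A row stands for  denominator * basic = constant + Σ coefficients * nonbasic.
  record Dictionary : Set where
    constructor dictionary
    field
      nonbasic : List ℕ
      rows     : List Row

  positive negative : ℤ → Bool
  positive (⁺ 0) = false
  positive (⁺ _) = true
  positive _       = false
  negative (⁺ _) = false
  negative _       = true

  least : ∀ {A : Set} → List (ℕ × A) → Maybe (ℕ × A)
  least []             = nothing
  least ((i , a) ∷ is) with least is
  ... | nothing      = just (i , a)
  ... | just (j , b) = if i <ᵇ j then just (i , a) else just (j , b)

  leaving : List Row → List (ℕ × Row)
  leaving []       = []
  leaving (r ∷ rs) = if negative (Row.constant r) then (Row.basic r , r) ∷ leaving rs else leaving rs

  entering : ℕ → List ℕ → List ℤ → List (ℕ × ℕ)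
  entering p (i ∷ is) (c ∷ cs) = if positive c then (i , p) ∷ entering (suc p) is cs else entering (suc p) is cs
  entering p _        _        = []

  nth : ℕ → List ℤ → ℤ
  nth _       []       = ⁺ 0
  nth zero    (c ∷ cs) = c
  nth (suc p) (c ∷ cs) = nth p cs

  replace : ∀ {A : Set} → ℕ → A → List A → List A
  replace _       a []       = []
  replace zero    a (c ∷ cs) = a ∷ cs
  replace (suc p) a (c ∷ cs) = c ∷ replace p a cs

  -- Cross-multiplication keeps all rows integral. The entering coefficient `t` is positive, so
  -- denominators remain positive.
  pivot : ℕ → ℕ → Row → Dictionary → Dictionary
  pivot i p (row s d b ts) (dictionary ns rs) = dictionary (replace p s ns) (List.map update rs)
    where
    t : ℤ
    t = nth p ts
    update : Row → Row
    update (row s′ d′ b′ ts′) with nth p ts′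
    ... | t′ = if s ≡ᵇ s′
      then row i t (ℤ.- b) (replace p d (List.map ℤ.-_ ts))
      else row s′ (t ℤ.* d′) (t ℤ.* b′ ℤ.- t′ ℤ.* b)
             (replace p (t′ ℤ.* d) (List.zipWith (λ x y → t ℤ.* y ℤ.- t′ ℤ.* x) ts ts′))

  solve : ℕ → Dictionary → Maybe (List ℕ × Row)
  solve zero       _ = nothing
  solve (suc fuel) δ@(dictionary ns rs) with least (leaving rs)
  ... | nothing      = nothing
  ... | just (_ , r) with least (entering 0 ns (Row.coefficients r))
  -- A negative constant without positive coefficients is impossible for nonnegative variables: the
  -- row is a Farkas certificate.
  ...   | nothing      = just (ns , r)
  ...   | just (i , p) = solve fuel (pivot i p r δ)

  multiplier : ℕ → List ℕ → List ℤ → ℕ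
  multiplier s (i ∷ is) (c ∷ cs) = if s ≡ᵇ i then ℤ.∣ c ∣ else multiplier s is cs
  multiplier s _        _        = 0

  initial : ∀ {k} → ℕ → List (Inequality k) → List Row
  initial s []                            = []
  initial s (((c , cs) , (d , ds)) ∷ is) =
    row s (⁺ 1) (⁺ d ℤ.- ⁺ c) (List.zipWith (λ x y → ⁺ y ℤ.- ⁺ x) (Vec.toList cs) (Vec.toList ds))
    ∷ initial (suc s) is

multipliers : ∀ {k} → List (Inequality k) → List ℕ
multipliers {k} is with Search.solve 100 (Search.dictionary (List.upTo k) (Search.initial k is))
-- With no multipliers `combine` gives 0 ≤ 0, so a failed search only makes `refuted` false.
... | nothing                       = []
... | just (ns , Search.row s d _ ts) =
  -- Indices below `k` are the original variables; `k + i` is the slack of the inequality number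
  -- `i`.
  List.map (λ i → Search.multiplier (k + i) (s ∷ ns) (d ∷ ts)) (List.upTo (length is))

refuted : ∀ {k} → List (Atomic k) → Bool
refuted as = let is = inequalities as in contradictory (combine (multipliers is) is)

module _ {k : ℕ} (ρ : Vec ℕ k) where

  Holds : Inequality k → Set
  Holds (l , r) = ⟦ l ⟧ⁿ ρ ≤ ⟦ r ⟧ⁿ ρ

  data AllHold : List (Inequality k) → Set where
    []  : AllHold []
    _∷_ : ∀ {i is} → Holds i → AllHold is → AllHold (i ∷ is)

  zero-holds : Holds ((0 , Vec.replicate _ 0) , (0 , Vec.replicate _ 0))
  zero-holds = ≤-refl

  combine-holds : ∀ ms {is} → AllHold is → Holds (combine ms is)
  combine-holds []       {_}               hs       = zero-holds
  combine-holds (m ∷ ms) {[]}              []       = zero-holds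
  combine-holds (m ∷ ms) {(l , r) ∷ is} (h ∷ hs) =
    let (ls , rs) = combine ms is in
    subst₂ _≤_ (sym (trans (⊞-correct (m ⊡ l) ls ρ) (cong (_+ ⟦ ls ⟧ⁿ ρ) (⊡-correct m l ρ))))
               (sym (trans (⊞-correct (m ⊡ r) rs ρ) (cong (_+ ⟦ rs ⟧ⁿ ρ) (⊡-correct m r ρ))))
               (+-mono-≤ (*-monoʳ-≤ m h) (combine-holds ms hs))

  normalised : ∀ a b → ⟦ ρ ⟧ᵉ a ≤ ⟦ ρ ⟧ᵉ b → Holds (normalise a , normalise b)
  normalised a b = subst₂ _≤_ (sym (normalise-correct a ρ)) (sym (normalise-correct b ρ))

  data Hypotheses : List (Atomic k) → Set where
    []  : Hypotheses []
    _∷_ : ∀ {a as} → ⟦ ρ ⟧ᵃ a → Hypotheses as → Hypotheses (a ∷ as)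

  all-hold : ∀ {as} → Hypotheses as → AllHold (inequalities as)
  all-hold []                    = []
  all-hold (_∷_ {a ≼ b} h hs) = normalised a b h ∷ all-hold hs
  all-hold (_∷_ {a ≐ b} h hs) =
    normalised a b (≤-reflexive h) ∷ normalised b a (≤-reflexive (sym h)) ∷ all-hold hs

  refuted-sound : ∀ as → Hypotheses as → T (refuted as) → ⊥
  refuted-sound as hs t = let is = inequalities as in
    contradictory-sound (combine (multipliers is) is) ρ t (combine-holds (multipliers is) (all-hold hs))

  curry : ∀ as {G : Set} → (Hypotheses as → G) → _⟹_ ρ as G
  curry []       f = f []
  curry (a ∷ as) f = λ h → curry as (λ hs → f (h ∷ hs))

  provable : Sequent k → Bool
  provable (as ⊢ a ≼ b) = refuted (b ≺ a ∷ as)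
  provable (as ⊢ a ≐ b) = refuted (b ≺ a ∷ as) ∧ refuted (a ≺ b ∷ as)
  provable (as ⊢⊥)      = refuted as

  sound : ∀ s → T (provable s) → ⟦ ρ ⟧ˢ s
  sound (as ⊢ a ≼ b) t = curry as λ hs →
    ≮⇒≥ λ lt → refuted-sound (b ≺ a ∷ as) (lt ∷ hs) t
  sound (as ⊢ a ≐ b) t = let (p , q) = Equivalence.to T-∧ t in curry as λ hs →
    ≤-antisym (≮⇒≥ λ lt → refuted-sound (b ≺ a ∷ as) (lt ∷ hs) p)
              (≮⇒≥ λ lt → refuted-sound (a ≺ b ∷ as) (lt ∷ hs) q)
  sound (as ⊢⊥) t = curry as λ hs → refuted-sound as hs t

variables : ∀ k → Vec (Expr k) k
variables k = Vec.tabulate var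

-- The function `f` serves to name the variables. The test does not look at the values in `ρ`, so it
-- evaluates to `true` during type checking and the implicit argument is filled in.
linear : ∀ {k} (ρ : Vec ℕ k) (f : N-ary k (Expr k) (Sequent k)) →
  {T (provable ρ (f $ⁿ variables k))} → ⟦ ρ ⟧ˢ (f $ⁿ variables k)
linear {k} ρ f {t} = sound ρ (f $ⁿ variables k) t

-- Counting in subsets of Fin N

Sub : ℕ → Set
Sub N = Fin N → Bool

infix 4 _∈_ _∉_
_∈_ _∉_ : ∀ {N} → Fin N → Sub N → Set
x ∈ p = p x ≡ true
x ∉ p = p x ≡ false

infixl 7 _∩_ _∖_
_∩_ _∖_ : ∀ {N} → Sub N → Sub N → Sub N
(p ∩ q) x = p x ∧ q x
(p ∖ q) x = p x ∧ not (q x)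

∅ : ∀ {N} → Sub N
∅ _ = false

⟪_⟫ : ∀ {N} → List (Fin N) → Sub N
⟪ [] ⟫     x = false
⟪ y ∷ ys ⟫ x = (x ==ᶠ y) ∨ ⟪ ys ⟫ x

decide : ∀ b → b ≡ true ⊎ b ≡ false
decide true  = inj₁ refl
decide false = inj₂ refl

true≢false : ∀ {b} → b ≡ true → b ≡ false → ⊥
true≢false refl ()

∧-intro : ∀ {a b} → a ≡ true → b ≡ true → a ∧ b ≡ true
∧-intro refl refl = refl

∧-left : ∀ {a b} → a ∧ b ≡ true → a ≡ true
∧-left {true} _ = refl

∧-right : ∀ {a b} → a ∧ b ≡ true → b ≡ true
∧-right {true} h = h

not-intro : ∀ {b} → b ≡ false → not b ≡ true
not-intro refl = refl

not-elim : ∀ {b} → not b ≡ true → b ≡ false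
not-elim {false} _ = refl

∖-intro : ∀ {a b} → a ≡ true → b ≡ false → a ∧ not b ≡ true
∖-intro refl refl = refl

∖-right : ∀ {a b} → a ∧ not b ≡ true → b ≡ false
∖-right {true} h = not-elim h

==-refl : ∀ {N} (x : Fin N) → (x ==ᶠ x) ≡ true
==-refl x with x ≟ x
... | yes _ = refl
... | no ≢  = ⊥-elim (≢ refl)

==-true : ∀ {N} (x y : Fin N) → (x ==ᶠ y) ≡ true → x ≡ y
==-true x y _ with x ≟ y
... | yes e = e

==-false : ∀ {N} {x y : Fin N} → (x ==ᶠ y) ≡ false → x ≢ y
==-false {x = x} h refl = true≢false (==-refl x) h

≢-false : ∀ {N} {x y : Fin N} → x ≢ y → (x ==ᶠ y) ≡ false
≢-false {x = x} {y} ≢ with x ≟ y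
... | yes e = ⊥-elim (≢ e)
... | no _  = refl

separate : ∀ {N} (p : Sub N) {x y} → x ∈ p → y ∉ p → x ≢ y
separate p h k refl = true≢false h k

∉⟪⟫ : ∀ {N} {x : Fin N} {ys} → All (x ≢_) ys → x ∉ ⟪ ys ⟫
∉⟪⟫ []       = refl
∉⟪⟫ (h ∷ hs) rewrite ≢-false h = ∉⟪⟫ hs

∉⟪⟫⁻ : ∀ {N} {x : Fin N} ys → x ∉ ⟪ ys ⟫ → All (x ≢_) ys
∉⟪⟫⁻ []       h = []
∉⟪⟫⁻ {x = x} (y ∷ ys) h with decide (x ==ᶠ y)
... | inj₁ e rewrite e = case h of λ ()
... | inj₂ e rewrite e = ==-false e ∷ ∉⟪⟫⁻ ys h

∈⟪⟫ : ∀ {N} {P : Fin N → Set} {x : Fin N} {ys} → All P ys → x ∈ ⟪ ys ⟫ → P x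
∈⟪⟫ {P = P} {x} {y ∷ ys} (h ∷ hs) e with decide (x ==ᶠ y)
... | inj₁ t = subst P (sym (==-true x y t)) h
... | inj₂ t rewrite t = ∈⟪⟫ hs e

-- The rules for covers, packings and overlaps are pointwise inequalities between such indicators,
-- summed over all vertices.
ι : Bool → ℕ
ι true  = 1
ι false = 0

infix 8 #_
#_ : ∀ {N} → Sub N → ℕ
#_ {zero}  p = 0
#_ {suc N} p = ι (p zero) + # (p ∘ suc)

#-additive : ∀ {N} (p q r s : Sub N) → (∀ x → ι (p x) + ι (q x) ≤ ι (r x) + ι (s x)) →
  # p + # q ≤ # r + # s
#-additive {zero}  p q r s h = z≤n
#-additive {suc N} p q r s h =
  linear (ι (p zero) ∷ ι (q zero) ∷ ι (r zero) ∷ ι (s zero) ∷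
          # (p ∘ suc) ∷ # (q ∘ suc) ∷ # (r ∘ suc) ∷ # (s ∘ suc) ∷ [])
    (λ p₀ q₀ r₀ s₀ p q r s → p₀ ⊕ q₀ ≼ r₀ ⊕ s₀ ∷ p ⊕ q ≼ r ⊕ s ∷ [] ⊢ p₀ ⊕ p ⊕ (q₀ ⊕ q) ≼ r₀ ⊕ r ⊕ (s₀ ⊕ s))
    (h zero) (#-additive (p ∘ suc) (q ∘ suc) (r ∘ suc) (s ∘ suc) (h ∘ suc))

#-none : ∀ N → # (∅ {N}) ≡ 0
#-none zero    = refl
#-none (suc N) = #-none N

+#∅ : ∀ N m → m + # (∅ {N}) ≡ m
+#∅ N m = trans (cong (_+_ m) (#-none N)) (+-identityʳ m)

#-all : ∀ {N} → # (λ (_ : Fin N) → true) ≡ N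
#-all {zero}  = refl
#-all {suc N} = cong suc (#-all {N})

#-cover : ∀ {N} (p q r : Sub N) → (∀ x → x ∈ p → x ∈ q ⊎ x ∈ r) → # p ≤ # q + # r
#-cover {N} p q r h = subst (_≤ # q + # r) (+#∅ N (# p))
  (#-additive p ∅ q r λ x → pointwise (p x) (q x) (r x) (h x))
  where
  pointwise : ∀ a b c → (a ≡ true → b ≡ true ⊎ c ≡ true) → ι a + 0 ≤ ι b + ι c
  pointwise false b     c     h = z≤n
  pointwise true  true  c     h = s≤s z≤n
  pointwise true  false true  h = s≤s z≤n
  pointwise true  false false h with h refl
  ... | inj₁ ()
  ... | inj₂ ()

#-mono : ∀ {N} (p q : Sub N) → (∀ x → x ∈ p → x ∈ q) → # p ≤ # q
#-mono {N} p q h = subst (# p ≤_) (+#∅ N (# q))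
  (#-cover p q ∅ λ x → inj₁ ∘ h x)

#-pack : ∀ {N} (p q r : Sub N) → (∀ x → x ∈ p → x ∈ r) → (∀ x → x ∈ q → x ∈ r) →
  (∀ x → x ∈ p → x ∉ q) → # p + # q ≤ # r
#-pack {N} p q r f g d = subst (# p + # q ≤_) (+#∅ N (# r))
  (#-additive p q r ∅ λ x → pointwise (p x) (q x) (r x) (f x) (g x) (d x))
  where
  pointwise : ∀ a b c → (a ≡ true → c ≡ true) → (b ≡ true → c ≡ true) → (a ≡ true → b ≡ false) →
    ι a + ι b ≤ ι c + 0
  pointwise false false c f g d = z≤n
  pointwise true  b     c f g d rewrite d refl | f refl = s≤s z≤n
  pointwise false true  c f g d rewrite g refl = s≤s z≤n

#-overlap : ∀ {N} (p q s : Sub N) → (∀ x → x ∈ p → x ∈ s) → (∀ x → x ∈ q → x ∈ s) →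
  # p + # q ≤ # (p ∩ q) + # s
#-overlap p q s f g = #-additive p q (p ∩ q) s λ x → pointwise (p x) (q x) (s x) (f x) (g x)
  where
  pointwise : ∀ a b c → (a ≡ true → c ≡ true) → (b ≡ true → c ≡ true) → ι a + ι b ≤ ι (a ∧ b) + ι c
  pointwise false false c f g = z≤n
  pointwise false true  c f g rewrite g refl = s≤s z≤n
  pointwise true  false c f g rewrite f refl = s≤s z≤n
  pointwise true  true  c f g rewrite f refl = s≤s (s≤s z≤n)

#-split : ∀ {N} (p q : Sub N) → # p ≡ # (p ∩ q) + # (p ∖ q)
#-split p q = ≤-antisym
  (#-cover p (p ∩ q) (p ∖ q) λ x h → [ (λ t → inj₁ (∧-intro h t)) , (λ f → inj₂ (∖-intro h f)) ]′ (decide (q x)))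
  (#-pack (p ∩ q) (p ∖ q) p (λ x → ∧-left) (λ x → ∧-left)
    λ x h → trans (cong (λ b → p x ∧ not b) (∧-right {p x} h)) (∧-zeroʳ (p x)))

#-single : ∀ {N} (y : Fin N) → # (_==ᶠ y) ≡ 1
#-single {suc N} zero    = cong suc (#-none N)
#-single {suc N} (suc y) = ≤-antisym
  (subst (# ((_==ᶠ suc y) ∘ suc) ≤_) (#-single y) (#-mono ((_==ᶠ suc y) ∘ suc) (_==ᶠ y) λ x h →
    trans (cong (_==ᶠ y) (Finₚ.suc-injective (==-true (suc x) (suc y) h))) (==-refl y)))
  (subst (_≤ # ((_==ᶠ suc y) ∘ suc)) (#-single y) (#-mono (_==ᶠ y) ((_==ᶠ suc y) ∘ suc) λ x h →
    trans (cong (λ z → suc z ==ᶠ suc y) (==-true x y h)) (==-refl (suc y))))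

#-list : ∀ {N} (xs : List (Fin N)) → # ⟪ xs ⟫ ≤ length xs
#-list {N} []   = ≤-reflexive (#-none N)
#-list (y ∷ ys) = ≤-trans
  (#-cover ⟪ y ∷ ys ⟫ (_==ᶠ y) ⟪ ys ⟫ λ x h → ∨-cases (x ==ᶠ y) h)
  (+-mono-≤ (≤-reflexive (#-single y)) (#-list ys))
  where
  ∨-cases : ∀ a {b} → a ∨ b ≡ true → a ≡ true ⊎ b ≡ true
  ∨-cases true  _ = inj₁ refl
  ∨-cases false h = inj₂ h

#-remove : ∀ {N} (p : Sub N) xs → # p ≤ # (p ∖ ⟪ xs ⟫) + length xs
#-remove p xs = ≤-trans
  (#-cover p (p ∖ ⟪ xs ⟫) ⟪ xs ⟫ λ x h → [ inj₂ , inj₁ ∘ ∖-intro h ]′ (decide (⟪ xs ⟫ x)))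
  (+-monoʳ-≤ (# (p ∖ ⟪ xs ⟫)) (#-list xs))

search : ∀ {N} (p : Sub N) → (∃ λ x → x ∈ p) ⊎ (∀ x → x ∉ p)
search p with any? (λ x → p x ≟ᵇ true)
... | yes h = inj₁ h
... | no ¬h = inj₂ λ x → [ (λ t → ⊥-elim (¬h (x , t))) , id ]′ (decide (p x))

#-empty : ∀ {N} (p : Sub N) → (∀ x → x ∉ p) → # p ≡ 0
#-empty {N} p h = n≤0⇒n≡0 (subst (# p ≤_) (#-none N) (#-mono p ∅ λ x t → ⊥-elim (true≢false t (h x))))

#-inhabited : ∀ {N} (p : Sub N) → 1 ≤ # p → ∃ λ x → x ∈ p
#-inhabited p h with search p
... | inj₁ w = w
... | inj₂ e = ⊥-elim (case subst (1 ≤_) (#-empty p e) h of λ ())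

#-positive : ∀ {N} (p : Sub N) {x} → x ∈ p → 1 ≤ # p
#-positive p {x} h = subst (_≤ # p) (#-single x) (#-mono (_==ᶠ x) p λ y e → trans (cong p (==-true y x e)) h)

pick : ∀ {N} (p : Sub N) xs → length xs < # p → ∃ λ x → x ∈ p × All (x ≢_) xs
pick p xs h = let (x , m) = #-inhabited (p ∖ ⟪ xs ⟫) positive in x , ∧-left m , ∉⟪⟫⁻ xs (∖-right {p x} m)
  where
  positive : 1 ≤ # (p ∖ ⟪ xs ⟫)
  positive = linear (# p ∷ # (p ∖ ⟪ xs ⟫) ∷ length xs ∷ [])
    (λ p q l → l ≺ p ∷ p ≼ q ⊕ l ∷ [] ⊢ K 1 ≼ q) h (#-remove p xs)

-- Nested pairs instead of `All`, so that the inequalities can be taken apart by a `let` pattern.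
Away : ∀ {N} → Fin N → List (Fin N) → Set
Away x []       = ⊤
Away x (y ∷ ys) = x ≢ y × Away x ys

pick′ : ∀ {N} (p : Sub N) xs → length xs < # p → ∃ λ x → x ∈ p × Away x xs
pick′ p xs h = let (x , x∈ , d) = pick p xs h in x , x∈ , away d
  where
  away : ∀ {x xs} → All (x ≢_) xs → Away x xs
  away []       = tt
  away (h ∷ hs) = h , away hs

-- The avoided vertices are part of `fresh`, so that consecutive choices yield one duplicate-free
-- list.
record Choice {N} (p : Sub N) (avoid : List (Fin N)) (k : ℕ) : Set where
  constructor chosen
  field
    elements : Vec (Fin N) k
    members  : All (_∈ p) (Vec.toList elements)
    fresh    : Unique (Vec.toList elements ++ avoid)

choose : ∀ {N} (p : Sub N) k {xs} → Unique xs → k + length xs ≤ # p → Choice p xs k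
choose p zero    u h = chosen [] [] u
choose p (suc k) {xs} u h = extend (choose p k u (≤-trans (n≤1+n _) h))
  where
  extend : Choice p xs k → Choice p xs (suc k)
  extend (chosen ys m f) =
    let (y , y∈ , d) = pick p (Vec.toList ys ++ xs)
          (subst (_< # p) (sym (trans (length-++ (Vec.toList ys)) (cong (_+ length xs) (length-toList ys)))) h)
    in chosen (y ∷ ys) (y∈ ∷ m) (d ∷ f)

count : ∀ {N} → Sub N → List (Fin N) → ℕ
count p []       = 0
count p (x ∷ xs) = ι (p x) + count p xs

count-≤ : ∀ {N} (p : Sub N) {xs} → Unique xs → count p xs ≤ # p
count-≤ p [] = z≤n
count-≤ p {x ∷ xs} (d ∷ u) =
  linear (ι (p x) ∷ # (p ∩ (_==ᶠ x)) ∷ # (p ∖ (_==ᶠ x)) ∷ # p ∷ count (p ∖ (_==ᶠ x)) xs ∷ count p xs ∷ [])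
    (λ i a b c s t → c ≐ a ⊕ b ∷ i ≼ a ∷ s ≼ b ∷ t ≐ s ∷ [] ⊢ i ⊕ t ≼ c)
    (#-split p (_==ᶠ x)) (ι≤ (decide (p x))) (count-≤ (p ∖ (_==ᶠ x)) u) (same xs d)
  where
  ι≤ : p x ≡ true ⊎ p x ≡ false → ι (p x) ≤ # (p ∩ (_==ᶠ x))
  ι≤ (inj₁ t) = subst (λ b → ι b ≤ # (p ∩ (_==ᶠ x))) (sym t) (#-positive (p ∩ (_==ᶠ x)) (∧-intro t (==-refl x)))
  ι≤ (inj₂ f) = subst (λ b → ι b ≤ # (p ∩ (_==ᶠ x))) (sym f) z≤n
  same : ∀ ys → All (x ≢_) ys → count p ys ≡ count (p ∖ (_==ᶠ x)) ys
  same []       []       = refl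
  same (y ∷ ys) (h ∷ hs) = cong₂ _+_ (cong ι (sym (trans (cong (λ b → p y ∧ not b) (≢-false (h ∘ sym)))
    (∧-identityʳ (p y))))) (same ys hs)

length-≤ : ∀ {N} (p : Sub N) {xs} → Unique xs → All (_∈ p) xs → length xs ≤ # p
length-≤ p {xs} u m = subst (_≤ # p) (full xs m) (count-≤ p u)
  where
  full : ∀ xs → All (_∈ p) xs → count p xs ≡ length xs
  full []       []       = refl
  full (x ∷ xs) (h ∷ hs) rewrite h = cong suc (full xs hs)

#-list-of : ∀ {N} {xs : List (Fin N)} → Unique xs → length xs ≤ # ⟪ xs ⟫
#-list-of {xs = xs} u = length-≤ ⟪ xs ⟫ u (members xs)
  where
  weaken : ∀ y {xs zs} → All (_∈ ⟪ xs ⟫) zs → All (_∈ ⟪ y ∷ xs ⟫) zs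
  weaken y {xs} = All.map λ {z} h → trans (cong ((z ==ᶠ y) ∨_) h) (∨-zeroʳ (z ==ᶠ y))
  members : ∀ xs → All (_∈ ⟪ xs ⟫) xs
  members []       = []
  members (x ∷ xs) = cong (_∨ ⟪ xs ⟫ x) (==-refl x) ∷ weaken x {xs} (members xs)

-- Red trees and blue wheels in two-coloured complete graphs

record Colouring (N : ℕ) : Set where
  field
    red blue : Fin N → Sub N
    red-sym  : ∀ x y → red x y ≡ red y x
    blue-sym : ∀ x y → blue x y ≡ blue y x
    red-irr  : ∀ x → x ∉ red x
    blue-irr : ∀ x → x ∉ blue x
    colour   : ∀ x y → x ≢ y → y ∈ red x ⊎ y ∈ blue x
    red⇒¬blue : ∀ x y → y ∈ red x → y ∉ blue x

next : Fin 8 → Fin 8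
next = lookup (1F ∷ 2F ∷ 3F ∷ 4F ∷ 5F ∷ 6F ∷ 7F ∷ 0F ∷ [])

IsInjective : ∀ {k} {A : Set} → (Fin k → A) → Set
IsInjective c = ∀ i j → c i ≡ c j → i ≡ j

injective? : ∀ {k m} (π : Vec (Fin m) k) → Dec (IsInjective (lookup π))
injective? π = all? λ i → all? λ j → (lookup π i ≟ lookup π j) →-dec (i ≟ j)

unique? : ∀ {k} (is : List (Fin k)) → Dec (Unique is)
unique? = allPairs? λ i j → ¬? (i ≟ j)

lookup-all : ∀ {A : Set} {P : A → Set} {k} (xs : Vec A k) → All P (Vec.toList xs) → ∀ i → P (lookup xs i)
lookup-all (x ∷ xs) (p ∷ ps) zero    = p
lookup-all (x ∷ xs) (p ∷ ps) (suc i) = lookup-all xs ps i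

-- The Hamiltonian cycles of a 4 × 6 bipartite graph, up to the choice of the order of the four vertices

allᵛ : ∀ k → (Vec Bool k → Bool) → Bool
allᵛ zero    f = f []
allᵛ (suc k) f = allᵛ k (f ∘ (true ∷_)) ∧ allᵛ k (f ∘ (false ∷_))

allᵛ-sound : ∀ k f → allᵛ k f ≡ true → ∀ v → f v ≡ true
allᵛ-sound zero    f h []          = h
allᵛ-sound (suc k) f h (true ∷ v)  = allᵛ-sound k (f ∘ (true ∷_)) (∧-left h) v
allᵛ-sound (suc k) f h (false ∷ v) = allᵛ-sound k (f ∘ (false ∷_)) (∧-right {allᵛ k (f ∘ (true ∷_))} h) v

weight : ∀ {k} → Vec Bool k → ℕ
weight []      = 0
weight (b ∷ v) = ι b + weight v

-- Up to rotation and reflection, four vertices have three cyclic orders.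
order : Fin 3 → Fin 4 → Fin 4
order o = lookup (lookup ((0F ∷ 1F ∷ 2F ∷ 3F ∷ []) ∷ (0F ∷ 2F ∷ 1F ∷ 3F ∷ []) ∷ (0F ∷ 1F ∷ 3F ∷ 2F ∷ []) ∷ []) o)

module _ (M : Fin 4 → Fin 6 → Bool) where

  Both : Fin 4 → Fin 4 → Fin 6 → Set
  Both i j p = M i p ∧ M j p ≡ true

  Cyclic : Set
  Cyclic =
    ∃ λ o → ∃ λ p → Both (order o 0F) (order o 1F) p ×
    ∃ λ q → Both (order o 1F) (order o 2F) q × p ≢ q ×
    ∃ λ r → Both (order o 2F) (order o 3F) r × p ≢ r × q ≢ r ×
    ∃ λ s → Both (order o 3F) (order o 0F) s × p ≢ s × q ≢ s × r ≢ s

  cyclic? : Dec Cyclic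
  cyclic? =
    any? λ o → any? λ p → (_ ≟ᵇ true) ×-dec
    any? λ q → (_ ≟ᵇ true) ×-dec ¬? (p ≟ q) ×-dec
    any? λ r → (_ ≟ᵇ true) ×-dec ¬? (p ≟ r) ×-dec ¬? (q ≟ r) ×-dec
    any? λ s → (_ ≟ᵇ true) ×-dec ¬? (p ≟ s) ×-dec ¬? (q ≟ s) ×-dec ¬? (r ≟ s)

rows : (a b c : Vec Bool 6) → Fin 4 → Fin 6 → Bool
rows a b c i = lookup (lookup ((true ∷ true ∷ true ∷ true ∷ false ∷ false ∷ []) ∷ a ∷ b ∷ c ∷ []) i)

heavy : ∀ {k} → Vec Bool k → Bool
heavy v = 4 ≤ᵇ weight v

rows-cyclic : ∀ a b c → heavy a ≡ true → heavy b ≡ true → heavy c ≡ true → Cyclic (rows a b c)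
rows-cyclic a b c ha hb hc = does-sound (cyclic? (rows a b c)) (use hc (allᵛ-sound 6 (test₃ a b)
  (use hb (allᵛ-sound 6 (test₂ a) (use ha (allᵛ-sound 6 test₁ refl a)) b)) c))
  where
  -- A light row is discarded before the next one is enumerated. Of the 64 rows 22 are heavy, which
  -- leaves 22³ matrices to search.
  test₃ : (a b c : Vec Bool 6) → Bool
  test₃ a b c = not (heavy c) ∨ does (cyclic? (rows a b c))
  test₂ : (a b : Vec Bool 6) → Bool
  test₂ a b = not (heavy b) ∨ allᵛ 6 (test₃ a b)
  test₁ : Vec Bool 6 → Bool
  test₁ a = not (heavy a) ∨ allᵛ 6 (test₂ a)
  does-sound : ∀ {P : Set} (d : Dec P) → does d ≡ true → P
  does-sound (yes p) _ = p
  use : ∀ {a b} → a ≡ true → not a ∨ b ≡ true → b ≡ true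
  use refl h = h

lookup-injective : ∀ {N k} (xs : Vec (Fin N) k) → Unique (Vec.toList xs) → IsInjective (lookup xs)
lookup-injective (x ∷ xs) (d ∷ u) zero    zero    e = refl
lookup-injective (x ∷ xs) (d ∷ u) zero    (suc j) e = ⊥-elim (lookup-all xs d j e)
lookup-injective (x ∷ xs) (d ∷ u) (suc i) zero    e = ⊥-elim (lookup-all xs d i (sym e))
lookup-injective (x ∷ xs) (d ∷ u) (suc i) (suc j) e = cong suc (lookup-injective xs u i j e)

-- Blue wheels and Dirac's theorem on eight vertices

module Wheels {N} (C : Colouring N) where
  open Colouring C

  record IsWheel (h : Fin N) (c : Fin 8 → Fin N) : Set where
    constructor wheel
    field
      injective : IsInjective c
      spoke     : ∀ i → c i ∈ blue h
      edge      : ∀ i → c (next i) ∈ blue (c i)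

  module Wheel-free (wheel-free : ∀ h c → ¬ IsWheel h c) where

    blue-unless-red : ∀ x y → x ≢ y → ¬ (y ∈ red x) → y ∈ blue x
    blue-unless-red x y ≢ h = [ ⊥-elim ∘ h , id ]′ (colour x y ≢)

    -- If each vertex of S has at most three red neighbours in S, then the blue graph on any eight vertices of S
    -- satisfies Dirac's condition.  A cyclic arrangement with a red consecutive pair can be improved: some
    -- segment can be reversed so that this pair is lost and no new red pair arises.
    module Dirac (h : Fin N) (S : Sub N) (spokes : ∀ x → x ∈ S → x ∈ blue h)
                 (sparse : ∀ x → x ∈ S → # (S ∩ red x) ≤ 3) where

      record Arrangement (c : Fin 8 → Fin N) : Set where
        field
          injective : IsInjective c
          member    : ∀ i → c i ∈ S
      open Arrangement

      permute : ∀ {c} (π : Vec (Fin 8) 8) {_ : True (injective? π)} → Arrangement c → Arrangement (c ∘ lookup π)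
      permute π {t} a = record
        { injective = λ i j e → toWitness {a? = injective? π} t i j (injective a _ _ e)
        ; member    = λ i → member a (lookup π i) }

      degree : ∀ {c} → Arrangement c → ∀ i is {_ : True (unique? is)} → count (red (c i)) (List.map c is) ≤ 3
      degree {c} a i is {t} = ≤-trans
        (≤-trans (≤-reflexive (restrict is))
          (count-≤ (S ∩ red (c i)) (Uniqueₚ.map⁺ (λ {x} {y} → injective a x y) (toWitness {a? = unique? is} t))))
        (sparse (c i) (member a i))
        where
        restrict : ∀ is → count (red (c i)) (List.map c is) ≡ count (S ∩ red (c i)) (List.map c is)
        restrict []       = refl
        restrict (j ∷ is) = cong₂ _+_ (cong (λ b → ι (b ∧ red (c i) (c j))) (sym (member a j))) (restrict is)

      module Defects (c : Fin 8 → Fin N) where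
        defect : Fin 8 → Fin 8 → ℕ
        defect i j = ι (red (c i) (c j))

        defects : ℕ
        defects = defect 0F 1F + defect 1F 2F + defect 2F 3F + defect 3F 4F
                + defect 4F 5F + defect 5F 6F + defect 6F 7F + defect 7F 0F

        defect-sym : ∀ i j → defect i j ≡ defect j i
        defect-sym i j = cong ι (red-sym (c i) (c j))

      open Defects

      Settled : ℕ → Set
      Settled b = ∀ c → Arrangement c → defects c < b → ⊥

      apart : ∀ {c} → Arrangement c → ∀ i j {_ : True (¬? (i ≟ j))} → c i ≢ c j
      apart a i j {t} e = toWitness {a? = ¬? (i ≟ j)} t (injective a i j e)

      no-defect : ∀ {c} → Arrangement c → ∀ i j {_ : True (¬? (i ≟ j))} → ¬ (c j ∈ red (c i)) → c j ∈ blue (c i)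
      no-defect {c} a i j {t} = blue-unless-red (c i) (c j) (apart a i j {t})

      defect-free : ∀ c i j → c j ∈ blue (c i) → defect c i j ≡ 0
      defect-free c i j b = [ (λ r → ⊥-elim (true≢false b (red⇒¬blue _ _ r))) , cong ι ]′ (decide (red (c i) (c j)))

      -- The reversal with index i runs through the positions i + 1, ..., 7 backwards: the
      -- consecutive pairs (i, i + 1) and (7, 0) are replaced by (i, 7) and (i + 1, 0).
      reversal₁ reversal₂ reversal₃ reversal₄ reversal₅ rotation : Vec (Fin 8) 8
      reversal₁ = 0F ∷ 1F ∷ 7F ∷ 6F ∷ 5F ∷ 4F ∷ 3F ∷ 2F ∷ []
      reversal₂ = 0F ∷ 1F ∷ 2F ∷ 7F ∷ 6F ∷ 5F ∷ 4F ∷ 3F ∷ []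
      reversal₃ = 0F ∷ 1F ∷ 2F ∷ 3F ∷ 7F ∷ 6F ∷ 5F ∷ 4F ∷ []
      reversal₄ = 0F ∷ 1F ∷ 2F ∷ 3F ∷ 4F ∷ 7F ∷ 6F ∷ 5F ∷ []
      reversal₅ = 0F ∷ 1F ∷ 2F ∷ 3F ∷ 4F ∷ 5F ∷ 7F ∷ 6F ∷ []
      rotation  = 1F ∷ 2F ∷ 3F ∷ 4F ∷ 5F ∷ 6F ∷ 7F ∷ 0F ∷ []

      module Improve {b} (settled : Settled b) (c : Fin 8 → Fin N) (a : Arrangement c)
                     (few : defects c < suc b) (closing : c 0F ∈ red (c 7F)) where

        closing-defect : defect c 7F 0F ≡ 1
        closing-defect = cong ι closing

        fewer₁ : c 7F ∈ blue (c 1F) → c 0F ∈ blue (c 2F) → defects (c ∘ lookup reversal₁) < b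
        fewer₁ p q = linear (defect c 0F 1F ∷ defect c 1F 2F ∷ defect c 2F 3F ∷ defect c 3F 4F ∷ defect c 4F 5F ∷
          defect c 5F 6F ∷ defect c 6F 7F ∷ defect c 7F 0F ∷ defect c 1F 7F ∷ defect c 7F 6F ∷ defect c 6F 5F ∷
          defect c 5F 4F ∷ defect c 4F 3F ∷ defect c 3F 2F ∷ defect c 2F 0F ∷ b ∷ [])
          (λ d01 d12 d23 d34 d45 d56 d67 d70 d17 d76 d65 d54 d43 d32 d20 b →
            d70 ≐ K 1 ∷ d17 ≐ K 0 ∷ d20 ≐ K 0 ∷ d32 ≐ d23 ∷ d43 ≐ d34 ∷ d54 ≐ d45 ∷ d65 ≐ d56 ∷ d76 ≐ d67 ∷ K 1 ⊕
              (d01 ⊕ d12 ⊕ d23 ⊕ d34 ⊕ d45 ⊕ d56 ⊕ d67 ⊕ d70) ≼ K 1 ⊕ b ∷ []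
            ⊢ K 1 ⊕ (d01 ⊕ d17 ⊕ d76 ⊕ d65 ⊕ d54 ⊕ d43 ⊕ d32 ⊕ d20) ≼ b)
          closing-defect (defect-free c 1F 7F p) (defect-free c 2F 0F q)
          (defect-sym c 3F 2F) (defect-sym c 4F 3F) (defect-sym c 5F 4F) (defect-sym c 6F 5F) (defect-sym c 7F 6F) few

        fewer₂ : c 7F ∈ blue (c 2F) → c 0F ∈ blue (c 3F) → defects (c ∘ lookup reversal₂) < b
        fewer₂ p q = linear (defect c 0F 1F ∷ defect c 1F 2F ∷ defect c 2F 3F ∷ defect c 3F 4F ∷ defect c 4F 5F ∷
          defect c 5F 6F ∷ defect c 6F 7F ∷ defect c 7F 0F ∷ defect c 2F 7F ∷ defect c 7F 6F ∷ defect c 6F 5F ∷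
          defect c 5F 4F ∷ defect c 4F 3F ∷ defect c 3F 0F ∷ b ∷ [])
          (λ d01 d12 d23 d34 d45 d56 d67 d70 d27 d76 d65 d54 d43 d30 b →
            d70 ≐ K 1 ∷ d27 ≐ K 0 ∷ d30 ≐ K 0 ∷ d43 ≐ d34 ∷ d54 ≐ d45 ∷ d65 ≐ d56 ∷ d76 ≐ d67 ∷ K 1 ⊕
              (d01 ⊕ d12 ⊕ d23 ⊕ d34 ⊕ d45 ⊕ d56 ⊕ d67 ⊕ d70) ≼ K 1 ⊕ b ∷ []
            ⊢ K 1 ⊕ (d01 ⊕ d12 ⊕ d27 ⊕ d76 ⊕ d65 ⊕ d54 ⊕ d43 ⊕ d30) ≼ b)
          closing-defect (defect-free c 2F 7F p) (defect-free c 3F 0F q)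
          (defect-sym c 4F 3F) (defect-sym c 5F 4F) (defect-sym c 6F 5F) (defect-sym c 7F 6F) few

        fewer₃ : c 7F ∈ blue (c 3F) → c 0F ∈ blue (c 4F) → defects (c ∘ lookup reversal₃) < b
        fewer₃ p q = linear (defect c 0F 1F ∷ defect c 1F 2F ∷ defect c 2F 3F ∷ defect c 3F 4F ∷ defect c 4F 5F ∷
          defect c 5F 6F ∷ defect c 6F 7F ∷ defect c 7F 0F ∷ defect c 3F 7F ∷ defect c 7F 6F ∷ defect c 6F 5F ∷
          defect c 5F 4F ∷ defect c 4F 0F ∷ b ∷ [])
          (λ d01 d12 d23 d34 d45 d56 d67 d70 d37 d76 d65 d54 d40 b →
            d70 ≐ K 1 ∷ d37 ≐ K 0 ∷ d40 ≐ K 0 ∷ d54 ≐ d45 ∷ d65 ≐ d56 ∷ d76 ≐ d67 ∷ K 1 ⊕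
              (d01 ⊕ d12 ⊕ d23 ⊕ d34 ⊕ d45 ⊕ d56 ⊕ d67 ⊕ d70) ≼ K 1 ⊕ b ∷ []
            ⊢ K 1 ⊕ (d01 ⊕ d12 ⊕ d23 ⊕ d37 ⊕ d76 ⊕ d65 ⊕ d54 ⊕ d40) ≼ b)
          closing-defect (defect-free c 3F 7F p) (defect-free c 4F 0F q)
          (defect-sym c 5F 4F) (defect-sym c 6F 5F) (defect-sym c 7F 6F) few

        fewer₄ : c 7F ∈ blue (c 4F) → c 0F ∈ blue (c 5F) → defects (c ∘ lookup reversal₄) < b
        fewer₄ p q = linear (defect c 0F 1F ∷ defect c 1F 2F ∷ defect c 2F 3F ∷ defect c 3F 4F ∷ defect c 4F 5F ∷
          defect c 5F 6F ∷ defect c 6F 7F ∷ defect c 7F 0F ∷ defect c 4F 7F ∷ defect c 7F 6F ∷ defect c 6F 5F ∷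
          defect c 5F 0F ∷ b ∷ [])
          (λ d01 d12 d23 d34 d45 d56 d67 d70 d47 d76 d65 d50 b →
            d70 ≐ K 1 ∷ d47 ≐ K 0 ∷ d50 ≐ K 0 ∷ d65 ≐ d56 ∷ d76 ≐ d67 ∷ K 1 ⊕ (d01 ⊕ d12 ⊕ d23 ⊕ d34 ⊕ d45 ⊕ d56 ⊕
              d67 ⊕ d70) ≼ K 1 ⊕ b ∷ []
            ⊢ K 1 ⊕ (d01 ⊕ d12 ⊕ d23 ⊕ d34 ⊕ d47 ⊕ d76 ⊕ d65 ⊕ d50) ≼ b)
          closing-defect (defect-free c 4F 7F p) (defect-free c 5F 0F q)
          (defect-sym c 6F 5F) (defect-sym c 7F 6F) few

        fewer₅ : c 7F ∈ blue (c 5F) → c 0F ∈ blue (c 6F) → defects (c ∘ lookup reversal₅) < b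
        fewer₅ p q = linear (defect c 0F 1F ∷ defect c 1F 2F ∷ defect c 2F 3F ∷ defect c 3F 4F ∷ defect c 4F 5F ∷
          defect c 5F 6F ∷ defect c 6F 7F ∷ defect c 7F 0F ∷ defect c 5F 7F ∷ defect c 7F 6F ∷ defect c 6F 0F ∷ b ∷
          [])
          (λ d01 d12 d23 d34 d45 d56 d67 d70 d57 d76 d60 b →
            d70 ≐ K 1 ∷ d57 ≐ K 0 ∷ d60 ≐ K 0 ∷ d76 ≐ d67 ∷ K 1 ⊕ (d01 ⊕ d12 ⊕ d23 ⊕ d34 ⊕ d45 ⊕ d56 ⊕ d67 ⊕ d70) ≼
              K 1 ⊕ b ∷ []
            ⊢ K 1 ⊕ (d01 ⊕ d12 ⊕ d23 ⊕ d34 ⊕ d45 ⊕ d57 ⊕ d76 ⊕ d60) ≼ b)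
          closing-defect (defect-free c 5F 7F p) (defect-free c 6F 0F q)
          (defect-sym c 7F 6F) few

        swap₁ : c 7F ∈ blue (c 1F) → c 0F ∈ blue (c 2F) → ⊥
        swap₁ p q = settled (c ∘ lookup reversal₁) (permute reversal₁ a) (fewer₁ p q)
        swap₂ : c 7F ∈ blue (c 2F) → c 0F ∈ blue (c 3F) → ⊥
        swap₂ p q = settled (c ∘ lookup reversal₂) (permute reversal₂ a) (fewer₂ p q)
        swap₃ : c 7F ∈ blue (c 3F) → c 0F ∈ blue (c 4F) → ⊥
        swap₃ p q = settled (c ∘ lookup reversal₃) (permute reversal₃ a) (fewer₃ p q)
        swap₄ : c 7F ∈ blue (c 4F) → c 0F ∈ blue (c 5F) → ⊥
        swap₄ p q = settled (c ∘ lookup reversal₄) (permute reversal₄ a) (fewer₄ p q)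
        swap₅ : c 7F ∈ blue (c 5F) → c 0F ∈ blue (c 6F) → ⊥
        swap₅ p q = settled (c ∘ lookup reversal₅) (permute reversal₅ a) (fewer₅ p q)

        blocked : ∀ i j {_ : True (¬? (7F ≟ i))} {_ : True (¬? (0F ≟ j))} →
          (c 7F ∈ blue (c i) → c 0F ∈ blue (c j) → ⊥) → 1 ≤ defect c 7F i + defect c 0F j
        blocked i j {s} {t} f with decide (red (c 7F) (c i)) | decide (red (c 0F) (c j))
        ... | inj₁ r | _      rewrite r = s≤s z≤n
        ... | inj₂ _ | inj₁ r rewrite r = m≤n+m 1 _
        ... | inj₂ p | inj₂ q = ⊥-elim (f (turn 7F i {s} p) (turn 0F j {t} q))
          where
          turn : ∀ i j {_ : True (¬? (i ≟ j))} → c j ∉ red (c i) → c i ∈ blue (c j)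
          turn i j {t} h = trans (blue-sym _ _) (no-defect a i j {t} λ r → true≢false r h)

        -- Each of the five reversals must be blocked by a red pair at `c 7F` or at `c 0F`. These
        -- two are red to each other, so each has at most two further red neighbours, and four red
        -- pairs cannot block five reversals.
        absurd : ⊥
        absurd = linear
          (defect c 7F 1F ∷ defect c 7F 2F ∷ defect c 7F 3F ∷ defect c 7F 4F ∷ defect c 7F 5F ∷
           defect c 0F 2F ∷ defect c 0F 3F ∷ defect c 0F 4F ∷ defect c 0F 5F ∷ defect c 0F 6F ∷ [])
          (λ s₁ s₂ s₃ s₄ s₅ t₂ t₃ t₄ t₅ t₆ →
            K 1 ≼ s₁ ⊕ t₂ ∷ K 1 ≼ s₂ ⊕ t₃ ∷ K 1 ≼ s₃ ⊕ t₄ ∷ K 1 ≼ s₄ ⊕ t₅ ∷ K 1 ≼ s₅ ⊕ t₆ ∷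
            s₁ ⊕ (s₂ ⊕ (s₃ ⊕ (s₄ ⊕ (s₅ ⊕ K 0)))) ≼ K 2 ∷ t₂ ⊕ (t₃ ⊕ (t₄ ⊕ (t₅ ⊕ (t₆ ⊕ K 0)))) ≼ K 2 ∷ [] ⊢⊥)
          (blocked 1F 2F swap₁) (blocked 2F 3F swap₂) (blocked 3F 4F swap₃) (blocked 4F 5F swap₄)
            (blocked 5F 6F swap₅)
          (at-most-two 7F 0F (1F ∷ 2F ∷ 3F ∷ 4F ∷ 5F ∷ []) closing)
          (at-most-two 0F 7F (2F ∷ 3F ∷ 4F ∷ 5F ∷ 6F ∷ []) (trans (red-sym _ _) closing))
          where
          at-most-two : ∀ i j (is : List (Fin 8)) {_ : True (unique? (j ∷ is))} → c j ∈ red (c i) →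
            count (red (c i)) (List.map c is) ≤ 2
          at-most-two i j is {t} r with degree a i (j ∷ is) {t}
          ... | d rewrite r = ≤-pred d

      rotate-defects : ∀ c → defects (c ∘ lookup rotation) ≡ defects c
      rotate-defects c = linear (defect c 0F 1F ∷ defect c 1F 2F ∷ defect c 2F 3F ∷ defect c 3F 4F ∷
          defect c 4F 5F ∷ defect c 5F 6F ∷ defect c 6F 7F ∷ defect c 7F 0F ∷ [])
        λ a b c d e f g h → [] ⊢ b ⊕ c ⊕ d ⊕ e ⊕ f ⊕ g ⊕ h ⊕ a ≐ a ⊕ b ⊕ c ⊕ d ⊕ e ⊕ f ⊕ g ⊕ h

      rotate : ℕ → (Fin 8 → Fin N) → Fin 8 → Fin N
      rotate zero    c = c
      rotate (suc k) c = rotate k c ∘ lookup rotation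

      rotate-arrangement : ∀ k {c} → Arrangement c → Arrangement (rotate k c)
      rotate-arrangement zero    a = a
      rotate-arrangement (suc k) a = permute rotation (rotate-arrangement k a)

      rotate-few : ∀ k {c b} → defects c < b → defects (rotate k c) < b
      rotate-few zero    few = few
      rotate-few (suc k) {c} {b} few = subst (_< b) (sym (rotate-defects (rotate k c))) (rotate-few k few)

      -- Induction on the number of red consecutive pairs. A rotation moves any such pair to the
      -- closing place (7, 0), where `Improve` applies.
      settle : ∀ b → Settled b
      settle (suc b) c a few = wheel-free h c (wheel (injective a) (λ i → spokes (c i) (member a i)) edge)
        where
        fix : ∀ k → rotate k c 0F ∈ red (rotate k c 7F) → ⊥
        fix k = Improve.absurd (settle b) (rotate k c) (rotate-arrangement k a) (rotate-few k few)
        edge : ∀ i → c (next i) ∈ blue (c i)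
        edge 0F = no-defect a 0F 1F (fix 1)
        edge 1F = no-defect a 1F 2F (fix 2)
        edge 2F = no-defect a 2F 3F (fix 3)
        edge 3F = no-defect a 3F 4F (fix 4)
        edge 4F = no-defect a 4F 5F (fix 5)
        edge 5F = no-defect a 5F 6F (fix 6)
        edge 6F = no-defect a 6F 7F (fix 7)
        edge 7F = no-defect a 7F 0F (fix 0)

    sparse-wheel : ∀ h S → (∀ x → x ∈ S → x ∈ blue h) → (∀ x → x ∈ S → # (S ∩ red x) ≤ 3) → 8 ≤ # S → ⊥
    sparse-wheel h S spokes sparse eight = arrange (choose S 8 [] eight)
      where
      open Dirac h S spokes sparse
      arrange : Choice S [] 8 → ⊥
      arrange (chosen xs m u) = settle (suc (Defects.defects (lookup xs))) (lookup xs)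
        (record { injective = lookup-injective xs (subst Unique (++-identityʳ _) u)
                ; member = lookup-all xs m }) ≤-refl

    -- The vertices are listed in the order that suits the proofs of membership and distinctness;
    -- `π` puts them into their order on the rim, and its injectivity is checked by evaluation.
    wheel-at : ∀ h (xs : Vec (Fin N) 8) → All (_∈ blue h) (Vec.toList xs) → Unique (Vec.toList xs) →
      ∀ (π : Vec (Fin 8) 8) {_ : True (injective? π)} →
      let e : Fin 8 → Fin 8 → Set
          e i j = lookup xs (lookup π j) ∈ blue (lookup xs (lookup π i)) in
      e 0F 1F → e 1F 2F → e 2F 3F → e 3F 4F → e 4F 5F → e 5F 6F → e 6F 7F → e 7F 0F → ⊥
    wheel-at h xs m u π {t} e₀ e₁ e₂ e₃ e₄ e₅ e₆ e₇ = wheel-free h (lookup xs ∘ lookup π) (wheel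
      (λ i j → toWitness {a? = injective? π} t i j ∘ lookup-injective xs u _ _)
      (λ i → lookup-all xs m (lookup π i))
      λ { 0F → e₀ ; 1F → e₁ ; 2F → e₂ ; 3F → e₃ ; 4F → e₄ ; 5F → e₅ ; 6F → e₆ ; 7F → e₇ })

    flip-blue : ∀ {x y} → y ∈ blue x → x ∈ blue y
    flip-blue {x} {y} = trans (blue-sym y x)

-- Blue cycles between two classes: K₄,₄ and Jackson's theorem

module Bipartite {N} (C : Colouring N) (wheel-free : ∀ h c → ¬ Wheels.IsWheel C h c) where
  open Colouring C
  open Wheels C
  open Wheel-free wheel-free

  blue⇒≢ : ∀ {x y} → y ∈ blue x → x ≢ y
  blue⇒≢ {x} b refl = true≢false b (blue-irr x)

  bipartite-wheel : ∀ h (X Y : Sub N) → (∀ x → x ∈ X → x ∈ blue h) → (∀ y → y ∈ Y → y ∈ blue h) →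
    (∀ x y → x ∈ X → y ∈ Y → y ∈ blue x) → 4 ≤ # X → 4 ≤ # Y → ⊥
  bipartite-wheel h X Y hX hY join X≥4 Y≥4 = go (choose X 4 [] X≥4) (choose Y 4 [] Y≥4)
    where
    go : Choice X [] 4 → Choice Y [] 4 → ⊥
    go (chosen xs@(_ ∷ _ ∷ _ ∷ _ ∷ []) mx@(a ∷ b ∷ c ∷ d ∷ []) ux)
       (chosen ys@(_ ∷ _ ∷ _ ∷ _ ∷ []) my@(p ∷ q ∷ r ∷ s ∷ []) uy) =
      wheel-at h (xs Vec.++ ys)
        (Allₚ.++⁺ (All.map (hX _) mx) (All.map (hY _) my))
        (AllPairsₚ.++⁺ ux uy (All.map (λ x∈ → All.map (λ y∈ → blue⇒≢ (join _ _ x∈ y∈)) my) mx))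
        (0F ∷ 4F ∷ 1F ∷ 5F ∷ 2F ∷ 6F ∷ 3F ∷ 7F ∷ [])
        (join _ _ a p) (flip-blue (join _ _ b p)) (join _ _ b q) (flip-blue (join _ _ c q))
        (join _ _ c r) (flip-blue (join _ _ d r)) (join _ _ d s) (flip-blue (join _ _ a s))

  profile : ∀ {k} → Fin N → Vec (Fin N) k → Vec Bool k
  profile x = Vec.map (blue x)

  profile-heavy : ∀ x {k} (ys : Vec (Fin N) k) → All (x ≢_) (Vec.toList ys) →
    weight (profile x ys) + count (red x) (Vec.toList ys) ≡ k
  profile-heavy x []       []       = refl
  profile-heavy x (y ∷ ys) (d ∷ ds) = trans (shuffle (ι (blue x y)) _ _ _)
    (cong₂ _+_ (one (colour x y d)) (profile-heavy x ys ds))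
    where
    shuffle : ∀ a b c d → (a + b) + (c + d) ≡ (a + c) + (b + d)
    shuffle = solve-∀
    one : y ∈ red x ⊎ y ∈ blue x → ι (blue x y) + ι (red x y) ≡ 1
    one (inj₁ r) rewrite r | red⇒¬blue x y r = refl
    one (inj₂ b) with decide (red x y)
    ... | inj₁ r = ⊥-elim (true≢false b (red⇒¬blue x y r))
    ... | inj₂ n rewrite b | n = refl

  -- The case (4, 6) of Jackson's theorem on cycles in bipartite graphs, checked by enumeration: the rows of the adjacency
  -- matrix have weight at least 4, and the first may be assumed to begin with four neighbours.
  module Jackson (h : Fin N) (x₀ x₁ x₂ x₃ : Fin N) (Y : Sub N) (ux : Unique (x₀ ∷ x₁ ∷ x₂ ∷ x₃ ∷ []))
                 (hX : All (_∈ blue h) (x₀ ∷ x₁ ∷ x₂ ∷ x₃ ∷ [])) (hY : ∀ y → y ∈ Y → y ∈ blue h)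
                 (outside : All (_∉ Y) (x₀ ∷ x₁ ∷ x₂ ∷ x₃ ∷ []))
                 (few : All (λ x → # (Y ∩ red x) ≤ 2) (x₀ ∷ x₁ ∷ x₂ ∷ x₃ ∷ [])) (Y≥6 : 6 ≤ # Y) where

    xs : Vec (Fin N) 4
    xs = x₀ ∷ x₁ ∷ x₂ ∷ x₃ ∷ []

    x : Fin 4 → Fin N
    x = lookup xs

    Y₀ : Sub N
    Y₀ = Y ∩ blue (x 0F)

    Y₀≥4 : 4 ≤ # Y₀
    Y₀≥4 = linear (# Y ∷ # (Y ∩ red (x 0F)) ∷ # Y₀ ∷ [])
      (λ y r b → K 6 ≼ y ∷ r ≼ K 2 ∷ y ≼ r ⊕ b ∷ [] ⊢ K 4 ≼ b)
      Y≥6 (lookup-all xs few 0F) (#-cover Y (Y ∩ red (x 0F)) Y₀ λ y y∈ →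
        [ (λ r → inj₁ (∧-intro y∈ r)) , (λ b → inj₂ (∧-intro y∈ b)) ]′
          (colour (x 0F) y λ e → true≢false (subst (_∈ Y) (sym e) y∈) (lookup-all xs outside 0F)))

    -- Four blue neighbours of `x₀` come first, to match the fixed first row of `rows`; the other
    -- two columns are any further vertices of `Y`.
    conclude : Choice Y₀ [] 4 → ⊥
    conclude (chosen front@(_ ∷ _ ∷ _ ∷ _ ∷ []) mf uf) = extend (choose Y 2 uf Y≥6)
      where
      extend : Choice Y _ 2 → ⊥
      extend (chosen back@(e ∷ f ∷ []) mb ub) = go (rows-cyclic (profile (x 1F) ys) (profile (x 2F) ys)
        (profile (x 3F) ys)
                                           (is-heavy 1F) (is-heavy 2F) (is-heavy 3F))
        where
        ys : Vec (Fin N) 6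
        ys = front Vec.++ back
        my : All (_∈ Y) (Vec.toList ys)
        my = Allₚ.++⁺ (All.map ∧-left mf) mb
        uy : Unique (Vec.toList ys)
        uy = rotate₂ ub
          where
          rotate₂ : ∀ {a b c d e f : Fin N} → Unique (e ∷ f ∷ a ∷ b ∷ c ∷ d ∷ []) → Unique
            (a ∷ b ∷ c ∷ d ∷ e ∷ f ∷ [])
          rotate₂ ((ef ∷ es) ∷ fs ∷ u) = AllPairsₚ.++⁺ u ((ef ∷ []) ∷ [] ∷ []) (zip es fs)
            where
            zip : ∀ {e f zs} → All (e ≢_) zs → All (f ≢_) zs → All (λ z → All (z ≢_) (e ∷ f ∷ [])) zs
            zip []       []       = []
            zip (p ∷ ps) (q ∷ qs) = ((p ∘ sym) ∷ (q ∘ sym) ∷ []) ∷ zip ps qs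
        apart : ∀ i → All (x i ≢_) (Vec.toList ys)
        apart i = All.map (λ y∈ e → true≢false (subst (_∈ Y) (sym e) y∈) (lookup-all xs outside i)) my
        is-heavy : ∀ i → heavy (profile (x i) ys) ≡ true
        is-heavy i = ≤⇒≤ᵇ≡ (linear (weight (profile (x i) ys) ∷ count (red (x i)) (Vec.toList ys) ∷ [])
          (λ w r → w ⊕ r ≐ K 6 ∷ r ≼ K 2 ∷ [] ⊢ K 4 ≼ w)
          (profile-heavy (x i) ys (apart i)) (≤-trans (subst (_≤ # (Y ∩ red (x i))) (inside (Vec.toList ys) my)
             (count-≤ (Y ∩ red (x i)) uy)) (lookup-all xs few i)))
          where
          ≤⇒≤ᵇ≡ : ∀ {m n} → m ≤ n → (m ≤ᵇ n) ≡ true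
          ≤⇒≤ᵇ≡ {m} {n} h = T⇒≡ (≤⇒≤ᵇ h)
            where
            T⇒≡ : ∀ {b} → T b → b ≡ true
            T⇒≡ {true} _ = refl
          inside : ∀ zs → All (_∈ Y) zs → count (Y ∩ red (x i)) zs ≡ count (red (x i)) zs
          inside []       []       = refl
          inside (z ∷ zs) (m ∷ ms) = cong₂ _+_ (cong (λ b → ι (b ∧ red (x i) z)) m) (inside zs ms)

        M : Fin 4 → Fin 6 → Bool
        M = rows (profile (x 1F) ys) (profile (x 2F) ys) (profile (x 3F) ys)

        M-blue : ∀ i p → M i p ≡ true → lookup ys p ∈ blue (x i)
        M-blue 0F 0F h = ∧-right {Y _} (lookup-all front mf 0F)
        M-blue 0F 1F h = ∧-right {Y _} (lookup-all front mf 1F)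
        M-blue 0F 2F h = ∧-right {Y _} (lookup-all front mf 2F)
        M-blue 0F 3F h = ∧-right {Y _} (lookup-all front mf 3F)
        M-blue 0F 4F ()
        M-blue 0F 5F ()
        M-blue 1F p  h = trans (sym (lookup-map p (blue (x 1F)) ys)) h
        M-blue 2F p  h = trans (sym (lookup-map p (blue (x 2F)) ys)) h
        M-blue 3F p  h = trans (sym (lookup-map p (blue (x 3F)) ys)) h

        left : ∀ i j p → Both M i j p → lookup ys p ∈ blue (x i)
        left i j p b = M-blue i p (∧-left {M i p} b)

        right : ∀ i j p → Both M i j p → x j ∈ blue (lookup ys p)
        right i j p b = flip-blue (M-blue j p (∧-right {M i p} b))

        go : Cyclic M → ⊥
        go (o , p , bp , q , bq , pq , r , br , pr , qr , s , bs , ps , qs , rs) = close o bp bq br bs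
          where
          y : Fin 6 → Fin N
          y = lookup ys
          zs : Vec (Fin N) 8
          zs = x₀ ∷ x₁ ∷ x₂ ∷ x₃ ∷ y p ∷ y q ∷ y r ∷ y s ∷ []
          y∈ : ∀ p → y p ∈ Y
          y∈ = lookup-all ys my
          mz : All (_∈ blue h) (Vec.toList zs)
          mz = Allₚ.++⁺ hX (hY _ (y∈ p) ∷ hY _ (y∈ q) ∷ hY _ (y∈ r) ∷ hY _ (y∈ s) ∷ [])
          y≢ : ∀ {p q} → p ≢ q → y p ≢ y q
          y≢ {p} {q} ≢ e = ≢ (lookup-injective ys uy p q e)
          uz : Unique (Vec.toList zs)
          uz = AllPairsₚ.++⁺ ux
            ((y≢ pq ∷ y≢ pr ∷ y≢ ps ∷ []) ∷ (y≢ qr ∷ y≢ qs ∷ []) ∷ (y≢ rs ∷ []) ∷ [] ∷ [])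
            (All.map (λ x∉ → All.map (λ y∈ e → true≢false (subst (_∈ Y) (sym e) y∈) x∉)
              (y∈ p ∷ y∈ q ∷ y∈ r ∷ y∈ s ∷ [])) outside)
          close : ∀ o → Both M (order o 0F) (order o 1F) p → Both M (order o 1F) (order o 2F) q →
            Both M (order o 2F) (order o 3F) r → Both M (order o 3F) (order o 0F) s → ⊥
          close 0F bp bq br bs = wheel-at h zs mz uz (0F ∷ 4F ∷ 1F ∷ 5F ∷ 2F ∷ 6F ∷ 3F ∷ 7F ∷ [])
            (left 0F 1F p bp) (right 0F 1F p bp) (left 1F 2F q bq) (right 1F 2F q bq)
            (left 2F 3F r br) (right 2F 3F r br) (left 3F 0F s bs) (right 3F 0F s bs)
          close 1F bp bq br bs = wheel-at h zs mz uz (0F ∷ 4F ∷ 2F ∷ 5F ∷ 1F ∷ 6F ∷ 3F ∷ 7F ∷ [])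
            (left 0F 2F p bp) (right 0F 2F p bp) (left 2F 1F q bq) (right 2F 1F q bq)
            (left 1F 3F r br) (right 1F 3F r br) (left 3F 0F s bs) (right 3F 0F s bs)
          close 2F bp bq br bs = wheel-at h zs mz uz (0F ∷ 4F ∷ 1F ∷ 5F ∷ 3F ∷ 6F ∷ 2F ∷ 7F ∷ [])
            (left 0F 1F p bp) (right 0F 1F p bp) (left 1F 3F q bq) (right 1F 3F q bq)
            (left 3F 2F r br) (right 3F 2F r br) (left 2F 0F s bs) (right 2F 0F s bs)

  -- Among any six vertices of `Y`, a vertex of `X` keeps at least four blue neighbours, so any four
  -- vertices of `X` lie on an alternating blue cycle.
  jackson-wheel : ∀ h (X Y : Sub N) → (∀ x → x ∈ X → x ∈ blue h) → (∀ y → y ∈ Y → y ∈ blue h) →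
    (∀ x → x ∈ X → x ∉ Y) → (∀ x → x ∈ X → # (Y ∩ red x) ≤ 2) → 4 ≤ # X → 6 ≤ # Y → ⊥
  jackson-wheel h X Y hX hY outside few X≥4 Y≥6 = go (choose X 4 [] X≥4)
    where
    go : Choice X [] 4 → ⊥
    go (chosen (_ ∷ _ ∷ _ ∷ _ ∷ []) m u) = conclude (choose Y₀ 4 [] Y₀≥4)
      where open Jackson h _ _ _ _ Y u (All.map (hX _) m) hY (All.map (outside _) m) (All.map (few _) m) Y≥6

-- The red tree: v is the centre of the large star and x that of the small one, joined through w.
record IsTree {N} (C : Colouring N) (n : ℕ) (v w x : Fin N) (ys : List (Fin N)) : Set where
  constructor tree
  open Colouring C
  field
    three    : length ys ≡ 3
    vw       : w ∈ red v
    wx       : x ∈ red w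
    xy       : All (_∈ red x) ys
    distinct : Unique (v ∷ w ∷ x ∷ ys)
    -- These n - 5 neighbours are `w` and the n - 6 leaves of the large star.
    leaves   : n ≤ 5 + # (red v ∖ ⟪ x ∷ ys ⟫)

enumeration : ∀ {N} (p : Sub N) →
  ∃ λ xs → length xs ≡ # p × All (_∈ p) xs × Unique xs × (∀ x → x ∈ p → x ∈ ⟪ xs ⟫)
enumeration {N} p = go (choose p (# p) [] (≤-reflexive (+-identityʳ _)))
  where
  go : Choice p [] (# p) → ∃ λ xs → length xs ≡ # p × All (_∈ p) xs × Unique xs × (∀ x → x ∈ p → x ∈ ⟪ xs ⟫)
  go (chosen v m u′) = Vec.toList v , length-toList v , m , u , complete
    where
    u : Unique (Vec.toList v)
    u = subst Unique (++-identityʳ _) u′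
    complete : ∀ x → x ∈ p → x ∈ ⟪ Vec.toList v ⟫
    complete x x∈ = [ id , (λ x∉ → ⊥-elim (<-irrefl (length-toList v)
      (length-≤ p (∉⟪⟫⁻ (Vec.toList v) x∉ ∷ u) (x∈ ∷ m)))) ]′ (decide (⟪ Vec.toList v ⟫ x))

-- Constructions of the red tree

module Trees {N} (C : Colouring N) (n : ℕ) (tree-free : ∀ v w x ys → ¬ IsTree C n v w x ys) where
  open Colouring C

  red⇒≢ : ∀ {x y} → y ∈ red x → x ≢ y
  red⇒≢ {x} r refl = true≢false r (red-irr x)

  flip-red : ∀ {x y} → y ∈ red x → x ∈ red y
  flip-red {x} {y} = trans (red-sym y x)

  blue⇒¬red : ∀ x y → y ∈ blue x → y ∉ red x
  blue⇒¬red x y b = [ (λ r → ⊥-elim (true≢false b (red⇒¬blue x y r))) , id ]′ (decide (red x y))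

  -- Of the three leaves at x, j are red and b are blue neighbours of v.
  tree-from : ∀ v x → v ≢ x → ∀ j b → j + b ≡ 3 → suc j ≤ # (red v ∩ red x) → b ≤ # (blue v ∩ red x) →
    n + ι (red v x) + j ≤ 5 + # (red v) → ⊥
  tree-from v x v≢x j b sum α β many =
    go (choose (red v ∩ red x) (suc j) [] (subst (_≤ # (red v ∩ red x)) (sym (+-identityʳ (suc j))) α))
       (choose (blue v ∩ red x) b [] (subst (_≤ # (blue v ∩ red x)) (sym (+-identityʳ b)) β))
    where
    go : Choice (red v ∩ red x) [] (suc j) → Choice (blue v ∩ red x) [] b → ⊥
    go (chosen (w ∷ as) (mw ∷ ma) ua) (chosen bs mb ub) = tree-free v w x ys (tree
      (trans (length-++ (Vec.toList as)) (trans (cong₂ _+_ (length-toList as) (length-toList bs)) sum))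
      (∧-left mw) (flip-red (∧-right {red v w} mw))
      (Allₚ.++⁺ (All.map (λ {a} → ∧-right {red v a}) ma) (All.map (λ {a} → ∧-right {blue v a}) mb))
      ((red⇒≢ (∧-left mw) ∷ v≢x ∷ Allₚ.++⁺ (All.map (red⇒≢ ∘ ∧-left) ma)
        (All.map (λ m e → true≢false (∧-left m) (subst (λ z → blue v z ≡ false) e (blue-irr v))) mb))
       ∷ ((red⇒≢ (∧-right {red v w} mw) ∘ sym) ∷ first)
       ∷ Allₚ.++⁺ (All.map (λ {a} m → red⇒≢ (∧-right {red v a} m)) ma)
         (All.map (λ {a} m → red⇒≢ (∧-right {blue v a} m)) mb)
       ∷ rest)
      (linear (n ∷ ι (red v x) ∷ j ∷ # (red v) ∷ # (red v ∖ ⟪ x ∷ ys ⟫) ∷ [])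
        (λ n i j a r → n ⊕ i ⊕ j ≼ K 5 ⊕ a ∷ a ≼ r ⊕ (i ⊕ j) ∷ [] ⊢ n ≼ K 5 ⊕ r) many
        (loss (decide (red v x)))))
      where
      ys : List (Fin N)
      ys = Vec.toList as ++ Vec.toList bs
      uas : Unique (w ∷ Vec.toList as)
      uas = subst Unique (++-identityʳ _) ua
      cross : ∀ {a} → a ∈ red v → All (a ≢_) (Vec.toList bs)
      cross {a} r = All.map (λ {z} m e → true≢false (subst (_∈ red v) e r) (blue⇒¬red v z (∧-left m))) mb
      uys : Unique ((w ∷ Vec.toList as) ++ Vec.toList bs)
      uys = AllPairsₚ.++⁺ uas (subst Unique (++-identityʳ _) ub) (All.map (cross ∘ ∧-left) (mw ∷ ma))
      split : ∀ {z zs} → Unique (z ∷ zs) → All (z ≢_) zs × Unique zs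
      split (d ∷ u) = d , u
      first : All (w ≢_) ys
      first = proj₁ (split uys)
      rest : Unique ys
      rest = proj₂ (split uys)
      -- The red neighbourhood of `v` loses `x`, if `vx` is red, and the leaves in `as`. The leaves
      -- in `bs` are blue neighbours of `v` and cost nothing.
      loss : red v x ≡ true ⊎ red v x ≡ false → # (red v) ≤ # (red v ∖ ⟪ x ∷ ys ⟫) + (ι (red v x) + j)
      loss (inj₁ t) rewrite t = ≤-trans
        (#-cover (red v) (red v ∖ ⟪ x ∷ ys ⟫) ⟪ x ∷ Vec.toList as ⟫ λ a a∈ →
          [ inj₂ , (λ a∉ → inj₁ (∖-intro a∈ (∉⟪⟫ (Allₚ.++⁺ (∉⟪⟫⁻ (x ∷ Vec.toList as) a∉) (cross a∈))))) ]′
            (decide (⟪ x ∷ Vec.toList as ⟫ a)))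
        (+-monoʳ-≤ _ (≤-trans (#-list (x ∷ Vec.toList as)) (s≤s (≤-reflexive (length-toList as)))))
      loss (inj₂ f) rewrite f = ≤-trans
        (#-cover (red v) (red v ∖ ⟪ x ∷ ys ⟫) ⟪ Vec.toList as ⟫ λ a a∈ →
          [ inj₂ , (λ a∉ → inj₁ (∖-intro a∈ (∉⟪⟫ ((λ e → true≢false (subst (_∈ red v) e a∈) f)
            ∷ Allₚ.++⁺ (∉⟪⟫⁻ (Vec.toList as) a∉) (cross a∈))))) ]′
            (decide (⟪ Vec.toList as ⟫ a)))
        (+-monoʳ-≤ _ (≤-trans (#-list (Vec.toList as)) (≤-reflexive (length-toList as))))

  -- With D the set of blue neighbours of b in S, take x so that x has no blue neighbour in D.  Then the leaves at x can
  -- be chosen to contain D, and all other vertices of S become red neighbours of b.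
  module Dense (9≤n : 9 ≤ n) (S : Sub N) (n≤S : n ≤ # S) (dense : ∀ x → x ∈ S → # (S ∩ blue x) ≤ 3) where

    module _ (b : Fin N) (b∈S : b ∈ S) where

      D : Sub N
      D = S ∩ blue b

      far : List (Fin N) → Sub N
      far []       = S ∖ ⟪ b ∷ [] ⟫
      far (d ∷ ds) = far ds ∖ blue d

      far-S : ∀ ds x → x ∈ far ds → x ∈ S ∖ ⟪ b ∷ [] ⟫
      far-S []       x h = h
      far-S (d ∷ ds) x h = far-S ds x (∧-left h)

      b∉⟪b⟫ : ∀ {z} → z ∉ ⟪ b ∷ [] ⟫ → z ≢ b
      b∉⟪b⟫ {z} h = All.head (∉⟪⟫⁻ (b ∷ []) h)

      -- One of the at most three blue neighbours of `d` in `S` is `b`, so each `d` removes at most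
      -- two vertices. With at most three such `d`, at least n - 1 - 6 ≥ 2 vertices stay.
      far-many : ∀ ds → All (_∈ D) ds → n ≤ 1 + # (far ds) + (length ds + length ds)
      far-many [] [] = linear (n ∷ # S ∷ # (far []) ∷ []) (λ n s f → n ≼ s ∷ s ≼ f ⊕ K 1 ∷ [] ⊢ n ≼ K 1 ⊕ f ⊕ K 0)
        n≤S (#-remove S (b ∷ []))
      far-many (d ∷ ds) (d∈ ∷ m) =
        linear (n ∷ # (far ds) ∷ # (far ds ∩ blue d) ∷ # (far ds ∖ blue d) ∷ # (S ∩ blue d) ∷ length ds ∷ [])
          (λ n f i o s l → n ≼ K 1 ⊕ f ⊕ (l ⊕ l) ∷ f ≐ i ⊕ o ∷ i ⊕ K 1 ≼ s ∷ s ≼ K 3 ∷ []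
            ⊢ n ≼ K 1 ⊕ o ⊕ (K 1 ⊕ l ⊕ (K 1 ⊕ l)))
          (far-many ds m) (#-split (far ds) (blue d)) through-b (dense d (∧-left d∈))
        where
        through-b : # (far ds ∩ blue d) + 1 ≤ # (S ∩ blue d)
        through-b = subst (λ k → # (far ds ∩ blue d) + k ≤ # (S ∩ blue d)) (#-single b)
          (#-pack (far ds ∩ blue d) (_==ᶠ b) (S ∩ blue d)
            (λ x h → ∧-intro (∧-left (far-S ds x (∧-left h))) (∧-right {far ds x} h))
            (λ x e → subst (_∈ S ∩ blue d) (sym (==-true x b e))
              (∧-intro b∈S (trans (blue-sym d b) (∧-right {S d} d∈))))
            (λ x h → ≢-false (b∉⟪b⟫ {x} (∖-right {S x} (far-S ds x (∧-left h))))))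

      module _ (x : Fin N) (x∈S : x ∈ S) (x≢b : x ≢ b) (clear : ∀ z → z ∈ D → z ∉ blue x) where

        R : Sub N
        R = S ∩ red x

        R≥5 : 5 ≤ # R
        R≥5 = linear (n ∷ # S ∷ # R ∷ # (S ∖ red x) ∷ # ((S ∖ red x) ∖ ⟪ x ∷ [] ⟫) ∷ # (S ∩ blue x) ∷ [])
          (λ n s r o p d → K 9 ≼ n ∷ n ≼ s ∷ s ≐ r ⊕ o ∷ o ≼ p ⊕ K 1 ∷ p ≼ d ∷ d ≼ K 3 ∷ [] ⊢ K 5 ≼ r)
          9≤n n≤S (#-split S (red x)) (#-remove (S ∖ red x) (x ∷ []))
          (#-mono ((S ∖ red x) ∖ ⟪ x ∷ [] ⟫) (S ∩ blue x) λ z h →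
            ∧-intro (∧-left (∧-left h)) ([ (λ r → ⊥-elim
              (true≢false r (∖-right {S z} (∧-left {S z ∧ not (red x z)} h)))) , id ]′
              (colour x z (λ e → All.head (∉⟪⟫⁻ (x ∷ []) (∖-right {(S ∖ red x) z} h)) (sym e)))))
          (dense x x∈S)

        -- The vertex `x` may itself be a blue neighbour of `b`; it cannot be one of its own leaves.
        E : Sub N
        E = D ∖ ⟪ x ∷ [] ⟫

        E-red : ∀ z → z ∈ E → z ∈ R
        E-red z h = ∧-intro (∧-left (∧-left h))
          ([ id , (λ b → ⊥-elim (true≢false b (clear z (∧-left h)))) ]′
            (colour x z (λ e → All.head (∉⟪⟫⁻ (x ∷ []) (∖-right {D z} h)) (sym e))))

        finish : ∀ es → All (_∈ E) es → Unique es → (∀ z → z ∈ E → z ∈ ⟪ es ⟫) →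
          ∀ k → k + length es ≡ 3 → Choice R (b ∷ es) k → ⊥
        -- Five red neighbours of `x` in `S` suffice: only `b` and the three leaves are forbidden
        -- for `w`.
        finish es me ue all-E k k+e (chosen fs mf uf) = grow
          (pick R (b ∷ ys) (subst (λ l → suc l < # R) (sym three) R≥5))
          where
          ys : List (Fin N)
          ys = Vec.toList fs ++ es
          three : length ys ≡ 3
          three = trans (length-++ (Vec.toList fs)) (trans (cong (_+ length es) (length-toList fs)) k+e)
          mys : All (_∈ R) ys
          mys = Allₚ.++⁺ mf (All.map (E-red _) me)
          b∉E : ∀ {z} → z ∈ E → b ≢ z
          b∉E {z} h e = true≢false (∧-right {S z} (∧-left h)) (subst (λ y → y ∉ blue b) e (blue-irr b))
          u : ∀ xs → Unique (xs ++ b ∷ es) → Unique (xs ++ es)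
          u []       (_ ∷ v) = v
          u (y ∷ xs) (d ∷ v) = drop xs d ∷ u xs v
            where
            drop : ∀ xs → All (y ≢_) (xs ++ b ∷ es) → All (y ≢_) (xs ++ es)
            drop []       (_ ∷ d) = d
            drop (_ ∷ xs) (p ∷ d) = p ∷ drop xs d
          b∉fs : ∀ xs → Unique (xs ++ b ∷ es) → All (b ≢_) xs
          b∉fs []       _       = []
          b∉fs (y ∷ xs) (d ∷ v) = (λ e → All.head (Allₚ.++⁻ʳ xs d) (sym e)) ∷ b∉fs xs v
          red-of-b : ∀ z → z ∈ S → z ≢ b → z ≢ x → z ∉ ⟪ ys ⟫ → z ∈ red b
          red-of-b z z∈ z≢b z≢x z∉ = [ id , (λ bl → ⊥-elim (true≢false
            (all-E z (∖-intro (∧-intro z∈ bl) (∉⟪⟫ (z≢x ∷ [])))) (∉⟪⟫ (Allₚ.++⁻ʳ (Vec.toList fs) (∉⟪⟫⁻ ys z∉))))) ]′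
            (colour b z (z≢b ∘ sym))
          grow : (∃ λ w → w ∈ R × All (w ≢_) (b ∷ ys)) → ⊥
          grow (w , w∈ , (w≢b ∷ w∉ys)) = tree-free b w x ys (tree three
            (red-of-b w (∧-left w∈) w≢b (λ e → red⇒≢ (∧-right {S w} w∈) (sym e)) (∉⟪⟫ w∉ys))
            (flip-red (∧-right {S w} w∈))
            (All.map (λ {z} → ∧-right {S z}) mys)
            (((w≢b ∘ sym) ∷ (x≢b ∘ sym) ∷ Allₚ.++⁺ (b∉fs (Vec.toList fs) uf) (All.map b∉E me))
              ∷ ((λ e → red⇒≢ (∧-right {S w} w∈) (sym e)) ∷ w∉ys)
              ∷ All.map (λ {z} m → red⇒≢ (∧-right {S z} m)) mys
              ∷ u (Vec.toList fs) uf)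
            -- Without `b`, `x` and the three leaves, `S` still has n - 5 vertices, and `b` is red
            -- to all of them because the leaves absorb `E`.
            (linear (n ∷ # S ∷ # (S ∖ ⟪ b ∷ x ∷ ys ⟫) ∷ # (red b ∖ ⟪ x ∷ ys ⟫) ∷ length ys ∷ [])
              (λ n s t r l → n ≼ s ∷ s ≼ t ⊕ (K 2 ⊕ l) ∷ t ≼ r ∷ l ≐ K 3 ∷ [] ⊢ n ≼ K 5 ⊕ r)
              n≤S (#-remove S (b ∷ x ∷ ys))
              (#-mono (S ∖ ⟪ b ∷ x ∷ ys ⟫) (red b ∖ ⟪ x ∷ ys ⟫) λ z h →
                case ∉⟪⟫⁻ (b ∷ x ∷ ys) (∖-right {S z} h) of λ { (z≢b ∷ z≢x ∷ z∉) →
                  ∖-intro (red-of-b z (∧-left h) z≢b z≢x (∉⟪⟫ z∉)) (∉⟪⟫ (z≢x ∷ z∉)) })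
              three))

        contradiction : ⊥
        contradiction = with-E (enumeration E)
          where
          with-E : (∃ λ es → length es ≡ # E × All (_∈ E) es × Unique es × (∀ z → z ∈ E → z ∈ ⟪ es ⟫)) → ⊥
          with-E (es , le , me , ue , all-E) = finish es me ue all-E (3 ∸ length es) (m∸n+n≡m short)
            (choose R (3 ∸ length es) (All.map b≢ me ∷ ue)
              (subst (_≤ # R) (sym (trans (+-suc (3 ∸ length es) (length es)) (cong suc (m∸n+n≡m short))))
                (≤-trans (n≤1+n 4) R≥5)))
            where
            b≢ : ∀ {z} → z ∈ E → b ≢ z
            b≢ {z} h e = true≢false (∧-right {S z} (∧-left h)) (subst (λ y → y ∉ blue b) e (blue-irr b))
            short : length es ≤ 3
            short = ≤-trans (≤-reflexive le) (≤-trans (#-mono E D λ z → ∧-left) (dense b b∈S))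

      absurd : ⊥
      absurd = with-D (enumeration D)
        where
        with-D : (∃ λ ds → length ds ≡ # D × All (_∈ D) ds × Unique ds × (∀ z → z ∈ D → z ∈ ⟪ ds ⟫)) → ⊥
        with-D (ds , ld , md , _ , all-D) = with-x (#-inhabited (far ds)
          (linear (n ∷ # (far ds) ∷ length ds ∷ # D ∷ []) (λ n f l d → K 9 ≼ n ∷ n ≼ K 1 ⊕ f ⊕ (l ⊕ l) ∷ l ≐ d ∷
            d ≼ K 3 ∷ [] ⊢ K 1 ≼ f)
            9≤n (far-many ds md) ld (dense b b∈S)))
          where
          avoids : ∀ ds {x} → x ∈ far ds → All (λ d → x ∉ blue d) ds
          avoids []       h = []
          avoids (d ∷ ds) {x} h = ∖-right {far ds x} h ∷ avoids ds (∧-left h)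
          with-x : (∃ λ x → x ∈ far ds) → ⊥
          with-x (x , x∈) = contradiction x (∧-left (far-S ds x x∈)) (b∉⟪b⟫ {x} (∖-right {S x} (far-S ds x x∈)))
            λ z z∈ → trans (blue-sym x z) (∈⟪⟫ {P = λ d → x ∉ blue d} (avoids ds x∈) (all-D z z∈))

  dense-tree : 9 ≤ n → ∀ S → n ≤ # S → (∀ x → x ∈ S → # (S ∩ blue x) ≤ 3) → ⊥
  dense-tree 9≤n S n≤S dense = let (b , b∈) = #-inhabited S (≤-trans (s≤s z≤n) (≤-trans 9≤n n≤S)) in
    Dense.absurd 9≤n S n≤S dense b b∈

≤ᵇ-true : ∀ m n → (m ≤ᵇ n) ≡ true → m ≤ n
≤ᵇ-true m n h = ≤ᵇ⇒≤ m n (subst T (sym h) _)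

≤ᵇ-false : ∀ m n → (m ≤ᵇ n) ≡ false → n < m
≤ᵇ-false m n h = ≰⇒> λ le → subst T h (≤⇒≤ᵇ le)

halves : ∀ m n → m ≤ n ⊎ n < m
halves m n = [ inj₁ ∘ ≤ᵇ-true m n , inj₂ ∘ ≤ᵇ-false m n ]′ (decide (m ≤ᵇ n))

-- Colourings without tree and wheel

module Critical {N} (C : Colouring N) (n : ℕ) (9≤n : 9 ≤ n) (N+1≡2n : N + 1 ≡ n + n)
  (wheel-free : ∀ h c → ¬ Wheels.IsWheel C h c) (tree-free : ∀ v w x ys → ¬ IsTree C n v w x ys) where
  open Colouring C
  open Wheels C
  open Wheel-free wheel-free
  open Bipartite C wheel-free
  open Trees C n tree-free

  degree-sum : ∀ x → # (red x) + # (blue x) + 1 ≡ N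
  degree-sum x = ≤-antisym
    (≤-trans (linear (# (red x) ∷ # (blue x) ∷ # not-x ∷ # (_==ᶠ x) ∷ # all ∷ [])
        (λ r b m s a → r ⊕ b ≼ m ∷ m ⊕ s ≼ a ∷ s ≐ K 1 ∷ [] ⊢ r ⊕ b ⊕ K 1 ≼ a)
        (#-pack (red x) (blue x) not-x
          (λ y r → not-intro (≢-false (red⇒≢ r ∘ sym))) (λ y b → not-intro (≢-false (blue⇒≢ b ∘ sym)))
          (λ y → red⇒¬blue x y))
        (#-pack not-x (_==ᶠ x) all (λ _ _ → refl) (λ _ _ → refl) (λ y → not-elim))
        (#-single x)) (≤-reflexive #-all))
    (≤-trans (≤-reflexive (sym #-all))
      (linear (# (red x) ∷ # (blue x) ∷ # not-x ∷ # (_==ᶠ x) ∷ # all ∷ [])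
        (λ r b m s a → m ≼ r ⊕ b ∷ a ≼ m ⊕ s ∷ s ≐ K 1 ∷ [] ⊢ a ≼ r ⊕ b ⊕ K 1)
        (#-cover not-x (red x) (blue x) λ y h → colour x y (==-false {x = y} {x} (not-elim h) ∘ sym))
        (#-cover all not-x (_==ᶠ x) λ y _ → [ inj₂ , inj₁ ∘ not-intro ]′ (decide (y ==ᶠ x)))
        (#-single x)))
    where
    all not-x : Sub N
    all _   = true
    not-x y = not (y ==ᶠ x)

  #-less : ∀ (p : Sub N) x → x ∉ p → ∀ q → x ∈ q → (∀ y → y ∈ p → y ∈ q) → # p + 1 ≤ # q
  #-less p x x∉ q x∈ h = subst (λ k → # p + k ≤ # q) (#-single x)
    (#-pack p (_==ᶠ x) q h (λ y e → subst (_∈ q) (sym (==-true y x e)) x∈)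
      (λ y y∈ → ≢-false (separate p y∈ x∉)))

  join-blue : ∀ (p : Sub N) {x} → x ∉ p → # (p ∩ red x) ≤ 0 → ∀ y → y ∈ p → y ∈ blue x
  join-blue p {x} x∉ h y y∈ = [ (λ r → ⊥-elim (<⇒≱ (#-positive (p ∩ red x) (∧-intro y∈ r)) h)) , id ]′
    (colour x y (separate p y∈ x∉ ∘ sym))

  red-or-blue-count : ∀ (p : Sub N) {x} → x ∉ p → # p ≤ # (p ∩ red x) + # (p ∩ blue x)
  red-or-blue-count p {x} x∉ = #-cover p (p ∩ red x) (p ∩ blue x) λ y y∈ →
    [ inj₁ ∘ ∧-intro y∈ , inj₂ ∘ ∧-intro y∈ ]′ (colour x y (separate p y∈ x∉ ∘ sym))

  -- A vertex v of red degree n - 5 + k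

  module Centre (v : Fin N) (k : ℕ) (A-size : # (red v) + 5 ≡ n + k) where

    A B : Sub N
    A = red v
    B = blue v

    α β : Fin N → ℕ
    α x = # (A ∩ red x)
    β x = # (B ∩ red x)

    B-size : # B + k ≡ n + 3
    B-size = linear (# A ∷ # B ∷ n ∷ k ∷ N ∷ [])
      (λ a b n k N → a ⊕ K 5 ≐ n ⊕ k ∷ a ⊕ b ⊕ K 1 ≐ N ∷ N ⊕ K 1 ≐ n ⊕ n ∷ [] ⊢ b ⊕ k ≐ n ⊕ K 3)
      A-size (degree-sum v) N+1≡2n

    B∉A : ∀ {x} → x ∈ B → x ∉ A
    B∉A {x} = blue⇒¬red v x

    A∉B : ∀ {x} → x ∈ A → x ∉ B
    A∉B {x} = red⇒¬blue v x

    side : ∀ x → x ≡ v ⊎ x ∈ A ⊎ x ∈ B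
    side x with x ≟ v
    ... | yes e = inj₁ e
    ... | no ≢  = inj₂ (colour v x (≢ ∘ sym))

    red-count : ∀ (S : Sub N) x → v ∉ S → # (S ∩ red x) ≤ α x + β x
    red-count S x v∉ = #-cover (S ∩ red x) (A ∩ red x) (B ∩ red x) λ y h →
      [ (λ r → inj₁ (∧-intro r (∧-right {S y} h))) , (λ b → inj₂ (∧-intro b (∧-right {S y} h))) ]′
        (colour v y (separate S (∧-left h) v∉ ∘ sym))

    -- As many leaves as possible are taken from `B`, where they are free; `j₀` bounds the number
    -- taken from `A`. One vertex of `A` is reserved as the connecting vertex, whence `suc j`.
    distribute : ∀ α β j₀ → 1 ≤ α → 4 ≤ α + β → 3 ≤ j₀ + β →
      ∃ λ j → ∃ λ b → j + b ≡ 3 × suc j ≤ α × b ≤ β × j ≤ j₀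
    distribute α 0 j₀ h₁ h₄ h₃ = 3 , 0 , refl , subst (4 ≤_) (+-identityʳ α) h₄ , z≤n , subst (3 ≤_)
      (+-identityʳ j₀) h₃
    distribute α 1 j₀ h₁ h₄ h₃ = 2 , 1 , refl , +-cancelʳ-≤ 1 3 α h₄ , ≤-refl , +-cancelʳ-≤ 1 2 j₀ h₃
    distribute α 2 j₀ h₁ h₄ h₃ = 1 , 2 , refl , +-cancelʳ-≤ 2 2 α h₄ , ≤-refl , +-cancelʳ-≤ 2 1 j₀ h₃
    distribute α (suc (suc (suc β))) j₀ h₁ h₄ h₃ = 0 , 3 , refl , h₁ , s≤s (s≤s (s≤s z≤n)) , z≤n

    -- The surplus `k` has to pay for `x`, if it lies in `A`, and for at most `j₀` leaves in `A`.
    overfull : ∀ x → v ≢ x → ∀ j₀ → 1 ≤ α x → 4 ≤ α x + β x → 3 ≤ j₀ + β x → ι (A x) + j₀ ≤ k → ⊥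
    overfull x v≢x j₀ h₁ h₄ h₃ fits = go (distribute (α x) (β x) j₀ h₁ h₄ h₃)
      where
      go : (∃ λ j → ∃ λ b → j + b ≡ 3 × suc j ≤ α x × b ≤ β x × j ≤ j₀) → ⊥
      go (j , b , sum , hα , hβ , hj) = tree-from v x v≢x j b sum hα hβ
        (linear (n ∷ ι (A x) ∷ j ∷ j₀ ∷ k ∷ # A ∷ [])
          (λ n i j j₀ k a → i ⊕ j₀ ≼ k ∷ j ≼ j₀ ∷ a ⊕ K 5 ≐ n ⊕ k ∷ [] ⊢ n ⊕ i ⊕ j ≼ K 5 ⊕ a) fits hj A-size)

    overfull-B : ∀ x → x ∈ B → ∀ j₀ → 1 ≤ α x → 4 ≤ α x + β x → 3 ≤ j₀ + β x → j₀ ≤ k → ⊥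
    overfull-B x x∈ j₀ h₁ h₄ h₃ fits = overfull x (blue⇒≢ x∈) j₀ h₁ h₄ h₃
      (subst (λ b → ι b + j₀ ≤ k) (sym (B∉A x∈)) fits)

    overfull-A : ∀ x → x ∈ A → ∀ j₀ → 1 ≤ α x → 4 ≤ α x + β x → 3 ≤ j₀ + β x → suc j₀ ≤ k → ⊥
    overfull-A x x∈ j₀ h₁ h₄ h₃ fits = overfull x (red⇒≢ x∈) j₀ h₁ h₄ h₃
      (subst (λ b → ι b + j₀ ≤ k) (sym x∈) fits)

    module Isolated (U : Sub N) (U⊆B : ∀ x → x ∈ U → x ∈ B) (isolated : ∀ x → x ∈ U → α x ≤ 0) where

      U-A : ∀ u a → u ∈ U → a ∈ A → a ∈ blue u
      U-A u a u∈ = join-blue A (B∉A (U⊆B u u∈)) (isolated u u∈) a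

      A≥4 : 4 ≤ # A
      A≥4 = linear (n ∷ k ∷ # A ∷ []) (λ n k a → K 9 ≼ n ∷ a ⊕ K 5 ≐ n ⊕ k ∷ [] ⊢ K 4 ≼ a) 9≤n A-size

      -- All pairs between `U` and `A` are blue, so four blue neighbours of `u` in `U` form a blue
      -- K₄,₄ with four vertices of `A`, all of it in the blue neighbourhood of `u`.
      U-dense : ∀ u → u ∈ U → # (U ∩ blue u) ≤ 3
      U-dense u u∈ = [ id , (λ many → ⊥-elim (bipartite-wheel u (U ∩ blue u) A
        (λ x → ∧-right {U x}) (λ a → U-A u a u∈) (λ x a h → U-A x a (∧-left h)) many A≥4)) ]′
          (halves (# (U ∩ blue u)) 3)

    -- Red degree n - 5 + k with k ≤ 2

    module Small (k≤2 : k ≤ 2) where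

      low : Sub N
      low x = β x ≤ᵇ 2

      L U : Sub N
      L = B ∩ low
      U = B ∖ low

      -- Three leaves in `B` are free, so a single red neighbour in `A` would connect `x` to `v` and
      -- complete the tree.
      U-isolated : ∀ x → x ∈ U → α x ≤ 0
      U-isolated x h = [ id , (λ pos → ⊥-elim (overfull-B x (∧-left h) 0 pos
        (+-mono-≤ pos β≥3) β≥3 z≤n)) ]′ (halves (α x) 0)
        where
        β≥3 : 3 ≤ β x
        β≥3 = ≤ᵇ-false (β x) 2 (∖-right {B x} h)

      L-few : ∀ x → x ∈ L → β x ≤ 2
      L-few x h = ≤ᵇ-true (β x) 2 (∧-right {B x} h)

      open Isolated U (λ x → ∧-left) U-isolated

      -- `B` has n + 3 - k ≥ 10 vertices, so six remain for Jackson's theorem beside four vertices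
      -- of `L`.
      L≤3 : # L ≤ 3
      L≤3 = [ id , (λ many → ⊥-elim (go (choose L 4 [] many))) ]′ (halves (# L) 3)
        where
        go : Choice L [] 4 → ⊥
        go (chosen xs m u) = jackson-wheel v X (B ∖ X)
          (λ x x∈ → ∈⟪⟫ {P = _∈ B} (All.map ∧-left m) x∈) (λ y → ∧-left)
          (λ x x∈ → trans (cong (λ b → B x ∧ not b) x∈) (∧-zeroʳ (B x)))
          (λ x x∈ → ≤-trans (#-mono ((B ∖ X) ∩ red x) (B ∩ red x) λ y h → ∧-intro (∧-left (∧-left h))
            (∧-right {(B ∖ X) y} h))
            (∈⟪⟫ {P = λ x → β x ≤ 2} (All.map (L-few _) m) x∈))
          (subst (_≤ # X) (length-toList xs) (#-list-of (subst Unique (++-identityʳ _) u)))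
          (linear (# B ∷ # (B ∖ X) ∷ length (Vec.toList xs) ∷ n ∷ k ∷ [])
            (λ b y l n k → K 9 ≼ n ∷ k ≼ K 2 ∷ b ⊕ k ≐ n ⊕ K 3 ∷ b ≼ y ⊕ l ∷ l ≐ K 4 ∷ [] ⊢ K 6 ≼ y)
            9≤n k≤2 B-size (#-remove B (Vec.toList xs)) (length-toList xs))
          where
          X : Sub N
          X = ⟪ Vec.toList xs ⟫

      U-size : n ≤ # U + k
      U-size = linear (# B ∷ # L ∷ # U ∷ n ∷ k ∷ [])
        (λ b l u n k → b ⊕ k ≐ n ⊕ K 3 ∷ l ≼ K 3 ∷ b ≐ l ⊕ u ∷ [] ⊢ n ≼ u ⊕ k) B-size L≤3 (#-split B low)

      W : Sub N
      W x = not (U x)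

      U-few : ∀ w → w ∈ W → # (U ∩ red w) ≤ 2
      U-few w w∈ = few (side w)
        where
        none : (∀ u → u ∈ U → u ∈ blue w) → # (U ∩ red w) ≤ 2
        none h = ≤-trans (≤-reflexive (#-empty (U ∩ red w) λ u →
          [ (λ t → ⊥-elim (true≢false (∧-right {U u} t) (blue⇒¬red w u (h u (∧-left t))))) , id ]′
            (decide ((U ∩ red w) u)))) z≤n
        few : w ≡ v ⊎ w ∈ A ⊎ w ∈ B → # (U ∩ red w) ≤ 2
        few (inj₁ refl)       = none λ u → ∧-left
        few (inj₂ (inj₁ w∈A)) = none λ u u∈ → flip-blue (U-A u w u∈ w∈A)
        few (inj₂ (inj₂ w∈B)) = ≤-trans
          (#-mono (U ∩ red w) (B ∩ red w) λ y h → ∧-intro (∧-left (∧-left h)) (∧-right {U y} h))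
          ([ ≤ᵇ-true (β w) 2 , (λ f → ⊥-elim (true≢false (∖-intro w∈B f) (not-elim w∈))) ]′ (decide (low w)))

      -- If `w` has six blue neighbours in `U`, Jackson's theorem applies between these and four
      -- blue neighbours in `W`. Otherwise `w` has two red neighbours in `U`, which rules out `v`
      -- and `A`. Then `w` lies in `B` and has at most one red neighbour in `A`, so a K₄,₄ between
      -- `A` and `U` is found in its blue neighbourhood.
      W-dense : ∀ w → w ∈ W → # (W ∩ blue w) ≤ 3
      W-dense w w∈ = [ id , (λ many → ⊥-elim (crowded many)) ]′ (halves (# (W ∩ blue w)) 3)
        where
        w∉U : w ∉ U
        w∉U = not-elim w∈
        Y : Sub N
        Y = U ∩ blue w
        Y-size : # U ≤ # (U ∩ red w) + # Y
        Y-size = red-or-blue-count U w∉U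
        crowded : 4 ≤ # (W ∩ blue w) → ⊥
        crowded many = [ few-Y , jackson-wheel w (W ∩ blue w) Y (λ x → ∧-right {W x}) (λ y → ∧-right {U y})
            (λ x h → cong (_∧ blue w x) (not-elim (∧-left h)))
            (λ x h → ≤-trans (#-mono (Y ∩ red x) (U ∩ red x) λ y t → ∧-intro (∧-left (∧-left t)) (∧-right {Y y} t))
              (U-few x (∧-left h)))
            many ]′ (halves (# Y) 5)
          where
          few-Y : # Y ≤ 5 → ⊥
          few-Y Y≤5 = cases (side w)
            where
            red-two : 2 ≤ # (U ∩ red w)
            red-two = linear (n ∷ k ∷ # U ∷ # (U ∩ red w) ∷ # Y ∷ [])
              (λ n k u r y → K 9 ≼ n ∷ k ≼ K 2 ∷ n ≼ u ⊕ k ∷ u ≼ r ⊕ y ∷ y ≼ K 5 ∷ [] ⊢ K 2 ≼ r)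
              9≤n k≤2 U-size Y-size Y≤5
            k≥1 : 1 ≤ k
            k≥1 = linear (n ∷ k ∷ # U ∷ # (U ∩ red w) ∷ # Y ∷ [])
              (λ n k u r y → K 9 ≼ n ∷ r ≼ K 2 ∷ n ≼ u ⊕ k ∷ u ≼ r ⊕ y ∷ y ≼ K 5 ∷ [] ⊢ K 1 ≼ k)
              9≤n (U-few w w∈) U-size Y-size Y≤5
            none : (∀ u → u ∈ U → u ∈ blue w) → ⊥
            none h = case ≤-trans red-two (≤-reflexive (#-empty (U ∩ red w) λ u →
              [ (λ t → ⊥-elim (true≢false (∧-right {U u} t) (blue⇒¬red w u (h u (∧-left t))))) , id ]′
              (decide ((U ∩ red w) u)))) of λ ()
            cases : w ≡ v ⊎ w ∈ A ⊎ w ∈ B → ⊥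
            cases (inj₁ refl)       = none λ u → ∧-left
            cases (inj₂ (inj₁ w∈A)) = none λ u u∈ → flip-blue (U-A u w u∈ w∈A)
            cases (inj₂ (inj₂ w∈B)) = bipartite-wheel w (A ∩ blue w) Y (λ x → ∧-right {A x}) (λ y → ∧-right {U y})
              (λ x y hx hy → flip-blue (U-A y x (∧-left hy) (∧-left hx)))
              (linear (n ∷ k ∷ # A ∷ α w ∷ # (A ∩ blue w) ∷ [])
                (λ n k a r b → K 9 ≼ n ∷ K 1 ≼ k ∷ a ⊕ K 5 ≐ n ⊕ k ∷ r ≼ K 1 ∷ a ≼ r ⊕ b ∷ [] ⊢ K 4 ≼ b)
                9≤n k≥1 A-size α≤1 (red-or-blue-count A (B∉A w∈B)))
              (linear (n ∷ k ∷ # U ∷ # (U ∩ red w) ∷ # Y ∷ [])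
                (λ n k u r y → K 9 ≼ n ∷ k ≼ K 2 ∷ r ≼ K 2 ∷ n ≼ u ⊕ k ∷ u ≼ r ⊕ y ∷ [] ⊢ K 4 ≼ y)
                9≤n k≤2 (U-few w w∈) U-size Y-size)
              where
              β≥2 : 2 ≤ β w
              β≥2 = ≤-trans red-two
                (#-mono (U ∩ red w) (B ∩ red w) λ y h → ∧-intro (∧-left (∧-left h)) (∧-right {U y} h))
              α≤1 : α w ≤ 1
              α≤1 = [ id , (λ two → ⊥-elim (overfull-B w w∈B 1 (≤-trans (s≤s z≤n) two) (+-mono-≤ two β≥2) (s≤s β≥2)
                k≥1)) ]′
                (halves (α w) 1)

      absurd : ⊥
      -- `U` and `W` partition 2n - 1 vertices, so one of them has at least n.
      absurd = [ (λ many → dense-tree 9≤n U many U-dense) , (λ few → dense-tree 9≤n W (W-size few) W-dense) ]′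
        (halves n (# U))
        where
        every : Sub N
        every _ = true
        W-size : # U < n → n ≤ # W
        W-size few = linear (n ∷ N ∷ # U ∷ # W ∷ # every ∷ [])
          (λ n N u w a → K 1 ⊕ u ≼ n ∷ N ⊕ K 1 ≐ n ⊕ n ∷ a ≐ N ∷ a ≐ u ⊕ w ∷ [] ⊢ n ≼ w)
          few N+1≡2n #-all (#-split every U)

    -- Red degree n - 2

    module Middle (k≡3 : k ≡ 3) where

      B-law : ∀ x → x ∈ B → 1 ≤ α x → α x + β x ≤ 3
      B-law x x∈ pos = [ id , (λ four → ⊥-elim (overfull-B x x∈ 3 pos four (m≤m+n 3 (β x)) (≤-reflexive (sym k≡3))))
        ]′
        (halves (α x + β x) 3)

      -- Since `x` itself uses one unit of the surplus three, only two leaves in `A` can be paid for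
      -- and the third must lie in `B`.
      A-law : ∀ x → x ∈ A → 1 ≤ α x → 1 ≤ β x → α x + β x ≤ 3
      A-law x x∈ pos pos′ = [ id , (λ four → ⊥-elim (overfull-A x x∈ 2 pos four (+-monoʳ-≤ 2 pos′)
        (≤-reflexive (sym k≡3)))) ]′
        (halves (α x + β x) 3)

      free : Sub N
      free x = α x ≤ᵇ 0

      U B₂ : Sub N
      U  = B ∩ free
      B₂ = B ∖ free

      U-isolated : ∀ x → x ∈ U → α x ≤ 0
      U-isolated x h = ≤ᵇ-true (α x) 0 (∧-right {B x} h)

      B₂-α : ∀ x → x ∈ B₂ → 1 ≤ α x
      B₂-α x h = ≤ᵇ-false (α x) 0 (∖-right {B x} h)

      B₂-law : ∀ x → x ∈ B₂ → α x + β x ≤ 3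
      B₂-law x h = B-law x (∧-left h) (B₂-α x h)

      open Isolated U (λ x → ∧-left) U-isolated

      B≡n : # B ≡ n
      B≡n = linear (# B ∷ n ∷ k ∷ []) (λ b n k → k ≐ K 3 ∷ b ⊕ k ≐ n ⊕ K 3 ∷ [] ⊢ b ≐ n) k≡3 B-size

      A≥7 : 7 ≤ # A
      A≥7 = linear (# A ∷ n ∷ k ∷ []) (λ a n k → K 9 ≼ n ∷ k ≐ K 3 ∷ a ⊕ K 5 ≐ n ⊕ k ∷ [] ⊢ K 7 ≼ a) 9≤n k≡3 A-size

      -- Among eight blue neighbours of b, four in A and four in B, of which u ∈ U is one, nobody has four red ones.
      module Mixed (b u : Fin N) (b∈ : b ∈ B₂) (u∈ : u ∈ U) (bu : u ∈ blue b) where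

        go : Choice (A ∩ blue b) [] 4 → Choice (B ∩ blue b) (u ∷ []) 3 → ⊥
        go (chosen as ma ua′) (chosen bs mb ub) = sparse-wheel b S spokes sparse eight
          where
          as′ bs′ : List (Fin N)
          as′ = Vec.toList as
          bs′ = Vec.toList bs ++ u ∷ []
          ua : Unique as′
          ua = subst Unique (++-identityʳ _) ua′
          length-bs : length bs′ ≡ 4
          length-bs = trans (length-++ (Vec.toList bs)) (cong (_+ 1) (length-toList bs))
          mb′ : All (_∈ B ∩ blue b) bs′
          mb′ = Allₚ.++⁺ mb (∧-intro (∧-left u∈) bu ∷ [])
          S P Q : Sub N
          S x = ⟪ as′ ⟫ x ∨ ⟪ bs′ ⟫ x
          P = ⟪ as′ ⟫
          Q = ⟪ bs′ ⟫
          P-A : ∀ x → x ∈ P → x ∈ A ∩ blue b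
          P-A x = ∈⟪⟫ {P = _∈ A ∩ blue b} ma
          Q-B : ∀ x → x ∈ Q → x ∈ B ∩ blue b
          Q-B x = ∈⟪⟫ {P = _∈ B ∩ blue b} mb′
          S-cases : ∀ x → x ∈ S → x ∈ P ⊎ x ∈ Q
          S-cases x h with decide (P x)
          ... | inj₁ p = inj₁ p
          ... | inj₂ p = inj₂ (subst (λ c → c ∨ Q x ≡ true) p h)
          spokes : ∀ x → x ∈ S → x ∈ blue b
          spokes x h = [ (λ p → ∧-right {A x} (P-A x p)) , (λ q → ∧-right {B x} (Q-B x q)) ]′ (S-cases x h)
          #P≤4 : # P ≤ 4
          #P≤4 = ≤-trans (#-list as′) (≤-reflexive (length-toList as))
          #Q≤4 : # Q ≤ 4
          #Q≤4 = ≤-trans (#-list bs′) (≤-reflexive length-bs)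
          P∩Q : ∀ x → x ∈ P → x ∉ Q
          P∩Q x p = [ (λ q → ⊥-elim (true≢false (∧-left (Q-B x q)) (A∉B (∧-left (P-A x p))))) , id ]′ (decide (Q x))
          eight : 8 ≤ # S
          eight = ≤-trans
            (+-mono-≤ (subst (_≤ # P) (length-toList as) (#-list-of ua)) (subst (_≤ # Q) length-bs (#-list-of ub)))
            (#-pack P Q S (λ x p → cong (_∨ Q x) p) (λ x q → trans (cong (P x ∨_) q) (∨-zeroʳ (P x))) P∩Q)
          all-but : ∀ (p : Sub N) x z → z ∈ p → # p ≤ 4 → z ∉ red x → (∀ y → y ∈ S → y ∈ red x → y ∈ p) →
            # (S ∩ red x) ≤ 3
          all-but p x z z∈ p≤4 z∉ h = ≤-pred (≤-trans (subst (_≤ # p) (+-comm (# (S ∩ red x)) 1)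
            (#-less (S ∩ red x) z (trans (cong (S z ∧_) z∉) (∧-zeroʳ (S z))) p z∈
              λ y t → h y (∧-left t) (∧-right {S y} t))) p≤4)
          sparse-by-law : ∀ x → α x + β x ≤ 3 → # (S ∩ red x) ≤ 3
          sparse-by-law x = ≤-trans (#-cover (S ∩ red x) (A ∩ red x) (B ∩ red x) λ y h →
            [ (λ p → inj₁ (∧-intro (∧-left (P-A y p)) (∧-right {S y} h)))
            , (λ q → inj₂ (∧-intro (∧-left (Q-B y q)) (∧-right {S y} h))) ]′ (S-cases y (∧-left h)))
          not-in : ∀ (p : Sub N) x y → # (p ∩ red x) ≤ 0 → y ∈ red x → y ∈ p → ⊥
          not-in p x y h r m = <⇒≱ (#-positive (p ∩ red x) (∧-intro m r)) h
          u∈Q : ∀ xs → u ∈ ⟪ xs ++ u ∷ [] ⟫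
          u∈Q []       = cong (_∨ false) (==-refl u)
          u∈Q (x ∷ xs) = trans (cong ((u ==ᶠ x) ∨_) (u∈Q xs)) (∨-zeroʳ (u ==ᶠ x))
          sparse : ∀ x → x ∈ S → # (S ∩ red x) ≤ 3
          -- For a vertex to which neither law applies, all red neighbours in `S` lie in `P` or all
          -- lie in `Q`. One of the four vertices there is excluded: `x` itself, or `u` when `x` is
          -- in `P` and the neighbours are in `Q`.
          sparse x h = [ in-P , in-Q ]′ (S-cases x h)
            where
            in-Q : x ∈ Q → # (S ∩ red x) ≤ 3
            in-Q q = [ (λ zero → all-but Q x x q #Q≤4 (red-irr x) λ y s r →
                [ (λ p → ⊥-elim (not-in A x y zero r (∧-left (P-A y p)))) , id ]′ (S-cases y s))
              , (λ pos → sparse-by-law x (B-law x (∧-left (Q-B x q)) pos)) ]′ (halves (α x) 0)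
            in-P : x ∈ P → # (S ∩ red x) ≤ 3
            in-P p = [ (λ zero → all-but Q x u (u∈Q (Vec.toList bs)) #Q≤4
                  (trans (red-sym x u) (blue⇒¬red u x (U-A u x u∈ x∈A))) λ y s r →
                [ (λ p → ⊥-elim (not-in A x y zero r (∧-left (P-A y p)))) , id ]′ (S-cases y s))
              , (λ pos → [ (λ zero → all-but P x x p #P≤4 (red-irr x) λ y s r →
                  [ id , (λ q → ⊥-elim (not-in B x y zero r (∧-left (Q-B y q)))) ]′ (S-cases y s))
                , (λ pos′ → sparse-by-law x (A-law x x∈A pos pos′)) ]′ (halves (β x) 0)) ]′ (halves (α x) 0)
              where
              x∈A : x ∈ A
              x∈A = ∧-left (P-A x p)

        absurd : ⊥
        absurd = go
          (choose (A ∩ blue b) 4 [] (linear (# A ∷ α b ∷ β b ∷ # (A ∩ blue b) ∷ [])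
            (λ a r s l → K 7 ≼ a ∷ r ⊕ s ≼ K 3 ∷ a ≼ r ⊕ l ∷ [] ⊢ K 4 ≼ l)
            A≥7 (B₂-law b b∈) (red-or-blue-count A (B∉A (∧-left b∈)))))
          (choose (B ∩ blue b) 3 ([] ∷ []) (linear (# B ∷ # (B ∖ ⟪ b ∷ [] ⟫) ∷ # ((B ∖ ⟪ b ∷ [] ⟫) ∩ red b) ∷ β b ∷
            α b ∷ # ((B ∖ ⟪ b ∷ [] ⟫) ∩ blue b) ∷ # (B ∩ blue b) ∷ n ∷ [])
            (λ B B′ r β α b′ b n → K 9 ≼ n ∷ B ≐ n ∷ B ≼ B′ ⊕ K 1 ∷ B′ ≼ r ⊕ b′ ∷ r ≼ β ∷ b′ ≼ b ∷ α ⊕ β ≼ K 3 ∷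
              [] ⊢ K 4 ≼ b)
            9≤n B≡n (#-remove B (b ∷ [])) (red-or-blue-count (B ∖ ⟪ b ∷ [] ⟫) b∉)
            (#-mono ((B ∖ ⟪ b ∷ [] ⟫) ∩ red b) (B ∩ red b) λ y h → ∧-intro (∧-left (∧-left h))
              (∧-right {(B ∖ ⟪ b ∷ [] ⟫) y} h))
            (#-mono ((B ∖ ⟪ b ∷ [] ⟫) ∩ blue b) (B ∩ blue b) λ y h → ∧-intro (∧-left (∧-left h))
              (∧-right {(B ∖ ⟪ b ∷ [] ⟫) y} h))
            (B₂-law b b∈)))
          where
          b∉ : b ∉ B ∖ ⟪ b ∷ [] ⟫
          b∉ rewrite ==-refl b = ∧-zeroʳ (B b)

      -- The remaining possibility is n = 9: seven vertices of B form a blue clique, each of them with exactly one red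
      -- neighbour in A, while the other two vertices of B are red to all of them.
      module Clique (some : 1 ≤ # B₂) (few : # B₂ ≤ 7) (no-mixed : ∀ b → b ∈ B₂ → ∀ u → u ∈ U → u ∉ blue b) where

        split : # B ≡ # U + # B₂
        split = #-split B free

        U≥2 : 2 ≤ # U
        U≥2 = linear (n ∷ # B ∷ # U ∷ # B₂ ∷ []) (λ n b u c → K 9 ≼ n ∷ b ≐ n ∷ c ≼ K 7 ∷ b ≐ u ⊕ c ∷ [] ⊢ K 2 ≼ u)
          9≤n B≡n few split

        -- Here every pair between `B₂` and `U` is red. As `U` has at least two vertices and α + β ≤
        -- 3 with α ≥ 1, nothing is left for red edges inside `B₂` or for a second red neighbour in
        -- `A`.
        red-U : ∀ b → b ∈ B₂ → # U + # (B₂ ∩ red b) ≤ β b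
        red-U b b∈ = #-pack U (B₂ ∩ red b) (B ∩ red b)
          (λ u u∈ → ∧-intro (∧-left u∈) ([ id , (λ bl → ⊥-elim (true≢false bl (no-mixed b b∈ u u∈))) ]′
            (colour b u (λ e → true≢false (subst (_∈ U) (sym e) u∈ ∙) (∖-right {B b} b∈)))))
          (λ y h → ∧-intro (∧-left (∧-left h)) (∧-right {B₂ y} h))
          (λ u u∈ → [ (λ t → ⊥-elim (true≢false (∧-right {B u} u∈) (∖-right {B u} (∧-left {B₂ u} t)))) , id ]′
            (decide ((B₂ ∩ red b) u)))
          where
          _∙ : ∀ {x} → x ∈ U → free x ≡ true
          _∙ {x} = ∧-right {B x}

        α≤1 : ∀ b → b ∈ B₂ → α b ≤ 1
        α≤1 b b∈ = linear (# U ∷ # (B₂ ∩ red b) ∷ β b ∷ α b ∷ [])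
          (λ u r β α → K 2 ≼ u ∷ u ⊕ r ≼ β ∷ α ⊕ β ≼ K 3 ∷ [] ⊢ α ≼ K 1) U≥2 (red-U b b∈) (B₂-law b b∈)

        clique : ∀ b c → b ∈ B₂ → c ∈ B₂ → b ≢ c → c ∈ blue b
        clique b c b∈ c∈ b≢c = [ (λ r → ⊥-elim (<⇒≱ (#-positive (B₂ ∩ red b) (∧-intro c∈ r))
          (linear (# U ∷ # (B₂ ∩ red b) ∷ β b ∷ α b ∷ [])
            (λ u r β α → K 2 ≼ u ∷ u ⊕ r ≼ β ∷ K 1 ≼ α ∷ α ⊕ β ≼ K 3 ∷ [] ⊢ r ≼ K 0)
            U≥2 (red-U b b∈) (B₂-α b b∈) (B₂-law b b∈)))) , id ]′ (colour b c b≢c)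

        B₂≥7 : 7 ≤ # B₂
        B₂≥7 = go (#-inhabited B₂ some)
          where
          go : (∃ λ b → b ∈ B₂) → 7 ≤ # B₂
          go (b , b∈) = linear (n ∷ # B ∷ # U ∷ # B₂ ∷ # (B₂ ∩ red b) ∷ β b ∷ α b ∷ [])
            (λ n B u c r β α → K 9 ≼ n ∷ B ≐ n ∷ B ≐ u ⊕ c ∷ u ⊕ r ≼ β ∷ K 1 ≼ α ∷ α ⊕ β ≼ K 3 ∷ [] ⊢ K 7 ≼ c)
            9≤n B≡n split (red-U b b∈) (B₂-α b b∈) (B₂-law b b∈)

        A⇒∉B₂ : ∀ a → a ∈ A → a ∉ B₂
        A⇒∉B₂ a a∈ = cong (_∧ not (free a)) (A∉B a∈)

        with-a : ∀ a → a ∈ A → 4 ≤ # (B₂ ∩ blue a) → ⊥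
        with-a a a∈ many = go₁ (choose (B₂ ∩ blue a) 3 [] (≤-trans (n≤1+n 3) many))
          where
          go₁ : Choice (B₂ ∩ blue a) [] 3 → ⊥
          go₁ (chosen (b ∷ b₁ ∷ b₂ ∷ []) (m ∷ m₁ ∷ m₂ ∷ []) u) = go₂ (choose B₂ 4 u B₂≥7)
            where
            go₂ : Choice B₂ (b ∷ b₁ ∷ b₂ ∷ []) 4 → ⊥
            go₂ (chosen (b₃ ∷ b₄ ∷ b₅ ∷ b₆ ∷ []) (m₃ ∷ m₄ ∷ m₅ ∷ m₆ ∷ []) u′) =
              wheel-at b (a ∷ v ∷ b₃ ∷ b₄ ∷ b₅ ∷ b₆ ∷ b₁ ∷ b₂ ∷ [])
                (flip-blue (∧-right {B₂ b} m) ∷ flip-blue (∧-left (∧-left m)) ∷ All.map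
                  (λ { (c∈ , ≢) → clique b _ (∧-left m) c∈ ≢ }) others)
                ((separate A a∈ (red-irr v) ∷ All.map
                  (λ { (c∈ , _) e → true≢false (subst (_∈ B₂) (sym e) c∈) (A⇒∉B₂ a a∈) }) others)
                 ∷ All.map (λ { (c∈ , _) → blue⇒≢ (∧-left c∈) }) others
                 ∷ drop-b u′)
                -- The rim is a b₁ b₃ b₄ v b₅ b₆ b₂. It separates `a` from `v`, the only pair that
                -- is red for certain, and `a` stands between the two vertices chosen as its blue
                -- neighbours.
                (0F ∷ 6F ∷ 2F ∷ 3F ∷ 1F ∷ 4F ∷ 5F ∷ 7F ∷ [])
                (∧-right {B₂ b₁} m₁) (edge 4F 0F) (edge 0F 1F) (flip-blue (∧-left m₄)) (∧-left m₅) (edge 2F 3F)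
                  (edge 3F 5F)
                (flip-blue (∧-right {B₂ b₂} m₂))
              where
              six : Vec (Fin N) 6
              six = b₃ ∷ b₄ ∷ b₅ ∷ b₆ ∷ b₁ ∷ b₂ ∷ []
              members : All (_∈ B₂) (Vec.toList six)
              members = m₃ ∷ m₄ ∷ m₅ ∷ m₆ ∷ ∧-left m₁ ∷ ∧-left m₂ ∷ []
              drop-b : ∀ {w x y z p q r : Fin N} → Unique (w ∷ x ∷ y ∷ z ∷ p ∷ q ∷ r ∷ []) → Unique
                (w ∷ x ∷ y ∷ z ∷ q ∷ r ∷ [])
              drop-b ((a ∷ b ∷ c ∷ _ ∷ d) ∷ (e ∷ f ∷ _ ∷ g) ∷ (h ∷ _ ∷ i) ∷ (_ ∷ j) ∷ _ ∷ k) =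
                (a ∷ b ∷ c ∷ d) ∷ (e ∷ f ∷ g) ∷ (h ∷ i) ∷ j ∷ k
              not-b : ∀ {w x y z p q r : Fin N} → Unique (w ∷ x ∷ y ∷ z ∷ p ∷ q ∷ r ∷ []) → All (p ≢_)
                (w ∷ x ∷ y ∷ z ∷ q ∷ r ∷ [])
              not-b ((_ ∷ _ ∷ _ ∷ a ∷ _) ∷ (_ ∷ _ ∷ b ∷ _) ∷ (_ ∷ c ∷ _) ∷ (d ∷ _) ∷ (e ∷ f ∷ []) ∷ _) =
                (a ∘ sym) ∷ (b ∘ sym) ∷ (c ∘ sym) ∷ (d ∘ sym) ∷ e ∷ f ∷ []
              others : All (λ c → c ∈ B₂ × b ≢ c) (Vec.toList six)
              others = All.zip (members , not-b u′)
              edge : ∀ i j {_ : True (¬? (i ≟ j))} → lookup six j ∈ blue (lookup six i)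
              edge i j {t} = clique _ _ (lookup-all six members i) (lookup-all six members j)
                λ e → toWitness {a? = ¬? (i ≟ j)} t (lookup-injective six (drop-b u′) i j e)

        absurd : ⊥
        absurd = go (choose A 2 [] (≤-trans (s≤s (s≤s z≤n)) A≥7))
          where
          go : Choice A [] 2 → ⊥
          go (chosen (a ∷ a′ ∷ []) (m ∷ m′ ∷ []) ((a≢a′ ∷ []) ∷ _)) = [ other , with-a a m ]′
            (halves (# (B₂ ∩ blue a)) 3)
            where
            -- No vertex of `B₂` is red to both `a` and `a′`, so one of these two is blue to at
            -- least four of the seven vertices.
            disjoint : # (B₂ ∩ red a) + # (B₂ ∩ red a′) ≤ # B₂
            disjoint = #-pack (B₂ ∩ red a) (B₂ ∩ red a′) B₂ (λ x → ∧-left) (λ x → ∧-left) λ b h →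
              [ (λ h′ → ⊥-elim (<⇒≱ (length-≤ (A ∩ red b) ((a≢a′ ∷ []) ∷ [] ∷ [])
                  (∧-intro m (flip-red (∧-right {B₂ b} h)) ∷ ∧-intro m′ (flip-red (∧-right {B₂ b} h′)) ∷ []))
                  (α≤1 b (∧-left h)))) , id ]′ (decide ((B₂ ∩ red a′) b))
            other : # (B₂ ∩ blue a) ≤ 3 → ⊥
            other small = with-a a′ m′ (linear
              (# B₂ ∷ # (B₂ ∩ red a) ∷ # (B₂ ∩ red a′) ∷ # (B₂ ∩ blue a) ∷ # (B₂ ∩ blue a′) ∷ [])
              (λ b r r′ s s′ → K 7 ≼ b ∷ b ≼ K 7 ∷ s ≼ K 3 ∷ r ⊕ r′ ≼ b ∷ b ≼ r ⊕ s ∷ b ≼ r′ ⊕ s′ ∷ [] ⊢ K 4 ≼ s′)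
              B₂≥7 few small disjoint (red-or-blue-count B₂ (A⇒∉B₂ a m)) (red-or-blue-count B₂ (A⇒∉B₂ a′ m′)))

      mixed : Sub N
      mixed b = B₂ b ∧ (1 ≤ᵇ # (U ∩ blue b))

      -- If `B₂` is empty, then `U` is all of `B` and has n vertices. Eight vertices of `B₂` give a
      -- sparse set around `v`. In between, it matters whether some pair between `B₂` and `U` is
      -- blue.
      absurd : ⊥
      absurd = [ none , some ]′ (halves (# B₂) 0)
        where
        none : # B₂ ≤ 0 → ⊥
        none empty = dense-tree 9≤n U (linear (# B ∷ # U ∷ # B₂ ∷ n ∷ [])
          (λ b u c n → b ≐ n ∷ b ≐ u ⊕ c ∷ c ≼ K 0 ∷ [] ⊢ n ≼ u) B≡n (#-split B free) empty) U-dense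
        clique-or-mixed : 1 ≤ # B₂ → # B₂ ≤ 7 → ⊥
        clique-or-mixed pos few = go (search mixed)
          where
          go : (∃ λ b → b ∈ mixed) ⊎ (∀ b → b ∉ mixed) → ⊥
          go (inj₁ (b , h)) = let (u , t) = #-inhabited (U ∩ blue b) (≤ᵇ-true 1 _ (∧-right {B₂ b} h)) in
            Mixed.absurd b u (∧-left h) (∧-left t) (∧-right {U u} t)
          go (inj₂ h) = Clique.absurd pos few λ b b∈ u u∈ →
            [ (λ bl → ⊥-elim (<⇒≱ (#-positive (U ∩ blue b) (∧-intro u∈ bl))
              (≤-pred (≤ᵇ-false 1 (# (U ∩ blue b)) (trans (cong (_∧ (1 ≤ᵇ # (U ∩ blue b))) (sym b∈)) (h b)))))) , id
                ]′ (decide (blue b u))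
        some : 1 ≤ # B₂ → ⊥
        some pos = [ clique-or-mixed pos , sparse-wheel v B₂ (λ x → ∧-left) (λ x x∈ →
          ≤-trans (#-mono (B₂ ∩ red x) (B ∩ red x) λ y h → ∧-intro (∧-left (∧-left h)) (∧-right {B₂ y} h))
                  (≤-trans (m≤n+m (β x) (α x)) (B₂-law x x∈))) ]′ (halves (# B₂) 7)

    -- Red degree at least n - 1

    module Large (k≥4 : 4 ≤ k) where

      law : ∀ x → v ≢ x → 1 ≤ α x → α x + β x ≤ 3
      law x v≢x pos = [ id , (λ four → ⊥-elim (overfull x v≢x 3 pos four (m≤m+n 3 (β x))
        (≤-trans (+-monoˡ-≤ 3 (ι≤1 (A x))) k≥4))) ]′ (halves (α x + β x) 3)
        where
        ι≤1 : ∀ b → ι b ≤ 1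
        ι≤1 true  = ≤-refl
        ι≤1 false = z≤n

      α≤3 : ∀ x → v ≢ x → α x ≤ 3
      α≤3 x v≢x = [ (λ zero → ≤-trans zero z≤n) , (λ pos → ≤-trans (m≤m+n (α x) (β x)) (law x v≢x pos)) ]′
        (halves (α x) 0)

      A-part : ∀ (S : Sub N) → (∀ x → x ∈ S → x ∈ A) → ∀ x → x ∈ S → # (S ∩ red x) ≤ 3
      A-part S h x x∈ = ≤-trans (#-mono (S ∩ red x) (A ∩ red x) λ y t → ∧-intro (h y (∧-left t)) (∧-right {S y} t))
        (α≤3 x (red⇒≢ (h x x∈)))

      free free-B free-A : Sub N
      free x = α x ≤ᵇ 0
      free-B = B ∩ free
      free-A = A ∩ free

      -- The whole of `A` is blue to `b`; it has at least eight vertices, each with at most three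
      -- red neighbours in it.
      free-B-wheel : ∀ b → b ∈ free-B → ⊥
      free-B-wheel b h = sparse-wheel b A (join-blue A (B∉A (∧-left h)) (≤ᵇ-true (α b) 0 (∧-right {B b} h)))
        (A-part A λ x → id)
        (linear (# A ∷ n ∷ k ∷ []) (λ a n k → K 9 ≼ n ∷ K 4 ≼ k ∷ a ⊕ K 5 ≐ n ⊕ k ∷ [] ⊢ K 8 ≼ a) 9≤n k≥4 A-size)

      free-A-wheel : 9 ≤ # A → ∀ x → x ∈ free-A → ⊥
      free-A-wheel A≥9 x h = sparse-wheel x A′
        (join-blue A′ x∉ (≤-trans (#-mono (A′ ∩ red x) (A ∩ red x) λ y t → ∧-intro (∧-left (∧-left t))
          (∧-right {A′ y} t))
          (≤ᵇ-true (α x) 0 (∧-right {A x} h))))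
        (A-part A′ λ y → ∧-left)
        (linear (# A ∷ # A′ ∷ []) (λ a b → K 9 ≼ a ∷ a ≼ b ⊕ K 1 ∷ [] ⊢ K 8 ≼ b) A≥9 (#-remove A (x ∷ [])))
        where
        A′ : Sub N
        A′ = A ∖ ⟪ x ∷ [] ⟫
        x∉ : x ∉ A′
        x∉ rewrite ==-refl x = ∧-zeroʳ (A x)

      -- By `law` every vertex then has at most three red neighbours other than `v`. A vertex of `A`
      -- thus has red degree at most four, and its large blue neighbourhood, which misses `v`, is
      -- sparse.
      all-sparse : (∀ x → v ≢ x → 1 ≤ α x) → ⊥
      all-sparse pos = go (#-inhabited A (linear (# A ∷ n ∷ k ∷ [])
          (λ a n k → K 9 ≼ n ∷ K 4 ≼ k ∷ a ⊕ K 5 ≐ n ⊕ k ∷ [] ⊢ K 1 ≼ a) 9≤n k≥4 A-size))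
        where
        go : (∃ λ x → x ∈ A) → ⊥
        go (x , x∈) = sparse-wheel x (blue x) (λ y → id)
          (λ y y∈ → ≤-trans (red-count (blue x) y v∉) (law y (λ e → true≢false (subst (_∈ blue x) (sym e) y∈) v∉)
            (pos y (λ e → true≢false (subst (_∈ blue x) (sym e) y∈) v∉))))
          (linear (# (red x) ∷ # (blue x) ∷ N ∷ n ∷ α x ∷ β x ∷ # (red x ∖ ⟪ v ∷ [] ⟫) ∷
            # ((red x ∖ ⟪ v ∷ [] ⟫) ∩ red x) ∷ [])
            (λ r b N n α β r′ r″ → K 9 ≼ n ∷ N ⊕ K 1 ≐ n ⊕ n ∷ r ⊕ b ⊕ K 1 ≐ N ∷ α ⊕ β ≼ K 3 ∷ r ≼ r′ ⊕ K 1 ∷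
              r′ ≼ r″ ∷ r″ ≼ α ⊕ β ∷ [] ⊢ K 8 ≼ b)
            9≤n N+1≡2n (degree-sum x) (law x (red⇒≢ x∈) (pos x (red⇒≢ x∈))) (#-remove (red x) (v ∷ []))
            (#-mono (red x ∖ ⟪ v ∷ [] ⟫) ((red x ∖ ⟪ v ∷ [] ⟫) ∩ red x) λ y h → ∧-intro h (∧-left h))
            (red-count (red x ∖ ⟪ v ∷ [] ⟫) x v∉′))
          where
          v∉ : v ∉ blue x
          v∉ = red⇒¬blue x v (flip-red x∈)
          v∉′ : v ∉ red x ∖ ⟪ v ∷ [] ⟫
          v∉′ rewrite ==-refl v = ∧-zeroʳ (red x v)

      absurd : ⊥
      absurd = [ (λ { (b , h) → free-B-wheel b h }) , no-free-B ]′ (search free-B)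
        where
        positive : ∀ (p : Sub N) → (∀ x → x ∉ p ∩ free) → ∀ x → x ∈ p → 1 ≤ α x
        positive p h x x∈ = ≤ᵇ-false (α x) 0 (trans (cong (_∧ free x) (sym x∈)) (h x))
        no-free-B : (∀ x → x ∉ free-B) → ⊥
        no-free-B nb = [ small , sparse-wheel v B (λ x → id) (λ x x∈ →
            ≤-trans (m≤n+m (β x) (α x)) (law x (blue⇒≢ x∈) (positive B nb x x∈))) ]′ (halves (# B) 7)
          where
          small : # B ≤ 7 → ⊥
          small B≤7 = [ (λ { (x , h) → free-A-wheel A≥9 x h }) , (λ na → all-sparse λ x v≢x →
              [ positive A na x , positive B nb x ]′ (colour v x v≢x)) ]′ (search free-A)
            where
            A≥9 : 9 ≤ # A
            A≥9 = linear (# A ∷ # B ∷ N ∷ n ∷ []) (λ a b N n → K 9 ≼ n ∷ b ≼ K 7 ∷ N ⊕ K 1 ≐ n ⊕ n ∷ a ⊕ b ⊕ K 1 ≐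
              N ∷ [] ⊢ K 9 ≼ a)
              9≤n B≤7 N+1≡2n (degree-sum v)

    absurd : ⊥
    absurd = [ Small.absurd , (λ k≥3 → [ (λ k≤3 → Middle.absurd (≤-antisym k≤3 k≥3)) , Large.absurd ]′ (halves k 3))
      ]′ (halves k 2)

  red-degrees : ∀ v → # (red v) + 5 < n
  red-degrees v = [ (λ n≤ → ⊥-elim (Centre.absurd v (# (red v) + 5 ∸ n) (sym (m+[n∸m]≡n n≤)))) , id ]′
    (halves n (# (red v) + 5))

  -- All red degrees at most n - 6

  blue-degree : ∀ v → n + 4 ≤ # (blue v)
  blue-degree v = linear (# (red v) ∷ # (blue v) ∷ N ∷ n ∷ [])
    (λ r b N n → r ⊕ K 5 ≺ n ∷ r ⊕ b ⊕ K 1 ≐ N ∷ N ⊕ K 1 ≐ n ⊕ n ∷ [] ⊢ n ⊕ K 4 ≼ b)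
    (red-degrees v) (degree-sum v) N+1≡2n

  -- Any two vertices of X have four common blue neighbours in R = N(h) ∖ N(a), so that a blue cycle
  -- a x₁ r₁ x₂ r₂ x₃ r₃ x₄ can be built greedily.
  zigzag : ∀ h a → a ∈ blue h → ∀ s → n + 4 ≤ # (blue h ∖ blue a) + s →
    ∀ X → (∀ x → x ∈ X → x ∈ blue h) → (∀ x → x ∈ X → x ∈ blue a) →
    (∀ x → x ∈ X → # ((blue h ∖ blue a) ∩ red x) + # ((blue h ∖ blue a) ∩ red x) + s ≤ n) → 4 ≤ # X → ⊥
  zigzag h a a∈ s R-size X Xh Xa few X≥4 = go (choose X 4 [] X≥4)
    where
    R : Sub N
    R = blue h ∖ blue a
    R≢X : ∀ {x r} → r ∈ R → x ∈ X → r ≢ x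
    R≢X {x} {r} r∈ x∈ e = true≢false (Xa x x∈) (subst (_∉ blue a) e (∖-right {blue h r} r∈))
    common : ∀ x y → x ∈ X → y ∈ X → 4 ≤ # (R ∩ blue x ∩ blue y)
    common x y x∈ y∈ = linear
      (# R ∷ # (R ∩ red x) ∷ # (R ∩ red y) ∷ # (R ∩ blue x) ∷ # (R ∩ blue x ∩ red y) ∷ # (R ∩ blue x ∩ blue y) ∷ s ∷
        n ∷ [])
      (λ R x y bx bxy b s n → n ⊕ K 4 ≼ R ⊕ s ∷ x ⊕ x ⊕ s ≼ n ∷ y ⊕ y ⊕ s ≼ n ∷ R ≼ x ⊕ bx ∷ bx ≼ bxy ⊕ b ∷ bxy ≼
        y ∷ [] ⊢ K 4 ≼ b)
      R-size (few x x∈) (few y y∈) (red-or-blue-count R (x∉R x∈))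
        (red-or-blue-count (R ∩ blue x) (cong (_∧ blue x y) (x∉R y∈)))
      (#-mono (R ∩ blue x ∩ red y) (R ∩ red y) λ z h → ∧-intro (∧-left (∧-left h)) (∧-right {(R ∩ blue x) z} h))
      where
      x∉R : ∀ {x} → x ∈ X → x ∉ R
      x∉R {x} x∈ = trans (cong (λ b → blue h x ∧ not b) (Xa x x∈)) (∧-zeroʳ (blue h x))
    go : Choice X [] 4 → ⊥
    go (chosen (x₁ ∷ x₂ ∷ x₃ ∷ x₄ ∷ []) mx@(m₁ ∷ m₂ ∷ m₃ ∷ m₄ ∷ []) u) =
      -- Being no blue neighbour of itself, `a` lies in `R` and has to be avoided. With `r₁` and
      -- `r₂` this makes three forbidden vertices for `r₃`, hence four common neighbours.
      let (r₁ , h₁ , a₁ , _)           = pick′ (R ∩ blue x₁ ∩ blue x₂) (a ∷ [])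
            (≤-trans (s≤s (s≤s z≤n)) (common x₁ x₂ m₁ m₂))
          (r₂ , h₂ , a₂ , d₁₂ , _)       = pick′ (R ∩ blue x₂ ∩ blue x₃) (a ∷ r₁ ∷ [])
            (≤-trans (n≤1+n 3) (common x₂ x₃ m₂ m₃))
          (r₃ , h₃ , a₃ , d₁₃ , d₂₃ , _) = pick′ (R ∩ blue x₃ ∩ blue x₄) (a ∷ r₁ ∷ r₂ ∷ []) (common x₃ x₄ m₃ m₄)
          in-R : ∀ {r x y} → r ∈ R ∩ blue x ∩ blue y → r ∈ R
          in-R h = ∧-left (∧-left h)
      in wheel-at h (r₃ ∷ r₂ ∷ r₁ ∷ a ∷ x₁ ∷ x₂ ∷ x₃ ∷ x₄ ∷ [])
        (∧-left (in-R {r₃} {x₃} {x₄} h₃) ∷ ∧-left (in-R {r₂} {x₂} {x₃} h₂) ∷ ∧-left (in-R {r₁} {x₁} {x₂} h₁) ∷ a∈ ∷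
          All.map (Xh _) mx)
        ((d₂₃ ∷ d₁₃ ∷ a₃ ∷ All.map (R≢X (in-R {r₃} {x₃} {x₄} h₃)) mx)
          ∷ (d₁₂ ∷ a₂ ∷ All.map (R≢X (in-R {r₂} {x₂} {x₃} h₂)) mx)
          ∷ (a₁ ∷ All.map (R≢X (in-R {r₁} {x₁} {x₂} h₁)) mx)
          ∷ All.map (λ {x} x∈ → blue⇒≢ (Xa x x∈)) mx ∷ u)
        (3F ∷ 4F ∷ 2F ∷ 5F ∷ 1F ∷ 6F ∷ 0F ∷ 7F ∷ [])
        (Xa x₁ m₁) (∧-right {R r₁} (∧-left h₁)) (flip-blue (∧-right {(R ∩ blue x₁) r₁} h₁))
        (∧-right {R r₂} (∧-left h₂)) (flip-blue (∧-right {(R ∩ blue x₂) r₂} h₂))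
        (∧-right {R r₃} (∧-left h₃)) (flip-blue (∧-right {(R ∩ blue x₃) r₃} h₃)) (flip-blue (Xa x₄ m₄))

  module Edge (h a : Fin N) (a∈ : a ∈ blue h) where

    P : Sub N
    P = blue h ∩ blue a

    P≥9 : 9 ≤ # P
    P≥9 = linear (# (blue h) ∷ # (blue a) ∷ # P ∷ # every ∷ N ∷ n ∷ [])
      (λ h a p e N n → n ⊕ K 4 ≼ h ∷ n ⊕ K 4 ≼ a ∷ e ≐ N ∷ N ⊕ K 1 ≐ n ⊕ n ∷ h ⊕ a ≼ p ⊕ e ∷ [] ⊢ K 9 ≼ p)
      (blue-degree h) (blue-degree a) #-all N+1≡2n (#-overlap (blue h) (blue a) every (λ _ _ → refl) λ _ _ → refl)
      where
      every : Sub N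
      every _ = true

    P⇒h : ∀ x → x ∈ P → x ∈ blue h
    P⇒h x = ∧-left

    P⇒a : ∀ x → x ∈ P → x ∈ blue a
    P⇒a x = ∧-right {blue h x}

    path-at : ∀ (xs : Vec (Fin N) 7) → All (_∈ P) (Vec.toList xs) → Unique (Vec.toList xs) →
      ∀ (π : Vec (Fin 7) 7) {_ : True (injective? π)} →
      let e : Fin 7 → Fin 7 → Set
          e i j = lookup xs (lookup π j) ∈ blue (lookup xs (lookup π i)) in
      e 0F 1F → e 1F 2F → e 2F 3F → e 3F 4F → e 4F 5F → e 5F 6F → ⊥
    path-at xs m u π {t} e₀ e₁ e₂ e₃ e₄ e₅ = wheel-free h c (wheel c-injective spoke edge)
      where
      c : Fin 8 → Fin N
      c zero    = a
      c (suc i) = lookup xs (lookup π i)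
      c∈P : ∀ i → c (suc i) ∈ P
      c∈P i = lookup-all xs m (lookup π i)
      c-injective : IsInjective c
      c-injective zero    zero    e = refl
      c-injective zero    (suc j) e = ⊥-elim (blue⇒≢ (P⇒a _ (c∈P j)) e)
      c-injective (suc i) zero    e = ⊥-elim (blue⇒≢ (P⇒a _ (c∈P i)) (sym e))
      c-injective (suc i) (suc j) e = cong suc (toWitness {a? = injective? π} t i j (lookup-injective xs u _ _ e))
      spoke : ∀ i → c i ∈ blue h
      spoke zero    = a∈
      spoke (suc i) = P⇒h _ (c∈P i)
      edge : ∀ i → c (next i) ∈ blue (c i)
      edge 0F = P⇒a _ (c∈P 0F)
      edge 1F = e₀
      edge 2F = e₁
      edge 3F = e₂
      edge 4F = e₃
      edge 5F = e₄
      edge 6F = e₅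
      edge 7F = flip-blue (P⇒a _ (c∈P 6F))

    low : Sub N
    low x = # (P ∩ blue x) ≤ᵇ 5

    L T′ : Sub N
    L  = P ∩ low
    T′ = P ∖ low

    R Q : Sub N
    R = blue h ∖ blue a
    Q = blue a ∖ blue h

    -- Apart from itself and at most five blue neighbours, `x` is red to all of `P`, that is, to at
    -- least |P| - 6 vertices. Of its at most n - 6 red edges at most n - |P| leave `P`, and `R` and
    -- `Q` share these.
    L-red : ∀ x → x ∈ L → # (R ∩ red x) + # (Q ∩ red x) + # P ≤ n
    L-red x x∈ = linear
      (# (R ∩ red x) ∷ # (Q ∩ red x) ∷ # P ∷ n ∷ # (red x) ∷ # (red x ∖ P) ∷ # (red x ∩ P) ∷ # P′ ∷ # (P′ ∩ red x) ∷
        # (P′ ∩ blue x) ∷ # (P ∩ blue x) ∷ [])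
      (λ r q p n d o i p′ rp bp b → d ⊕ K 5 ≺ n ∷ d ≐ i ⊕ o ∷ r ⊕ q ≼ o ∷ p ≼ p′ ⊕ K 1 ∷ p′ ≼ rp ⊕ bp ∷ rp ≼ i ∷
        bp ≼ b ∷ b ≼ K 5 ∷ [] ⊢ r ⊕ q ⊕ p ≼ n)
      (red-degrees x) (#-split (red x) P)
      (#-pack (R ∩ red x) (Q ∩ red x) (red x ∖ P)
        (λ y t → ∖-intro (∧-right {R y} t) (trans (cong (blue h y ∧_) (∖-right {blue h y} (∧-left {R y} t)))
          (∧-zeroʳ (blue h y))))
        (λ y t → ∖-intro (∧-right {Q y} t) (cong (_∧ blue a y) (∖-right {blue a y} (∧-left {Q y} t))))
        (λ y t → cong (_∧ red x y) (cong (_∧ not (blue h y)) (∖-right {blue h y} (∧-left {R y} t)))))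
      (#-remove P (x ∷ [])) (red-or-blue-count P′ x∉)
      (#-mono (P′ ∩ red x) (red x ∩ P) λ y t → ∧-intro (∧-right {P′ y} t) (∧-left (∧-left t)))
      (#-mono (P′ ∩ blue x) (P ∩ blue x) λ y t → ∧-intro (∧-left (∧-left t)) (∧-right {P′ y} t))
      (≤ᵇ-true (# (P ∩ blue x)) 5 (∧-right {P x} x∈))
      where
      P′ : Sub N
      P′ = P ∖ ⟪ x ∷ [] ⟫
      x∉ : x ∉ P′
      x∉ rewrite ==-refl x = ∧-zeroʳ (P x)

    R-size : n + 4 ≤ # R + # P
    R-size = linear (# (blue h) ∷ # R ∷ # P ∷ n ∷ []) (λ b r p n → n ⊕ K 4 ≼ b ∷ b ≐ p ⊕ r ∷ [] ⊢ n ⊕ K 4 ≼ r ⊕ p)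
      (blue-degree h) (#-split (blue h) (blue a))

    Q-size : n + 4 ≤ # Q + # P
    Q-size = linear (# (blue a) ∷ # Q ∷ # P ∷ # (blue a ∩ blue h) ∷ n ∷ [])
      (λ b r p p′ n → n ⊕ K 4 ≼ b ∷ b ≐ p′ ⊕ r ∷ p′ ≼ p ∷ [] ⊢ n ⊕ K 4 ≼ r ⊕ p)
      (blue-degree a) (#-split (blue a) (blue h))
      (#-mono (blue a ∩ blue h) P λ y t → ∧-intro (∧-right {blue a y} t) (∧-left t))

    towards-Q : Sub N
    towards-Q x = # (R ∩ red x) ≤ᵇ # (Q ∩ red x)

    -- The smaller of the two red degrees, into `R` and into `Q`, is at most (n - |P|)/2, as
    -- `zigzag` requires. Of seven vertices four agree on the side; for `Q` the roles of `h` and `a`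
    -- are exchanged.
    L≤6 : # L ≤ 6
    L≤6 = [ id , (λ many → ⊥-elim (split many)) ]′ (halves (# L) 6)
      where
      split : 7 ≤ # L → ⊥
      split many =
        [ (λ few → zigzag a h (flip-blue a∈) (# P) Q-size (L ∖ towards-Q)
            (λ x t → P⇒a x (∧-left (∧-left t))) (λ x t → P⇒h x (∧-left (∧-left t)))
            (λ x t → linear (# (R ∩ red x) ∷ # (Q ∩ red x) ∷ # P ∷ n ∷ []) (λ r q p n → q ≺ r ∷ r ⊕ q ⊕ p ≼ n ∷
              [] ⊢ q ⊕ q ⊕ p ≼ n)
              (≤ᵇ-false (# (R ∩ red x)) (# (Q ∩ red x)) (∖-right {L x} t)) (L-red x (∧-left t)))
            (linear (# L ∷ # (L ∩ towards-Q) ∷ # (L ∖ towards-Q) ∷ []) (λ l i o → K 7 ≼ l ∷ l ≐ i ⊕ o ∷ i ≼ K 3 ∷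
              [] ⊢ K 4 ≼ o)
              many (#-split L towards-Q) few))
        , zigzag h a a∈ (# P) R-size (L ∩ towards-Q)
            (λ x t → P⇒h x (∧-left (∧-left t))) (λ x t → P⇒a x (∧-left (∧-left t)))
            (λ x t → linear (# (R ∩ red x) ∷ # (Q ∩ red x) ∷ # P ∷ n ∷ []) (λ r q p n → r ≼ q ∷ r ⊕ q ⊕ p ≼ n ∷
              [] ⊢ r ⊕ r ⊕ p ≼ n)
              (≤ᵇ-true (# (R ∩ red x)) (# (Q ∩ red x)) (∧-right {L x} t)) (L-red x (∧-left t)))
        ]′ (halves (# (L ∩ towards-Q)) 3)

    T≥3 : 3 ≤ # T′
    T≥3 = linear (# P ∷ # L ∷ # T′ ∷ []) (λ p l t → K 9 ≼ p ∷ l ≼ K 6 ∷ p ≐ l ⊕ t ∷ [] ⊢ K 3 ≼ t) P≥9 L≤6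
      (#-split P low)

    T-degree : ∀ t → t ∈ T′ → 6 ≤ # (P ∩ blue t)
    T-degree t t∈ = ≤ᵇ-false (# (P ∩ blue t)) 5 (∖-right {P t} t∈)

    L≢T : ∀ {l t} → l ∈ L → t ∈ T′ → l ≢ t
    L≢T {l} {t} l∈ t∈ e = true≢false (∧-right {P l} l∈) (subst (_∉ low) (sym e) (∖-right {P t} t∈))

    L-or-T : ∀ {x} → x ∈ P → x ∈ L ⊎ x ∈ T′
    L-or-T {x} x∈ = [ inj₁ ∘ ∧-intro x∈ , inj₂ ∘ ∖-intro x∈ ]′ (decide (low x))

    -- Two sets of four in `L`, which has at most six vertices, share at least two. The path is l t₁
    -- s t₂ s′ t₃ l′.
    fan : ∀ {t₁ t₂ t₃} → t₁ ∈ T′ → t₂ ∈ T′ → t₃ ∈ T′ → Unique (t₁ ∷ t₂ ∷ t₃ ∷ []) →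
      4 ≤ # (L ∩ blue t₁) → 4 ≤ # (L ∩ blue t₂) → 4 ≤ # (L ∩ blue t₃) → ⊥
    fan {t₁} {t₂} {t₃} m₁ m₂ m₃ u d₁ d₂ d₃ =
      let (s , hs , _)                  = pick′ (L ∩ blue t₁ ∩ blue t₂) [] (≤-trans (s≤s z≤n) (common d₁ d₂))
          (s′ , hs′ , e , _)           = pick′ (L ∩ blue t₂ ∩ blue t₃) (s ∷ []) (common d₂ d₃)
          (l , hl , f , g , _)         = pick′ (L ∩ blue t₁) (s ∷ s′ ∷ []) (≤-trans (n≤1+n 3) d₁)
          (l′ , hl′ , i , j , k , _)   = pick′ (L ∩ blue t₃) (s ∷ s′ ∷ l ∷ []) d₃
          all-T : All (_∈ T′) (t₁ ∷ t₂ ∷ t₃ ∷ [])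
          all-T = m₁ ∷ m₂ ∷ m₃ ∷ []
          L∈ : ∀ {x} → x ∈ L → All (x ≢_) (t₁ ∷ t₂ ∷ t₃ ∷ [])
          L∈ x∈ = All.map (L≢T x∈) all-T
      in path-at (l′ ∷ l ∷ s′ ∷ s ∷ t₁ ∷ t₂ ∷ t₃ ∷ [])
        (∧-left (∧-left hl′) ∷ ∧-left (∧-left hl) ∷ ∧-left (∧-left (∧-left hs′)) ∷ ∧-left (∧-left (∧-left hs)) ∷
          All.map ∧-left all-T)
        ((k ∷ j ∷ i ∷ L∈ (∧-left hl′)) ∷ (g ∷ f ∷ L∈ (∧-left hl)) ∷ (e ∷ L∈ (∧-left (∧-left hs′))) ∷
          L∈ (∧-left (∧-left hs)) ∷ u)
        (1F ∷ 4F ∷ 3F ∷ 5F ∷ 2F ∷ 6F ∷ 0F ∷ [])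
        (flip-blue (∧-right {L l} hl)) (∧-right {L s} (∧-left hs)) (flip-blue (∧-right {(L ∩ blue t₁) s} hs))
        (∧-right {L s′} (∧-left hs′)) (flip-blue (∧-right {(L ∩ blue t₂) s′} hs′)) (∧-right {L l′} hl′)
      where
      common : ∀ {x y} → 4 ≤ # (L ∩ blue x) → 4 ≤ # (L ∩ blue y) → 2 ≤ # (L ∩ blue x ∩ blue y)
      common {x} {y} dx dy = linear (# L ∷ # (L ∩ blue x) ∷ # (L ∩ blue y) ∷ # ((L ∩ blue x) ∩ (L ∩ blue y)) ∷
        # (L ∩ blue x ∩ blue y) ∷ [])
        (λ l a b c d → l ≼ K 6 ∷ K 4 ≼ a ∷ K 4 ≼ b ∷ a ⊕ b ≼ c ⊕ l ∷ c ≼ d ∷ [] ⊢ K 2 ≼ d)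
        L≤6 dx dy (#-overlap (L ∩ blue x) (L ∩ blue y) L (λ z → ∧-left) (λ z → ∧-left))
        (#-mono ((L ∩ blue x) ∩ (L ∩ blue y)) (L ∩ blue x ∩ blue y) λ z t →
          ∧-intro (∧-left t) (∧-right {L z} (∧-right {(L ∩ blue x) z} t)))

    -- Six blue neighbours in `P` exceed the five vertices to be avoided, so the path can be
    -- prolonged at both ends.
    path₅ : ∀ {x₀ x₁ x₂ x₃ x₄} → All (_∈ T′) (x₀ ∷ x₁ ∷ x₂ ∷ x₃ ∷ x₄ ∷ []) → Unique (x₀ ∷ x₁ ∷ x₂ ∷ x₃ ∷ x₄ ∷ []) →
      x₁ ∈ blue x₀ → x₂ ∈ blue x₁ → x₃ ∈ blue x₂ → x₄ ∈ blue x₃ → ⊥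
    path₅ {x₀} {x₁} {x₂} {x₃} {x₄} m u e₀ e₁ e₂ e₃ =
      let (y , hy , dy)                    = pick (P ∩ blue x₀) (x₀ ∷ x₁ ∷ x₂ ∷ x₃ ∷ x₄ ∷ [])
            (T-degree x₀ (All.head m))
          (z , hz , a , b , c , d , e , _) = pick′ (P ∩ blue x₄) (y ∷ x₀ ∷ x₁ ∷ x₂ ∷ x₃ ∷ [])
                                              (T-degree x₄ (lookup-all (x₀ ∷ x₁ ∷ x₂ ∷ x₃ ∷ x₄ ∷ []) m 4F))
      in path-at (z ∷ y ∷ x₀ ∷ x₁ ∷ x₂ ∷ x₃ ∷ x₄ ∷ [])
        (∧-left hz ∷ ∧-left hy ∷ All.map ∧-left m)
        ((a ∷ b ∷ c ∷ d ∷ e ∷ (blue⇒≢ (∧-right {P z} hz) ∘ sym) ∷ []) ∷ dy ∷ u)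
        (1F ∷ 2F ∷ 3F ∷ 4F ∷ 5F ∷ 6F ∷ 0F ∷ [])
        (flip-blue (∧-right {P y} hy)) e₀ e₁ e₂ e₃ (∧-right {P z} hz)

    module Path₄ (x t₀ t₁ y : Fin N) (x∈ : x ∈ T′) (t₀∈ : t₀ ∈ T′) (t₁∈ : t₁ ∈ T′) (y∈ : y ∈ T′)
      (x≢t₀ : x ≢ t₀) (x≢t₁ : x ≢ t₁) (x≢y : x ≢ y) (t₀≢t₁ : t₀ ≢ t₁) (t₀≢y : t₀ ≢ y) (t₁≢y : t₁ ≢ y)
      (xt₀ : t₀ ∈ blue x) (t₀t₁ : t₁ ∈ blue t₀) (t₁y : y ∈ blue t₁) where

      four : List (Fin N)
      four = x ∷ t₀ ∷ t₁ ∷ y ∷ []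

      all-T : All (_∈ T′) four
      all-T = x∈ ∷ t₀∈ ∷ t₁∈ ∷ y∈ ∷ []

      u : Unique four
      u = (x≢t₀ ∷ x≢t₁ ∷ x≢y ∷ []) ∷ (t₀≢t₁ ∷ t₀≢y ∷ []) ∷ (t₁≢y ∷ []) ∷ [] ∷ []

      L∈ : ∀ {l} → l ∈ L → All (l ≢_) four
      L∈ l∈ = All.map (L≢T l∈) all-T

      in-P : All (_∈ P) four
      in-P = All.map ∧-left all-T

      -- At most three of the six blue neighbours of an end lie on the path; by `path₅` the others
      -- are not in `T′`.
      end-degree : ∀ z → z ∈ T′ → (∀ w → w ∈ T′ → All (w ≢_) four → w ∈ blue z → ⊥) → ∀ os → length os ≡ 3 →
        (∀ w → w ≢ z → w ∉ ⟪ os ⟫ → All (w ≢_) four) → 3 ≤ # (L ∩ blue z)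
      end-degree z z∈ ends os three outside = linear (# (P ∩ blue z) ∷ # ((P ∩ blue z) ∖ ⟪ os ⟫) ∷ # (L ∩ blue z) ∷
        length os ∷ [])
        (λ p q l o → K 6 ≼ p ∷ p ≼ q ⊕ o ∷ o ≐ K 3 ∷ q ≼ l ∷ [] ⊢ K 3 ≼ l)
        (T-degree z z∈) (#-remove (P ∩ blue z) os) three
        (#-mono ((P ∩ blue z) ∖ ⟪ os ⟫) (L ∩ blue z) λ w h →
          let bw = ∧-right {P w} (∧-left h) in
          [ (λ l → ∧-intro l bw)
          , (λ t → ⊥-elim (ends w t (outside w (blue⇒≢ bw ∘ sym) (∖-right {(P ∩ blue z) w} h)) bw)) ]′
            (L-or-T (∧-left (∧-left h))))

      x-degree : 3 ≤ # (L ∩ blue x)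
      x-degree = end-degree x x∈ (λ w w∈ d b → path₅ (w∈ ∷ all-T) (d ∷ u) (flip-blue b) xt₀ t₀t₁ t₁y)
        (t₀ ∷ t₁ ∷ y ∷ []) refl λ w w≢x h → w≢x ∷ ∉⟪⟫⁻ (t₀ ∷ t₁ ∷ y ∷ []) h

      y-degree : 3 ≤ # (L ∩ blue y)
      y-degree = end-degree y y∈
        (λ { w w∈ (a ∷ b ∷ c ∷ d ∷ []) bl → path₅ (w∈ ∷ y∈ ∷ t₁∈ ∷ t₀∈ ∷ x∈ ∷ [])
          ((d ∷ c ∷ b ∷ a ∷ []) ∷ ((t₁≢y ∘ sym) ∷ (t₀≢y ∘ sym) ∷ (x≢y ∘ sym) ∷ []) ∷
            ((t₀≢t₁ ∘ sym) ∷ (x≢t₁ ∘ sym) ∷ []) ∷ ((x≢t₀ ∘ sym) ∷ []) ∷ [] ∷ [])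
          (flip-blue bl) (flip-blue t₁y) (flip-blue t₀t₁) (flip-blue xt₀) })
        (x ∷ t₀ ∷ t₁ ∷ []) refl λ w w≢y h → case ∉⟪⟫⁻ (x ∷ t₀ ∷ t₁ ∷ []) h of λ { (a ∷ b ∷ c ∷ []) → a ∷ b ∷ c ∷
          w≢y ∷ [] }

      joint : Sub N
      joint = L ∩ blue x ∩ blue y

      -- Here `s` closes x t₀ t₁ y to a cycle, which can be opened between `x` and `t₀` and
      -- prolonged there: q t₀ t₁ y s x z.
      with-joint : ∀ s → s ∈ joint → ⊥
      with-joint s hs =
        let (q , hq , a , b , c , d , _) = pick′ (P ∩ blue t₀) (x ∷ t₁ ∷ y ∷ s ∷ [])
              (≤-trans (n≤1+n 5) (T-degree t₀ t₀∈))
            (z , hz , e , f , _)         = pick′ (L ∩ blue x) (s ∷ q ∷ []) x-degree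
            s∈L                             = ∧-left (∧-left hs)
        in path-at (z ∷ q ∷ s ∷ x ∷ t₀ ∷ t₁ ∷ y ∷ [])
          (∧-left (∧-left hz) ∷ ∧-left hq ∷ ∧-left s∈L ∷ in-P)
          ((f ∷ e ∷ L∈ (∧-left hz)) ∷ (d ∷ a ∷ (blue⇒≢ (∧-right {P q} hq) ∘ sym) ∷ b ∷ c ∷ []) ∷ L∈ s∈L ∷ u)
          (1F ∷ 4F ∷ 5F ∷ 6F ∷ 2F ∷ 3F ∷ 0F ∷ [])
          (flip-blue (∧-right {P q} hq)) t₀t₁ t₁y (∧-right {(L ∩ blue x) s} hs)
            (flip-blue (∧-right {L s} (∧-left hs)))
          (∧-right {L z} hz)

      module Disjoint (disjoint : ∀ s → s ∉ joint) where

        apart : ∀ l → l ∈ L ∩ blue x → l ∉ L ∩ blue y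
        apart l h = [ (λ t → ⊥-elim (true≢false (∧-intro h (∧-right {L l} t)) (disjoint l))) , id ]′
          (decide ((L ∩ blue y) l))

        -- Two disjoint neighbourhoods of at least three vertices each exhaust the at most six
        -- vertices of `L`.
        covered : ∀ l → l ∈ L → l ∈ blue x ⊎ l ∈ blue y
        covered l l∈ = case decide (blue x l) of λ
          { (inj₁ b) → inj₁ b
          ; (inj₂ nx) → case decide (blue y l) of λ
            { (inj₁ b) → inj₂ b
            ; (inj₂ ny) → ⊥-elim (linear (# L ∷ # (L ∩ blue x) ∷ # (L ∩ blue y) ∷ # (L ∖ ⟪ l ∷ [] ⟫) ∷ [])
                (λ l a b m → l ≼ K 6 ∷ K 3 ≼ a ∷ K 3 ≼ b ∷ a ⊕ b ≼ m ∷ m ⊕ K 1 ≼ l ∷ [] ⊢⊥)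
                L≤6 x-degree y-degree
                (#-pack (L ∩ blue x) (L ∩ blue y) (L ∖ ⟪ l ∷ [] ⟫)
                  (λ z h → ∖-intro (∧-left h) (∉⟪⟫ (separate (blue x) (∧-right {L z} h) nx ∷ [])))
                  (λ z h → ∖-intro (∧-left h) (∉⟪⟫ (separate (blue y) (∧-right {L z} h) ny ∷ []))) apart)
                (#-less (L ∖ ⟪ l ∷ [] ⟫) l (l∉ l) L l∈ λ z → ∧-left)) } }
          where
          l∉ : ∀ l → l ∉ L ∖ ⟪ l ∷ [] ⟫
          l∉ l rewrite ==-refl l = ∧-zeroʳ (L l)

        -- The paths are z x q t₀ t₁ y z′ if `q` is blue to `x`, and z x t₀ q y t₁ q′ if it is blue
        -- to `y`.
        through-L : ∀ q → q ∈ L → q ∈ blue t₀ → q ∈ blue x ⊎ q ∈ blue y → ⊥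
        through-L q q∈ t₀q (inj₁ xq) =
          let (z , hz , a , _)       = pick′ (L ∩ blue x) (q ∷ []) (≤-trans (n≤1+n 2) x-degree)
              (z′ , hz′ , b , c , _) = pick′ (L ∩ blue y) (q ∷ z ∷ []) y-degree
          in path-at (z′ ∷ z ∷ q ∷ x ∷ t₀ ∷ t₁ ∷ y ∷ [])
            (∧-left (∧-left hz′) ∷ ∧-left (∧-left hz) ∷ ∧-left q∈ ∷ in-P)
            ((c ∷ b ∷ L∈ (∧-left hz′)) ∷ (a ∷ L∈ (∧-left hz)) ∷ L∈ q∈ ∷ u)
            (1F ∷ 3F ∷ 2F ∷ 4F ∷ 5F ∷ 6F ∷ 0F ∷ [])
            (flip-blue (∧-right {L z} hz)) xq (flip-blue t₀q) t₀t₁ t₁y (∧-right {L z′} hz′)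
        through-L q q∈ t₀q (inj₂ yq) =
          let (z , hz , a , _)                       = pick′ (L ∩ blue x) (q ∷ []) (≤-trans (n≤1+n 2) x-degree)
              (q′ , hq′ , b , c , d , e , f , _) = pick′ (P ∩ blue t₁) (q ∷ z ∷ x ∷ t₀ ∷ y ∷ []) (T-degree t₁ t₁∈)
          in path-at (q′ ∷ z ∷ q ∷ x ∷ t₀ ∷ t₁ ∷ y ∷ [])
            (∧-left hq′ ∷ ∧-left (∧-left hz) ∷ ∧-left q∈ ∷ in-P)
            ((c ∷ b ∷ d ∷ e ∷ (blue⇒≢ (∧-right {P q′} hq′) ∘ sym) ∷ f ∷ []) ∷ (a ∷ L∈ (∧-left hz)) ∷ L∈ q∈ ∷ u)
            (1F ∷ 3F ∷ 4F ∷ 2F ∷ 6F ∷ 5F ∷ 0F ∷ [])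
            (flip-blue (∧-right {L z} hz)) xt₀ t₀q (flip-blue yq) (flip-blue t₁y) (∧-right {P q′} hq′)

        -- If `r` is in `T′`, then r q t₀ t₁ y is a path on five vertices of `T′`. If `r` is in `L`,
        -- the paths are z y t₁ t₀ q r x and z x t₀ q r y t₁.
        through-T : ∀ q → q ∈ T′ → q ∈ blue t₀ → All (q ≢_) four → ∀ r → r ∈ P → r ∈ blue q → All (r ≢_) four → ⊥
        through-T q q∈ t₀q (qx ∷ qt₀ ∷ qt₁ ∷ qy ∷ []) r r∈ qr (rx ∷ rt₀ ∷ rt₁ ∷ ry ∷ []) =
          [ (λ r∈L → low-r r∈L (covered r r∈L))
          , (λ r∈T → path₅ (r∈T ∷ q∈ ∷ t₀∈ ∷ t₁∈ ∷ y∈ ∷ [])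
              (((blue⇒≢ qr ∘ sym) ∷ rt₀ ∷ rt₁ ∷ ry ∷ []) ∷ (qt₀ ∷ qt₁ ∷ qy ∷ []) ∷ (t₀≢t₁ ∷ t₀≢y ∷ []) ∷
                (t₁≢y ∷ []) ∷ [] ∷ [])
              (flip-blue qr) (flip-blue t₀q) t₀t₁ t₁y) ]′ (L-or-T r∈)
          where
          uq : Unique (q ∷ four)
          uq = (qx ∷ qt₀ ∷ qt₁ ∷ qy ∷ []) ∷ u
          Lq : ∀ {l} → l ∈ L → All (l ≢_) (q ∷ four)
          Lq l∈ = L≢T l∈ q∈ ∷ L∈ l∈
          low-r : r ∈ L → r ∈ blue x ⊎ r ∈ blue y → ⊥
          low-r r∈L (inj₁ xr) =
            let (z , hz , a , _) = pick′ (L ∩ blue y) (r ∷ []) (≤-trans (n≤1+n 2) y-degree)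
            in path-at (z ∷ r ∷ q ∷ x ∷ t₀ ∷ t₁ ∷ y ∷ [])
              (∧-left (∧-left hz) ∷ r∈ ∷ ∧-left q∈ ∷ in-P) ((a ∷ Lq (∧-left hz)) ∷ Lq r∈L ∷ uq)
              (0F ∷ 6F ∷ 5F ∷ 4F ∷ 2F ∷ 1F ∷ 3F ∷ [])
              (flip-blue (∧-right {L z} hz)) (flip-blue t₁y) (flip-blue t₀t₁) t₀q qr (flip-blue xr)
          low-r r∈L (inj₂ yr) =
            let (z , hz , a , _) = pick′ (L ∩ blue x) (r ∷ []) (≤-trans (n≤1+n 2) x-degree)
            in path-at (z ∷ r ∷ q ∷ x ∷ t₀ ∷ t₁ ∷ y ∷ [])
              (∧-left (∧-left hz) ∷ r∈ ∷ ∧-left q∈ ∷ in-P) ((a ∷ Lq (∧-left hz)) ∷ Lq r∈L ∷ uq)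
              (0F ∷ 3F ∷ 4F ∷ 2F ∷ 1F ∷ 6F ∷ 5F ∷ [])
              (flip-blue (∧-right {L z} hz)) xt₀ t₀q qr (flip-blue yr) (flip-blue t₁y)

        absurd : ⊥
        absurd =
          let (q , hq , a , b , c , _) = pick′ (P ∩ blue t₀) (x ∷ t₁ ∷ y ∷ []) (≤-trans (s≤s (s≤s (s≤s (s≤s z≤n))))
                (T-degree t₀ t₀∈))
              t₀q                         = ∧-right {P q} hq
          in [ (λ q∈L → through-L q q∈L t₀q (covered q q∈L))
             , (λ q∈T → let (r , hr , d) = pick (P ∩ blue q) four (≤-trans (n≤1+n 5) (T-degree q q∈T)) in
                 through-T q q∈T t₀q (a ∷ (blue⇒≢ t₀q ∘ sym) ∷ b ∷ c ∷ []) r (∧-left hr) (∧-right {P r} hr) d) ]′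
             (L-or-T (∧-left hq))

      absurd : ⊥
      absurd = [ (λ { (s , hs) → with-joint s hs }) , Disjoint.absurd ]′ (search joint)

    -- If a neighbour `e` of `t` had a second neighbour `e′` in `T′`, then e′ e t f would be
    -- excluded by `Path₄`. So three neighbours of `t` have all other blue neighbours in `L`, and
    -- `fan` applies to them.
    T-star : ∀ t → t ∈ T′ → 3 ≤ # (T′ ∩ blue t) → ⊥
    T-star t t∈ many = go (choose (T′ ∩ blue t) 3 [] many)
      where
      few : ∀ e → e ∈ T′ ∩ blue t → # ((T′ ∩ blue e) ∖ ⟪ t ∷ [] ⟫) ≤ 0
      few e he = [ id , (λ positive → ⊥-elim (
        let (e′ , h)          = #-inhabited ((T′ ∩ blue e) ∖ ⟪ t ∷ [] ⟫) positive
            ee′               = ∧-right {T′ e′} (∧-left h)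
            e′≢t              = All.head (∉⟪⟫⁻ (t ∷ []) (∖-right {(T′ ∩ blue e) e′} h))
            (f , hf , a , b , _) = pick′ (T′ ∩ blue t) (e ∷ e′ ∷ []) many
            te                = ∧-right {T′ e} he
            tf                = ∧-right {T′ f} hf
        in Path₄.absurd e′ e t f (∧-left (∧-left h)) (∧-left he) t∈ (∧-left hf)
             (blue⇒≢ ee′ ∘ sym) e′≢t (b ∘ sym) (blue⇒≢ te ∘ sym) (a ∘ sym) (blue⇒≢ tf)
             (flip-blue ee′) (flip-blue te) tf)) ]′ (halves (# ((T′ ∩ blue e) ∖ ⟪ t ∷ [] ⟫)) 0)
      L-degree : ∀ e → e ∈ T′ ∩ blue t → 4 ≤ # (L ∩ blue e)
      L-degree e he = linear (# (P ∩ blue e) ∷ # (L ∩ blue e) ∷ # (T′ ∩ blue e) ∷ # ((T′ ∩ blue e) ∖ ⟪ t ∷ [] ⟫) ∷ [])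
        (λ p l t t′ → K 6 ≼ p ∷ p ≼ l ⊕ t ∷ t ≼ t′ ⊕ K 1 ∷ t′ ≼ K 0 ∷ [] ⊢ K 4 ≼ l)
        (T-degree e (∧-left he)) (L+T e) (#-remove (T′ ∩ blue e) (t ∷ [])) (few e he)
        where
        L+T : ∀ e → # (P ∩ blue e) ≤ # (L ∩ blue e) + # (T′ ∩ blue e)
        L+T e = #-cover (P ∩ blue e) (L ∩ blue e) (T′ ∩ blue e) λ z h →
          [ (λ l → inj₁ (∧-intro l (∧-right {P z} h))) , (λ t → inj₂ (∧-intro t (∧-right {P z} h))) ]′
            (L-or-T (∧-left h))
      go : Choice (T′ ∩ blue t) [] 3 → ⊥
      go (chosen (a ∷ b ∷ c ∷ []) (ha ∷ hb ∷ hc ∷ []) u) =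
        fan (∧-left ha) (∧-left hb) (∧-left hc) u (L-degree a ha) (L-degree b hb) (L-degree c hc)

    T-L-degree : ∀ t → t ∈ T′ → 4 ≤ # (L ∩ blue t)
    T-L-degree t t∈ = [ (λ small → ⊥-elim
      (T-star t t∈ (linear (# (P ∩ blue t) ∷ # (L ∩ blue t) ∷ # (T′ ∩ blue t) ∷ [])
        (λ p l t → K 6 ≼ p ∷ l ≼ K 3 ∷ p ≼ l ⊕ t ∷ [] ⊢ K 3 ≼ t) (T-degree t t∈) small
        (#-cover (P ∩ blue t) (L ∩ blue t) (T′ ∩ blue t) λ z h →
          [ (λ l → inj₁ (∧-intro l (∧-right {P z} h))) , (λ t → inj₂ (∧-intro t (∧-right {P z} h))) ]′
            (L-or-T (∧-left h)))))) , id ]′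
      (halves (# (L ∩ blue t)) 3)

    absurd : ⊥
    absurd = go (choose T′ 3 [] T≥3)
      where
      go : Choice T′ [] 3 → ⊥
      go (chosen (a ∷ b ∷ c ∷ []) (ha ∷ hb ∷ hc ∷ []) u) =
        fan ha hb hc u (T-L-degree a ha) (T-L-degree b hb) (T-L-degree c hc)

  impossible : Fin N → ⊥
  impossible h = let (a , a∈) = #-inhabited (blue h) (≤-trans (≤-trans (s≤s z≤n) (m≤n+m 4 n)) (blue-degree h)) in
    Edge.absurd h a a∈

-- From colourings back to subgraph embeddings

T⇒true : ∀ {b} → T b → b ≡ true
T⇒true {true} _ = refl

true⇒T : ∀ {b} → b ≡ true → T b
true⇒T refl = tt

∨-true : ∀ a {b} → a ∨ b ≡ true → a ≡ true ⊎ b ≡ true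
∨-true true  _ = inj₁ refl
∨-true false h = inj₂ h

-- Graphs and colourings

W8-rim : ∀ (i j : Fin 8) → adj W8 (suc i) (suc j) ≡ true → j ≡ next i ⊎ i ≡ next j
W8-rim = toWitness {a? = all? λ i → all? λ j →
  (adj W8 (suc i) (suc j) ≟ᵇ true) →-dec ((j ≟ next i) ⊎-dec (i ≟ next j))} tt

module Sn5-edges (l : ℕ) where

  -- With `l` = n - 6, the number of leaves at the large centre, the truncated subtractions in `Sn5`
  -- become successors.
  n : ℕ
  n = suc (l + 5)

  n∸5 : n ∸ 5 ≡ suc l
  n∸5 = m+n∸n≡m (suc l) 5

  n∸4 : n ∸ 4 ≡ suc (suc l)
  n∸4 = trans (cong (_∸ 4) (cong suc (+-suc l 4))) (m+n∸n≡m (suc (suc l)) 4)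

  data Edge (a b : ℕ) : Set where
    large : a ≡ 0 → 1 ≤ b → b ≤ suc l → Edge a b
    small : a ≡ suc (suc l) → suc l ≤ b → b ≢ suc (suc l) → Edge a b

  related : ℕ → ℕ → Bool
  related a b = ((a ≡ᵇ 0) ∧ (1 ≤ᵇ b) ∧ (b ≤ᵇ (n ∸ 5))) ∨ ((a ≡ᵇ (n ∸ 4)) ∧ ((n ∸ 5) ≤ᵇ b) ∧ not (b ≡ᵇ (n ∸ 4)))

  decode : ∀ a b → related a b ≡ true → Edge a b
  decode a b h = [ left , right ]′ (∨-true ((a ≡ᵇ 0) ∧ (1 ≤ᵇ b) ∧ (b ≤ᵇ (n ∸ 5))) h)
    where
    left : (a ≡ᵇ 0) ∧ (1 ≤ᵇ b) ∧ (b ≤ᵇ (n ∸ 5)) ≡ true → Edge a b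
    left h = let h′ = ∧-right {a ≡ᵇ 0} h in
      large (≡ᵇ⇒≡ a 0 (true⇒T (∧-left {a ≡ᵇ 0} h))) (≤ᵇ-true 1 b (∧-left {1 ≤ᵇ b} h′))
        (subst (b ≤_) n∸5 (≤ᵇ-true b (n ∸ 5) (∧-right {1 ≤ᵇ b} h′)))
    right : (a ≡ᵇ (n ∸ 4)) ∧ ((n ∸ 5) ≤ᵇ b) ∧ not (b ≡ᵇ (n ∸ 4)) ≡ true → Edge a b
    right h = let h′ = ∧-right {a ≡ᵇ (n ∸ 4)} h in
      small (trans (≡ᵇ⇒≡ a (n ∸ 4) (true⇒T (∧-left {a ≡ᵇ (n ∸ 4)} h))) n∸4)
        (subst (_≤ b) n∸5 (≤ᵇ-true (n ∸ 5) b (∧-left {(n ∸ 5) ≤ᵇ b} h′)))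
        (λ e → true≢false (T⇒true (≡⇒≡ᵇ b (n ∸ 4) (trans e (sym n∸4)))) (∖-right {(n ∸ 5) ≤ᵇ b} h′))

  encode : ∀ a b → Edge a b → related a b ≡ true
  encode a b (large refl 1≤b b≤) = cong (_∨ ((0 ≡ᵇ (n ∸ 4)) ∧ ((n ∸ 5) ≤ᵇ b) ∧ not (b ≡ᵇ (n ∸ 4))))
    (∧-intro (T⇒true (≤⇒≤ᵇ 1≤b)) (T⇒true (≤⇒≤ᵇ (subst (b ≤_) (sym n∸5) b≤))))
  encode a b (small refl ≤b b≢) = trans (cong (((a ≡ᵇ 0) ∧ (1 ≤ᵇ b) ∧ (b ≤ᵇ (n ∸ 5))) ∨_) (∧-intro
      (T⇒true (≡⇒≡ᵇ a (n ∸ 4) (sym n∸4)))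
      (∖-intro (T⇒true (≤⇒≤ᵇ (subst (_≤ b) (sym n∸5) ≤b))) (b≢ᵇ (decide (b ≡ᵇ (n ∸ 4)))))))
    (∨-zeroʳ ((a ≡ᵇ 0) ∧ (1 ≤ᵇ b) ∧ (b ≤ᵇ (n ∸ 5))))
    where
    b≢ᵇ : (b ≡ᵇ (n ∸ 4)) ≡ true ⊎ (b ≡ᵇ (n ∸ 4)) ≡ false → (b ≡ᵇ (n ∸ 4)) ≡ false
    b≢ᵇ (inj₁ t) = ⊥-elim (b≢ (trans (≡ᵇ⇒≡ b (n ∸ 4) (true⇒T t)) n∸4))
    b≢ᵇ (inj₂ f) = f

  edge⁻ : ∀ i j → adj (Sn5 n) i j ≡ true → Edge (toℕ i) (toℕ j) ⊎ Edge (toℕ j) (toℕ i)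
  edge⁻ i j h = [ inj₁ ∘ decode (toℕ i) (toℕ j) , inj₂ ∘ decode (toℕ j) (toℕ i) ]′
    (∨-true (related (toℕ i) (toℕ j)) (∧-right {not (i ==ᶠ j)} h))

  edge : ∀ i j → i ≢ j → Edge (toℕ i) (toℕ j) → adj (Sn5 n) i j ≡ true
  edge i j i≢j e = ∧-intro (not-intro (≢-false i≢j)) (cong (_∨ related (toℕ j) (toℕ i)) (encode (toℕ i) (toℕ j) e))

module Embeddings {N} (F : Graph N) where

  complement-edge : ∀ x y → adj (complement F) x y ≡ true → adj F x y ≡ false
  complement-edge x y h = [ not-elim , (λ t → trans (Graph.sym F x y) (not-elim t)) ]′
    (∨-true (not (adj F x y)) (∧-right {not (x ==ᶠ y)} h))

  colouring : Colouring N
  colouring = record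
    { red       = adj F
    ; blue      = adj (complement F)
    ; red-sym   = Graph.sym F
    ; blue-sym  = Graph.sym (complement F)
    ; red-irr   = irrefl F
    ; blue-irr  = irrefl (complement F)
    ; colour    = λ x y x≢y → [ inj₁ , (λ f → inj₂ (∧-intro (not-intro (≢-false x≢y))
                    (cong (_∨ not (adj F y x)) (not-intro f)))) ]′ (decide (adj F x y))
    ; red⇒¬blue = λ x y r → [ (λ t → ⊥-elim (true≢false r (complement-edge x y t))) , id ]′
      (decide (adj (complement F) x y))
    }

  open Colouring colouring
  open Wheels colouring

  wheel-embeds : ∀ {h c} → IsWheel h c → W8 ⊆ complement F
  wheel-embeds {h} {c} (wheel injective spoke edge) = f , (λ {i} {j} → f-injective i j) , f-edge
    where
    h≢c : ∀ i → h ≢ c i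
    h≢c i e = true≢false (spoke i) (subst (_∉ blue h) e (blue-irr h))
    f : Fin 9 → Fin N
    f zero    = h
    f (suc i) = c i
    f-injective : ∀ i j → f i ≡ f j → i ≡ j
    f-injective zero    zero    e = refl
    f-injective zero    (suc j) e = ⊥-elim (h≢c j e)
    f-injective (suc i) zero    e = ⊥-elim (h≢c i (sym e))
    f-injective (suc i) (suc j) e = cong suc (injective i j e)
    f-edge : ∀ i j → adj W8 i j ≡ true → f j ∈ blue (f i)
    f-edge zero    zero    ()
    f-edge zero    (suc j) _ = spoke j
    f-edge (suc i) zero    _ = trans (blue-sym (c i) h) (spoke i)
    f-edge (suc i) (suc j) e = [ (λ { refl → edge i }) , (λ { refl → trans (blue-sym (c i) (c j)) (edge j) }) ]′
      (W8-rim i j e)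

  module Tree-embeds (l : ℕ) (v w x : Fin N) (ys : List (Fin N)) (t : IsTree colouring (suc (l + 5)) v w x ys) where
    open Sn5-edges l
    open IsTree t

    with-leaves : ∀ y₁ y₂ y₃ → ys ≡ y₁ ∷ y₂ ∷ y₃ ∷ [] → Choice (red v ∖ ⟪ x ∷ ys ⟫) (w ∷ []) l → Sn5 n ⊆ F
    with-leaves y₁ y₂ y₃ refl (chosen zs m u) = f , (λ {i} {j} → lookup-injective all unique i j) , f-edge
      where
      rest : Vec (Fin N) 5
      rest = w ∷ x ∷ y₁ ∷ y₂ ∷ y₃ ∷ []
      -- The positions follow the labels of `Sn5`: the large centre, its `l` leaves, the connecting
      -- vertex, the small centre and its three leaves.
      all : Vec (Fin N) n
      all = v ∷ (zs Vec.++ rest)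
      f : Fin n → Fin N
      f = lookup all
      toList-++ : ∀ {k} (as : Vec (Fin N) k) → Vec.toList as ++ Vec.toList rest ≡ Vec.toList (as Vec.++ rest)
      toList-++ []       = refl
      toList-++ (a ∷ as) = cong (a ∷_) (toList-++ as)
      fresh-rest : ∀ as → Unique (as ++ w ∷ []) → All (_∈ red v ∖ ⟪ x ∷ ys ⟫) as →
        Unique (as ++ Vec.toList rest) × All (v ≢_) (as ++ Vec.toList rest)
      fresh-rest [] _ [] = case distinct of λ { (d ∷ u) → u , d }
      fresh-rest (a ∷ as) (d ∷ u) (h ∷ hs) = let (u′ , d′) = fresh-rest as u hs in
        (Allₚ.++⁺ (Allₚ.++⁻ˡ as d) (All.head (Allₚ.++⁻ʳ as d) ∷ ∉⟪⟫⁻ (x ∷ ys) (∖-right {red v a} h)) ∷ u′)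
        , (λ e → true≢false (∧-left h) (subst (λ z → z ∉ red v) e (red-irr v))) ∷ d′
      unique : Unique (Vec.toList all)
      unique = let (u′ , d) = fresh-rest (Vec.toList zs) u m in
        subst (λ as → Unique (v ∷ as)) (toList-++ zs) (d ∷ u′)

      view : ∀ {k} (as : Vec (Fin N) k) (i : Fin (k + 5)) →
        (∃ λ j → toℕ i ≡ toℕ j × lookup (as Vec.++ rest) i ≡ lookup as j) ⊎
        (∃ λ j → toℕ i ≡ k + toℕ j × lookup (as Vec.++ rest) i ≡ lookup rest j)
      view []       i       = inj₂ (i , refl , refl)
      view (a ∷ as) zero    = inj₁ (zero , refl , refl)
      view (a ∷ as) (suc i) with view as i
      ... | inj₁ (j , e , e′) = inj₁ (suc j , cong suc e , e′)
      ... | inj₂ (j , e , e′) = inj₂ (j , cong suc e , e′)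

      zs-red : ∀ j → lookup zs j ∈ red v
      zs-red j = ∧-left (lookup-all zs m j)

      large-leaf : ∀ i → 1 ≤ toℕ i → toℕ i ≤ suc l → f i ∈ red v
      large-leaf (suc i) _ (s≤s i≤l) with view zs i
      ... | inj₁ (j , _ , e)     = subst (_∈ red v) (sym e) (zs-red j)
      ... | inj₂ (0F , _ , e)    = subst (_∈ red v) (sym e) vw
      ... | inj₂ (suc j , e , _) = ⊥-elim (m+1+n≰m l (subst (_≤ l) e i≤l))

      small-centre : ∀ i → toℕ i ≡ suc (suc l) → f i ≡ x
      small-centre (suc i) i≡ with view zs i
      ... | inj₁ (j , e , _) = ⊥-elim
        (1+n≰n (≤-trans (Finₚ.toℕ<n j) (≤-trans (n≤1+n l) (≤-reflexive (trans (sym (suc-injective i≡)) e)))))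
      ... | inj₂ (j , e , e′) = trans e′ (cong (lookup rest) {j} {1F} (Finₚ.toℕ-injective (+-cancelˡ-≡ l (toℕ j) 1
              (trans (sym e) (trans (suc-injective i≡) (+-comm 1 l))))))

      small-leaf : ∀ i → suc l ≤ toℕ i → toℕ i ≢ suc (suc l) → f i ∈ red x
      small-leaf (suc i) (s≤s l≤i) i≢ with view zs i
      ... | inj₁ (j , e , _)   = ⊥-elim (1+n≰n (≤-trans (Finₚ.toℕ<n j) (≤-trans l≤i (≤-reflexive e))))
      ... | inj₂ (0F , _ , e)  = subst (_∈ red x) (sym e) (trans (red-sym x w) wx)
      ... | inj₂ (1F , e , _)  = ⊥-elim (i≢ (cong suc (trans e (+-comm l 1))))
      ... | inj₂ (2F , _ , e)  = subst (_∈ red x) (sym e) (lookup-all (y₁ ∷ y₂ ∷ y₃ ∷ []) xy 0F)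
      ... | inj₂ (3F , _ , e)  = subst (_∈ red x) (sym e) (lookup-all (y₁ ∷ y₂ ∷ y₃ ∷ []) xy 1F)
      ... | inj₂ (4F , _ , e)  = subst (_∈ red x) (sym e) (lookup-all (y₁ ∷ y₂ ∷ y₃ ∷ []) xy 2F)

      directed : ∀ i j → Edge (toℕ i) (toℕ j) → f j ∈ red (f i)
      directed zero    j (large _ 1≤j j≤) = large-leaf j 1≤j j≤
      directed (suc i) j (large () _ _)
      directed i       j (small i≡ ≤j j≢) = subst (λ z → f j ∈ red z) (sym (small-centre i i≡)) (small-leaf j ≤j j≢)

      f-edge : ∀ i j → adj (Sn5 n) i j ≡ true → f j ∈ red (f i)
      f-edge i j h = [ directed i j , (λ e → trans (red-sym (f i) (f j)) (directed j i e)) ]′ (edge⁻ i j h)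

    embeds : Sn5 n ⊆ F
    embeds = list ys refl three
      where
      enough : l + 1 ≤ # (red v ∖ ⟪ x ∷ ys ⟫)
      enough = linear (l ∷ # (red v ∖ ⟪ x ∷ ys ⟫) ∷ []) (λ l r → K 1 ⊕ (l ⊕ K 5) ≼ K 5 ⊕ r ∷ [] ⊢ l ⊕ K 1 ≼ r) leaves
      list : ∀ zs → ys ≡ zs → length zs ≡ 3 → Sn5 n ⊆ F
      list (y₁ ∷ y₂ ∷ y₃ ∷ []) e refl = with-leaves y₁ y₂ y₃ e
        (choose (red v ∖ ⟪ x ∷ ys ⟫) l ([] ∷ []) enough)

  -- Rims and leaves are searched for as vectors, since functions on `Fin 8` cannot be enumerated up
  -- to propositional equality; `Vec.tabulate` leads back.
  ∃-vec? : ∀ k {P : Vec (Fin N) k → Set} → (∀ v → Dec (P v)) → Dec (∃ P)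
  ∃-vec? zero    P? = map′ (λ p → [] , p) (λ { ([] , p) → p }) (P? [])
  ∃-vec? (suc k) P? = map′ (λ { (x , v , p) → x ∷ v , p }) (λ { (x ∷ v , p) → x , v , p })
    (any? λ x → ∃-vec? k λ v → P? (x ∷ v))

  wheel? : ∀ h c → Dec (IsWheel h c)
  wheel? h c = map′ (λ { (i , s , e) → wheel i s e }) (λ { (wheel i s e) → i , s , e })
    ((all? λ i → all? λ j → (c i ≟ c j) →-dec (i ≟ j)) ×-dec
     (all? λ i → _ ≟ᵇ true) ×-dec (all? λ i → _ ≟ᵇ true))

  tree? : ∀ n v w x ys → Dec (IsTree colouring n v w x ys)
  tree? n v w x ys = map′ (λ { (a , b , c , d , e , f) → tree a b c d e f })
    (λ { (tree a b c d e f) → a , b , c , d , e , f })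
    ((length ys ℕₚ.≟ 3) ×-dec (_ ≟ᵇ true) ×-dec (_ ≟ᵇ true) ×-dec All.all? (λ _ → _ ≟ᵇ true) ys
      ×-dec unique? (v ∷ w ∷ x ∷ ys) ×-dec (n ≤? 5 + # (red v ∖ ⟪ x ∷ ys ⟫)))

  wheel-or-tree : ∀ n → 9 ≤ n → N + 1 ≡ n + n → Fin N → ∀ l → n ≡ suc (l + 5) → Sn5 n ⊆ F ⊎ W8 ⊆ complement F
  wheel-or-tree n 9≤n N+1≡2n vertex l n≡ =
    conclude (any? λ h → ∃-vec? 8 λ c → wheel? h (lookup c))
             (any? λ v → any? λ w → any? λ x → ∃-vec? 3 λ ys → tree? n v w x (Vec.toList ys))
    where
    conclude : Dec (∃ λ h → ∃ λ (c : Vec (Fin N) 8) → IsWheel h (lookup c)) →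
      Dec (∃ λ v → ∃ λ w → ∃ λ x → ∃ λ (ys : Vec (Fin N) 3) → IsTree colouring n v w x (Vec.toList ys)) →
      Sn5 n ⊆ F ⊎ W8 ⊆ complement F
    conclude (yes (_ , _ , W)) _ = inj₂ (wheel-embeds W)
    conclude (no _) (yes (v , w , x , ys , t)) = inj₁ (embed n≡ t)
      where
      embed : ∀ {n} → n ≡ suc (l + 5) → IsTree colouring n v w x (Vec.toList ys) → Sn5 n ⊆ F
      embed refl t = Tree-embeds.embeds l v w x (Vec.toList ys) t
    conclude (no ¬W) (no ¬t) = ⊥-elim (Critical.impossible colouring n 9≤n N+1≡2n wheel-free tree-free vertex)
      where
      wheel-free : ∀ h c → ¬ IsWheel h c
      wheel-free h c (wheel i s e) = ¬W (h , Vec.tabulate c , wheel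
        (λ j k eq → i j k (trans (sym (lookup∘tabulate c j)) (trans eq (lookup∘tabulate c k))))
        (λ j → subst (_∈ blue h) (sym (lookup∘tabulate c j)) (s j))
        (λ j → subst₂ (λ y z → y ∈ blue z) (sym (lookup∘tabulate c (next j))) (sym (lookup∘tabulate c j)) (e j)))
      tree-free : ∀ v w x ys → ¬ IsTree colouring n v w x ys
      tree-free v w x (y₁ ∷ y₂ ∷ y₃ ∷ []) t@(tree refl _ _ _ _ _) = ¬t (v , w , x , y₁ ∷ y₂ ∷ y₃ ∷ [] , t)

-- The lower bound

sameSide : Bool → Bool → Bool
sameSide true  b = b
sameSide false b = not b

sameSide-refl : ∀ b → sameSide b b ≡ true
sameSide-refl true  = refl
sameSide-refl false = refl

sameSide⇒≡ : ∀ {a b} → sameSide a b ≡ true → a ≡ b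
sameSide⇒≡ {true}  {true}  _ = refl
sameSide⇒≡ {false} {false} _ = refl

three-Bools : ∀ (a b c : Bool) → a ≢ b → b ≢ c → a ≢ c → ⊥
three-Bools true  true  c     h _ _ = h refl
three-Bools true  false true  _ _ h = h refl
three-Bools true  false false _ h _ = h refl
three-Bools false false c     h _ _ = h refl
three-Bools false true  false _ _ h = h refl
three-Bools false true  true  _ h _ = h refl

below : ∀ {M} → ℕ → Sub M
below k x = toℕ x <ᵇ k

#-below : ∀ M k → # (below {M} k) ≤ k
#-below zero    k       = z≤n
#-below (suc M) zero    = #-below M zero
#-below (suc M) (suc k) = s≤s (#-below M k)

#-above : ∀ M k → # (λ (x : Fin M) → not (below k x)) ≤ M ∸ k
#-above zero    k       = z≤n
#-above (suc M) zero    = s≤s (#-above M zero)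
#-above (suc M) (suc k) = #-above M k

module Cliques (M s : ℕ) where

  side : Sub M
  side = below s

  -- The order `M` is arbitrary, so each M < 2n - 1 is refuted directly, without monotonicity of the
  -- Ramsey property.
  cliques : Graph M
  cliques = mkGraph λ x y → sameSide (side x) (side y)

  red-same : ∀ x y → adj cliques x y ≡ true → side x ≡ side y
  red-same x y h = [ sameSide⇒≡ , sym ∘ sameSide⇒≡ ]′ (∨-true (sameSide (side x) (side y))
    (∧-right {not (x ==ᶠ y)} h))

  blue-different : ∀ x y → adj (complement cliques) x y ≡ true → side x ≢ side y
  blue-different x y h e = true≢false
    (∧-intro (∧-left h) (cong (_∨ sameSide (side y) (side x)) (trans (cong (sameSide (side x)) (sym e))
      (sameSide-refl (side x)))))
    (Embeddings.complement-edge cliques x y h)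

  -- The hub and two consecutive rim vertices form a triangle.
  no-W8 : ¬ (W8 ⊆ complement cliques)
  no-W8 (f , _ , edge) = three-Bools (side (f 0F)) (side (f 1F)) (side (f 2F))
    (blue-different (f 0F) (f 1F) (edge 0F 1F refl)) (blue-different (f 1F) (f 2F) (edge 1F 2F refl))
      (blue-different (f 0F) (f 2F) (edge 0F 2F refl))

  module _ (l : ℕ) (s≡ : s ≡ l + 5) (M≤ : M ≤ s + s) where
    open Sn5-edges l

    -- The tree is connected and red edges stay on one side, so n vertices would have to fit into a
    -- side of at most n - 1.
    no-Sn5 : ¬ (Sn5 n ⊆ cliques)
    no-Sn5 (f , injective , f-edge) = crowded (side (f zero)) refl
      where
      joined : ∀ i j → i ≢ j → Edge (toℕ i) (toℕ j) → side (f i) ≡ side (f j)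
      joined i j i≢j e = red-same (f i) (f j) (f-edge i j (edge i j i≢j e))
      c d : Fin n
      c = suc (l Fin.↑ʳ 0F)
      d = suc (l Fin.↑ʳ 1F)
      toℕ-c : toℕ c ≡ suc l
      toℕ-c = cong suc (trans (Finₚ.toℕ-↑ʳ l (zero {4})) (+-identityʳ l))
      toℕ-d : toℕ d ≡ suc (suc l)
      toℕ-d = cong suc (trans (Finₚ.toℕ-↑ʳ l (suc (zero {3}))) (+-comm l 1))
      differ : ∀ (i j : Fin n) → toℕ i ≢ toℕ j → i ≢ j
      differ i j h e = h (cong toℕ e)
      near : ∀ i → 1 ≤ toℕ i → toℕ i ≤ suc l → side (f i) ≡ side (f zero)
      near i 1≤i i≤ = sym (joined zero i (differ zero i λ e → case subst (1 ≤_) (sym e) 1≤i of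
        λ ()) (large refl 1≤i i≤))
      far : ∀ i → suc l ≤ toℕ i → toℕ i ≢ suc (suc l) → side (f i) ≡ side (f d)
      far i ≤i i≢ = sym (joined d i (differ d i λ e → i≢ (trans (sym e) toℕ-d)) (small toℕ-d ≤i i≢))
      d-side : side (f d) ≡ side (f zero)
      d-side = trans (sym (far c (≤-reflexive (sym toℕ-c)) λ e → 1+n≢n (trans (sym e) toℕ-c)))
        (near c (subst (1 ≤_) (sym toℕ-c) (s≤s z≤n)) (≤-reflexive toℕ-c))
      connected : ∀ i → side (f i) ≡ side (f zero)
      connected zero    = refl
      connected (suc i) = [ near (suc i) (s≤s z≤n) , beyond ]′ (halves (toℕ (suc i)) (suc l))
        where
        beyond : suc l < toℕ (suc i) → side (f (suc i)) ≡ side (f zero)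
        beyond h with toℕ (suc i) ℕₚ.≟ suc (suc l)
        ... | yes e = trans (cong (side ∘ f) (Finₚ.toℕ-injective (trans e (sym toℕ-d)))) d-side
        ... | no ≢  = trans (far (suc i) (≤-trans (n≤1+n (suc l)) h) ≢) d-side
      too-many : ∀ (p : Sub M) → (∀ i → f i ∈ p) → # p ≤ s → ⊥
      too-many p h p≤ = 1+n≰n (≤-trans (≤-trans (≤-reflexive (trans (cong suc s≡) (sym (length-tabulate f))))
        (length-≤ p (Uniqueₚ.tabulate⁺ injective) (Allₚ.tabulate⁺ h))) p≤)
      crowded : ∀ b → side (f zero) ≡ b → ⊥
      crowded true  e = too-many side (λ i → trans (connected i) e) (#-below M s)
      crowded false e = too-many (λ x → not (side x)) (λ i → not-intro (trans (connected i) e))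
        (≤-trans (#-above M s) (≤-trans (∸-monoˡ-≤ s M≤) (≤-reflexive (m+n∸n≡m s s))))

theorem20 : (n : ℕ) → 9 ≤ n → IsRamseyNumber (Sn5 n) W8 (2 * n ∸ 1)
theorem20 n 9≤n = upper , lower
  where
  l : ℕ
  l = n ∸ 6
  n≡ : n ≡ suc (l + 5)
  n≡ = trans (sym (m∸n+n≡m (≤-trans (m≤m+n 6 3) 9≤n))) (+-suc l 5)
  N+1≡2n : 2 * n ∸ 1 + 1 ≡ n + n
  N+1≡2n = trans (m∸n+n≡m (≤-trans (≤-trans (s≤s z≤n) 9≤n) (m≤m+n n (n + 0)))) (cong (n +_) (+-identityʳ n))
  upper : RamseyProp (Sn5 n) W8 (2 * n ∸ 1)
  upper F = Embeddings.wheel-or-tree F n 9≤n N+1≡2n (Fin.fromℕ< positive) l n≡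
    where
    positive : 0 < 2 * n ∸ 1
    positive = linear (2 * n ∸ 1 ∷ n ∷ []) (λ N n → N ⊕ K 1 ≐ n ⊕ n ∷ K 9 ≼ n ∷ [] ⊢ K 1 ≼ N) N+1≡2n 9≤n
  lower : ∀ M → RamseyProp (Sn5 n) W8 M → 2 * n ∸ 1 ≤ M
  lower M ramsey = [ id , (λ small → ⊥-elim (exclude n≡ ramsey small)) ]′ (halves (2 * n ∸ 1) M)
    where
    exclude : ∀ {n′} → n′ ≡ suc (l + 5) → RamseyProp (Sn5 n′) W8 M → M < 2 * n ∸ 1 → ⊥
    exclude refl ramsey small = [ no-Sn5 l refl (linear (2 * n ∸ 1 ∷ n ∷ M ∷ l ∷ [])
        (λ N n M l → N ⊕ K 1 ≐ n ⊕ n ∷ n ≐ K 1 ⊕ (l ⊕ K 5) ∷ M ≺ N ∷ [] ⊢ M ≼ l ⊕ K 5 ⊕ (l ⊕ K 5)) N+1≡2n n≡ small)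
      , no-W8 ]′ (ramsey cliques)
      where open Cliques M (l + 5)
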